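{- Let $q\ge3$, let $g\in\mathbb{F}_q[t]$ be a non-constant square-free polynomial, and let $\ell$ be a prime factor of $q-1$. Let $P_1,\dots,P_s$ be all the monic irreducible factors of $g$ whose degrees do not divide $\deg g$, and assume $\deg P_i=\ell$ for all $1\le i\le s$. Then there exist infinitely many cyclic extensions $K$ of $\mathbb{F}_q(t)$ of degree $\ell$ whose discriminants are relatively prime to $g$ such that $g$ is Carmichael in $K$.
   Context: $\mathbb{F}_q$ is the finite field with $q$ elements. A finite ring $S$ is a Carmichael ring if $S$ is not a field and $a^{|S|}=a$ for every $a\in S$; an ideal $I$ of a ring $R$ is a Carmichael ideal if $R/I$ is a Carmichael ring. For a finite extension $K$ of $\mathbb{F}_q(t)$, $\mathcal{O}_K$ denotes the integral closure of $\mathbb{F}_q[t]$ in $K$, and an element $\alpha\in\mathcal{O}_K$ is Carmichael in $K$ if $\alpha\mathcal{O}_K$ is a Carmichael ideal of $\mathcal{O}_K$. The discriminant of $K$ is the discriminant ideal of $\mathcal{O}_K$ over $\mathbb{F}_q[t]$; "relatively prime to $g$" means no irreducible factor of $g$ divides it. -}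

module Defs where

import Algebra.Definitions.RawMonoid as RawMonoidDefinitions
import Algebra.Definitions.RawSemiring as RawSemiringDefinitions
import Algebra.Morphism.Construct.Composition as Composition
import Algebra.Morphism.Construct.Identity as Identity
import Data.Fin.Properties as Fin
import Data.Nat.Base as ℕ
import Data.Nat.Properties as ℕ
import Relation.Binary.PropositionalEquality.Core as ≡
import Relation.Binary.PropositionalEquality.Properties as ≡
import Relation.Binary.Reasoning.Setoid as SetoidReasoning
open import Algebra.Bundles using (CommutativeRing; Group; Semiring)
open import Algebra.Morphism.Structures using (module RingMorphisms)
open import Data.Empty using (⊥-elim)
open import Data.Fin.Base using (Fin; zero; suc; toℕ; fromℕ<; remQuot; combine; punchIn)
open import Data.Fin.Properties using (toℕ<n; toℕ-fromℕ<; remQuot-combine)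
open import Data.Integer.Base using (ℤ; +_; -[1+_])
open import Data.List.Base using (List; []; _∷_; map)
open import Data.Nat.Base using (ℕ; zero; suc)
open import Data.Product.Base using (Σ; ∃; _×_; _,_; proj₁; proj₂)
open import Data.Sum.Base using (_⊎_; inj₁; inj₂)
open import Function.Base using (_∘_; id)
open import Function.Bundles using (Inverse)
open import Level using (Level; _⊔_) renaming (suc to lsuc)
open import Relation.Binary.Bundles using (Setoid)
open import Relation.Binary.Definitions using (Decidable)
open import Relation.Binary.PropositionalEquality.Core using (_≡_; _≢_)
open import Relation.Nullary using (¬_; yes; no)
open import Relation.Nullary.Decidable using (map′)

module CommRing {c e} (R : CommutativeRing c e) where
  open CommutativeRing R public hiding (zero)
  open RawSemiringDefinitions (Semiring.rawSemiring semiring) public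
    using (_^_; _∣_; Irreducible; sum)

HasCardinality : ∀ {c e} → CommutativeRing c e → ℕ → Set (c ⊔ e)
HasCardinality R n = Inverse (CommutativeRing.setoid R) (≡.setoid (Fin n))

IsField : ∀ {c e} → CommutativeRing c e → Set (c ⊔ e)
IsField R = ¬ (0# ≈ 1#) × (∀ x → ¬ (x ≈ 0#) → ∃ λ y → x * y ≈ 1#)
  where open CommutativeRing R

record Field c e : Set (lsuc (c ⊔ e)) where
  field
    commutativeRing : CommutativeRing c e
    isField         : IsField commutativeRing

  open CommutativeRing commutativeRing public

IsCarmichaelRing : ∀ {c e} → CommutativeRing c e → Set (c ⊔ e)
IsCarmichaelRing S =
  ¬ IsField S ×
  ∃ λ n → HasCardinality S n × (∀ a → a ^ n ≈ a)
  where open CommRing S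

record Ideal {c e} (R : CommutativeRing c e) (p : Level) : Set (c ⊔ e ⊔ lsuc p) where
  open CommutativeRing R
  field
    Member   : Carrier → Set p
    ∈-resp-≈ : ∀ {x y} → x ≈ y → Member x → Member y
    0∈       : Member 0#
    +-closed : ∀ {x y} → Member x → Member y → Member (x + y)
    *-closed : ∀ x {y} → Member y → Member (x * y)

module _ {c e p} (R : CommutativeRing c e) (I : Ideal R p) where
  open CommutativeRing R
  open Ideal I
  open import Algebra.Properties.AbelianGroup +-abelianGroup using (⁻¹-∙-comm; ⁻¹-anti-homo‿-)
  open import Algebra.Properties.CommutativeSemigroup +-commutativeSemigroup using (interchange)
  open import Algebra.Properties.Ring ring using (-1*x≈-x; x[y-z]≈xy-xz)

  private
    telescope : ∀ x y z → (x - y) + (y - z) ≈ x - z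
    telescope x y z = begin
      (x - y) + (y - z)    ≈⟨ +-assoc x (- y) (y - z) ⟩
      x + (- y + (y - z))  ≈⟨ +-congˡ (+-assoc (- y) y (- z)) ⟨
      x + ((- y + y) - z)  ≈⟨ +-congˡ (+-congʳ (-‿inverseˡ y)) ⟩
      x + (0# - z)         ≈⟨ +-congˡ (+-identityˡ (- z)) ⟩
      x - z                ∎
      where open SetoidReasoning setoid

    from-≈ : ∀ {x y} → x ≈ y → Member (x - y)
    from-≈ {x} {y} x≈y = ∈-resp-≈ (sym (trans (+-congʳ x≈y) (-‿inverseʳ y))) 0∈

    neg-closed : ∀ {x} → Member x → Member (- x)
    neg-closed {x} m = ∈-resp-≈ (-1*x≈-x x) (*-closed (- 1#) m)

    *-cong-mod : ∀ {x y u v} → Member (x - y) → Member (u - v) → Member (x * u - y * v)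
    *-cong-mod {x} {y} {u} {v} m n = ∈-resp-≈ eq (+-closed (*-closed u m) (*-closed y n))
      where
      eq : u * (x - y) + y * (u - v) ≈ x * u - y * v
      eq = begin
        u * (x - y) + y * (u - v)              ≈⟨ +-cong (x[y-z]≈xy-xz u x y) (x[y-z]≈xy-xz y u v) ⟩
        (u * x - u * y) + (y * u - y * v)      ≈⟨ +-congʳ (+-cong (*-comm u x) (-‿cong (*-comm u y))) ⟩
        (x * u - y * u) + (y * u - y * v)      ≈⟨ telescope _ _ _ ⟩
        x * u - y * v                          ∎
        where open SetoidReasoning setoid

  quotientRing : CommutativeRing c p
  quotientRing = record
    { Carrier = Carrier
    ; _≈_ = λ x y → Member (x - y)
    ; _+_ = _+_ ; _*_ = _*_ ; -_ = -_ ; 0# = 0# ; 1# = 1#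
    ; isCommutativeRing = record
      { isRing = record
        { +-isAbelianGroup = record
          { isGroup = record
            { isMonoid = record
              { isSemigroup = record
                { isMagma = record
                  { isEquivalence = record
                    { refl  = from-≈ refl
                    ; sym   = λ m → ∈-resp-≈ (⁻¹-anti-homo‿- _ _) (neg-closed m)
                    ; trans = λ m n → ∈-resp-≈ (telescope _ _ _) (+-closed m n)
                    }
                  ; ∙-cong = λ {x} {y} {u} {v} m n → ∈-resp-≈
                      (trans (interchange x (- y) u (- v)) (+-congˡ (⁻¹-∙-comm y v)))
                      (+-closed m n)
                  }
                ; assoc = λ x y z → from-≈ (+-assoc x y z)
                }
              ; identity = (λ x → from-≈ (+-identityˡ x)) , (λ x → from-≈ (+-identityʳ x))
              }
            ; inverse = (λ x → from-≈ (-‿inverseˡ x)) , (λ x → from-≈ (-‿inverseʳ x))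
            ; ⁻¹-cong = λ {x} {y} m → ∈-resp-≈ (sym (⁻¹-∙-comm x (- y))) (neg-closed m)
            }
          ; comm = λ x y → from-≈ (+-comm x y)
          }
        ; *-cong = *-cong-mod
        ; *-assoc = λ x y z → from-≈ (*-assoc x y z)
        ; *-identity = (λ x → from-≈ (*-identityˡ x)) , (λ x → from-≈ (*-identityʳ x))
        ; distrib = (λ x y z → from-≈ (distribˡ x y z)) , (λ x y z → from-≈ (distribʳ x y z))
        }
      ; *-comm = λ x y → from-≈ (*-comm x y)
      }
    }

module _ {c e} (R : CommutativeRing c e) where
  open CommRing R
  open import Algebra.Definitions.RawMagma *-rawMagma using (_,_)

  principalIdeal : Carrier → Ideal R (c ⊔ e)
  principalIdeal a = record
    { Member   = λ x → a ∣ x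
    ; ∈-resp-≈ = λ x≈y (q , qa≈x) → q , trans qa≈x x≈y
    ; 0∈       = 0# , zeroˡ a
    ; +-closed = λ (q , qa≈x) (r , ra≈y) → q + r , trans (distribʳ a q r) (+-cong qa≈x ra≈y)
    ; *-closed = λ x (q , qa≈y) → x * q , trans (*-assoc x q a) (*-congˡ qa≈y)
    }

  IsCarmichaelIdeal : ∀ {p} → Ideal R p → Set (c ⊔ p)
  IsCarmichaelIdeal I = IsCarmichaelRing (quotientRing R I)

module _ {c e} (R : CommutativeRing c e) where
  open CommRing R

  det : ∀ {n} → (Fin n → Fin n → Carrier) → Carrier
  det {zero}  M = 1#
  det {suc n} M = sum λ j →
    (- 1#) ^ toℕ j * (M zero j * det (λ i k → M (suc i) (punchIn j k)))

-- A polynomial is a list of coefficients, constant term first; trailing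
-- zeros are allowed, so equality compares all coefficients.
module Polynomials {c e} (R : CommutativeRing c e) where
  open CommRing R

  Poly : Set c
  Poly = List Carrier

  coeff : Poly → ℕ → Carrier
  coeff []      _       = 0#
  coeff (a ∷ p) zero    = a
  coeff (a ∷ p) (suc n) = coeff p n

  infix 4 _≈ₚ_
  record _≈ₚ_ (p q : Poly) : Set e where
    constructor coeffs
    field coeff-≈ : ∀ n → coeff p n ≈ coeff q n
  open _≈ₚ_ public

  infixl 6 _+ₚ_
  _+ₚ_ : Poly → Poly → Poly
  []      +ₚ q       = q
  (a ∷ p) +ₚ []      = a ∷ p
  (a ∷ p) +ₚ (b ∷ q) = a + b ∷ p +ₚ q

  -ₚ_ : Poly → Poly
  -ₚ_ = map (-_)

  scale : Carrier → Poly → Poly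
  scale a = map (a *_)

  infixl 7 _*ₚ_
  _*ₚ_ : Poly → Poly → Poly
  []      *ₚ q = []
  (a ∷ p) *ₚ q = scale a q +ₚ (0# ∷ p *ₚ q)

  1ₚ : Poly
  1ₚ = 1# ∷ []

  HasDegree : Poly → ℕ → Set e
  HasDegree p n = ¬ (coeff p n ≈ 0#) × (∀ m → n ℕ.< m → coeff p m ≈ 0#)

  IsMonicOfDegree : Poly → ℕ → Set e
  IsMonicOfDegree p n = coeff p n ≈ 1# × (∀ m → n ℕ.< m → coeff p m ≈ 0#)

  polySetoid : Setoid c e
  polySetoid = record
    { Carrier = Poly
    ; _≈_ = _≈ₚ_
    ; isEquivalence = record
      { refl  = coeffs λ n → refl
      ; sym   = λ p≈q → coeffs λ n → sym (coeff-≈ p≈q n)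
      ; trans = λ p≈q q≈r → coeffs λ n → trans (coeff-≈ p≈q n) (coeff-≈ q≈r n)
      }
    }

  private module P = Setoid polySetoid
  open SetoidReasoning polySetoid

  infixr 5 _∷-cong_
  _∷-cong_ : ∀ {a b p q} → a ≈ b → p ≈ₚ q → a ∷ p ≈ₚ b ∷ q
  a≈b ∷-cong p≈q = coeffs λ { zero → a≈b ; (suc n) → coeff-≈ p≈q n }

  tail-≈0 : ∀ {a p} → a ∷ p ≈ₚ [] → p ≈ₚ []
  tail-≈0 eq = coeffs λ n → coeff-≈ eq (suc n)

  0∷≈0 : ∀ {a p} → a ≈ 0# → p ≈ₚ [] → a ∷ p ≈ₚ []
  0∷≈0 a≈0 p≈0 = coeffs λ { zero → a≈0 ; (suc n) → coeff-≈ p≈0 n }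

  coeff-+ : ∀ p q n → coeff (p +ₚ q) n ≈ coeff p n + coeff q n
  coeff-+ []      q       n       = sym (+-identityˡ _)
  coeff-+ (a ∷ p) []      n       = sym (+-identityʳ _)
  coeff-+ (a ∷ p) (b ∷ q) zero    = refl
  coeff-+ (a ∷ p) (b ∷ q) (suc n) = coeff-+ p q n

  coeff-neg : ∀ p n → coeff (-ₚ p) n ≈ - coeff p n
  coeff-neg []      n       = sym -0#≈0#
    where open import Algebra.Properties.Ring ring using (-0#≈0#)
  coeff-neg (a ∷ p) zero    = refl
  coeff-neg (a ∷ p) (suc n) = coeff-neg p n

  coeff-scale : ∀ a p n → coeff (scale a p) n ≈ a * coeff p n
  coeff-scale a []      n       = sym (zeroʳ a)
  coeff-scale a (b ∷ p) zero    = refl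
  coeff-scale a (b ∷ p) (suc n) = coeff-scale a p n

  by-coeff : ∀ {p q} (f g : ℕ → Carrier) → (∀ n → coeff p n ≈ f n) → (∀ n → coeff q n ≈ g n) →
             (∀ n → f n ≈ g n) → p ≈ₚ q
  by-coeff f g p≈f q≈g f≈g = coeffs λ n → trans (p≈f n) (trans (f≈g n) (sym (q≈g n)))

  +ₚ-cong : ∀ {p p′ q q′} → p ≈ₚ p′ → q ≈ₚ q′ → p +ₚ q ≈ₚ p′ +ₚ q′
  +ₚ-cong {p} {p′} {q} {q′} eq eq′ = by-coeff _ _ (coeff-+ p q) (coeff-+ p′ q′)
    λ n → +-cong (coeff-≈ eq n) (coeff-≈ eq′ n)

  +ₚ-assoc : ∀ p q r → (p +ₚ q) +ₚ r ≈ₚ p +ₚ (q +ₚ r)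
  +ₚ-assoc p q r = by-coeff _ _
    (λ n → trans (coeff-+ (p +ₚ q) r n) (+-congʳ (coeff-+ p q n)))
    (λ n → trans (coeff-+ p (q +ₚ r) n) (+-congˡ (coeff-+ q r n)))
    λ n → +-assoc _ _ _

  +ₚ-comm : ∀ p q → p +ₚ q ≈ₚ q +ₚ p
  +ₚ-comm p q = by-coeff _ _ (coeff-+ p q) (coeff-+ q p) λ n → +-comm _ _

  +ₚ-identityʳ : ∀ p → p +ₚ [] ≈ₚ p
  +ₚ-identityʳ p = P.trans (+ₚ-comm p []) P.refl

  -ₚ-cong : ∀ {p q} → p ≈ₚ q → -ₚ p ≈ₚ -ₚ q
  -ₚ-cong {p} {q} eq = by-coeff _ _ (coeff-neg p) (coeff-neg q) λ n → -‿cong (coeff-≈ eq n)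

  -ₚ-inverseʳ : ∀ p → p +ₚ (-ₚ p) ≈ₚ []
  -ₚ-inverseʳ p = coeffs λ n →
    trans (coeff-+ p (-ₚ p) n) (trans (+-congˡ (coeff-neg p n)) (-‿inverseʳ _))

  -ₚ-inverseˡ : ∀ p → (-ₚ p) +ₚ p ≈ₚ []
  -ₚ-inverseˡ p = P.trans (+ₚ-comm (-ₚ p) p) (-ₚ-inverseʳ p)

  interchange : ∀ p q r s → (p +ₚ q) +ₚ (r +ₚ s) ≈ₚ (p +ₚ r) +ₚ (q +ₚ s)
  interchange p q r s = begin
    (p +ₚ q) +ₚ (r +ₚ s) ≈⟨ +ₚ-assoc p q (r +ₚ s) ⟩
    p +ₚ (q +ₚ (r +ₚ s)) ≈⟨ +ₚ-cong {p} P.refl (+ₚ-assoc q r s) ⟨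
    p +ₚ ((q +ₚ r) +ₚ s) ≈⟨ +ₚ-cong {p} P.refl (+ₚ-cong (+ₚ-comm q r) P.refl) ⟩
    p +ₚ ((r +ₚ q) +ₚ s) ≈⟨ +ₚ-cong {p} P.refl (+ₚ-assoc r q s) ⟩
    p +ₚ (r +ₚ (q +ₚ s)) ≈⟨ +ₚ-assoc p r (q +ₚ s) ⟨
    (p +ₚ r) +ₚ (q +ₚ s) ∎

  scale-cong : ∀ {a b p q} → a ≈ b → p ≈ₚ q → scale a p ≈ₚ scale b q
  scale-cong {a} {b} {p} {q} a≈b p≈q = by-coeff _ _ (coeff-scale a p) (coeff-scale b q)
    λ n → *-cong a≈b (coeff-≈ p≈q n)

  scale-zero : ∀ {a} p → a ≈ 0# → scale a p ≈ₚ []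
  scale-zero {a} p a≈0 = coeffs λ n →
    trans (coeff-scale a p n) (trans (*-congʳ a≈0) (zeroˡ _))

  scale-one : ∀ p → scale 1# p ≈ₚ p
  scale-one p = coeffs λ n → trans (coeff-scale 1# p n) (*-identityˡ _)

  scale-+ : ∀ a p q → scale a (p +ₚ q) ≈ₚ scale a p +ₚ scale a q
  scale-+ a p q = by-coeff _ _
    (λ n → trans (coeff-scale a (p +ₚ q) n) (*-congˡ (coeff-+ p q n)))
    (λ n → trans (coeff-+ (scale a p) (scale a q) n) (+-cong (coeff-scale a p n) (coeff-scale a q n)))
    λ n → distribˡ _ _ _

  +-scale : ∀ a b p → scale (a + b) p ≈ₚ scale a p +ₚ scale b p
  +-scale a b p = by-coeff _ _ (coeff-scale (a + b) p)
    (λ n → trans (coeff-+ (scale a p) (scale b p) n) (+-cong (coeff-scale a p n) (coeff-scale b p n)))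
    λ n → distribʳ _ _ _

  scale-scale : ∀ a b p → scale a (scale b p) ≈ₚ scale (a * b) p
  scale-scale a b p = by-coeff _ _
    (λ n → trans (coeff-scale a (scale b p) n) (*-congˡ (coeff-scale b p n)))
    (coeff-scale (a * b) p)
    λ n → sym (*-assoc a b _)

  0∷-+ : ∀ p q → 0# ∷ (p +ₚ q) ≈ₚ (0# ∷ p) +ₚ (0# ∷ q)
  0∷-+ p q = sym (+-identityˡ 0#) ∷-cong P.refl

  *ₚ-congˡ : ∀ p {q q′} → q ≈ₚ q′ → p *ₚ q ≈ₚ p *ₚ q′
  *ₚ-congˡ []      q≈q′ = P.refl
  *ₚ-congˡ (a ∷ p) q≈q′ = +ₚ-cong (scale-cong refl q≈q′) (refl ∷-cong *ₚ-congˡ p q≈q′)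

  *ₚ-zeroʳ : ∀ p → p *ₚ [] ≈ₚ []
  *ₚ-zeroʳ []      = P.refl
  *ₚ-zeroʳ (a ∷ p) = 0∷≈0 refl (*ₚ-zeroʳ p)

  *ₚ-∷ : ∀ p b q → p *ₚ (b ∷ q) ≈ₚ scale b p +ₚ (0# ∷ p *ₚ q)
  *ₚ-∷ []      b q = P.sym (0∷≈0 refl P.refl)
  *ₚ-∷ (a ∷ p) b q = +-congʳ (*-comm a b) ∷-cong (begin
    scale a q +ₚ p *ₚ (b ∷ q)                  ≈⟨ +ₚ-cong {scale a q} P.refl (*ₚ-∷ p b q) ⟩
    scale a q +ₚ (scale b p +ₚ (0# ∷ p *ₚ q))  ≈⟨ +ₚ-assoc (scale a q) (scale b p) _ ⟨
    (scale a q +ₚ scale b p) +ₚ (0# ∷ p *ₚ q)  ≈⟨ +ₚ-cong (+ₚ-comm (scale a q) (scale b p)) P.refl ⟩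
    (scale b p +ₚ scale a q) +ₚ (0# ∷ p *ₚ q)  ≈⟨ +ₚ-assoc (scale b p) (scale a q) _ ⟩
    scale b p +ₚ (scale a q +ₚ (0# ∷ p *ₚ q))  ∎)

  *ₚ-comm : ∀ p q → p *ₚ q ≈ₚ q *ₚ p
  *ₚ-comm []      q = P.sym (*ₚ-zeroʳ q)
  *ₚ-comm (a ∷ p) q = begin
    scale a q +ₚ (0# ∷ p *ₚ q)  ≈⟨ +ₚ-cong {scale a q} P.refl (refl ∷-cong *ₚ-comm p q) ⟩
    scale a q +ₚ (0# ∷ q *ₚ p)  ≈⟨ *ₚ-∷ q a p ⟨
    q *ₚ (a ∷ p)                ∎

  *ₚ-cong : ∀ {p p′ q q′} → p ≈ₚ p′ → q ≈ₚ q′ → p *ₚ q ≈ₚ p′ *ₚ q′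
  *ₚ-cong {p} {p′} {q} {q′} p≈p′ q≈q′ = begin
    p *ₚ q    ≈⟨ *ₚ-congˡ p q≈q′ ⟩
    p *ₚ q′   ≈⟨ *ₚ-comm p q′ ⟩
    q′ *ₚ p   ≈⟨ *ₚ-congˡ q′ p≈p′ ⟩
    q′ *ₚ p′  ≈⟨ *ₚ-comm q′ p′ ⟩
    p′ *ₚ q′  ∎

  *ₚ-distribʳ : ∀ r p q → (p +ₚ q) *ₚ r ≈ₚ p *ₚ r +ₚ q *ₚ r
  *ₚ-distribʳ r []      q       = P.refl
  *ₚ-distribʳ r (a ∷ p) []      = P.sym (+ₚ-identityʳ _)
  *ₚ-distribʳ r (a ∷ p) (b ∷ q) = begin
    scale (a + b) r +ₚ (0# ∷ (p +ₚ q) *ₚ r)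
      ≈⟨ +ₚ-cong (+-scale a b r) (P.trans (refl ∷-cong *ₚ-distribʳ r p q) (0∷-+ (p *ₚ r) (q *ₚ r))) ⟩
    (scale a r +ₚ scale b r) +ₚ ((0# ∷ p *ₚ r) +ₚ (0# ∷ q *ₚ r))
      ≈⟨ interchange (scale a r) (scale b r) _ _ ⟩
    (scale a r +ₚ (0# ∷ p *ₚ r)) +ₚ (scale b r +ₚ (0# ∷ q *ₚ r)) ∎

  *ₚ-distribˡ : ∀ r p q → r *ₚ (p +ₚ q) ≈ₚ r *ₚ p +ₚ r *ₚ q
  *ₚ-distribˡ r p q = begin
    r *ₚ (p +ₚ q)     ≈⟨ *ₚ-comm r (p +ₚ q) ⟩
    (p +ₚ q) *ₚ r     ≈⟨ *ₚ-distribʳ r p q ⟩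
    p *ₚ r +ₚ q *ₚ r  ≈⟨ +ₚ-cong (*ₚ-comm p r) (*ₚ-comm q r) ⟩
    r *ₚ p +ₚ r *ₚ q  ∎

  scale-*ₚ : ∀ a p q → scale a p *ₚ q ≈ₚ scale a (p *ₚ q)
  scale-*ₚ a []      q = P.refl
  scale-*ₚ a (b ∷ p) q = begin
    scale (a * b) q +ₚ (0# ∷ scale a p *ₚ q)
      ≈⟨ +ₚ-cong (P.sym (scale-scale a b q)) (sym (zeroʳ a) ∷-cong scale-*ₚ a p q) ⟩
    scale a (scale b q) +ₚ scale a (0# ∷ p *ₚ q)
      ≈⟨ scale-+ a (scale b q) (0# ∷ p *ₚ q) ⟨
    scale a (scale b q +ₚ (0# ∷ p *ₚ q)) ∎

  *ₚ-assoc : ∀ p q r → (p *ₚ q) *ₚ r ≈ₚ p *ₚ (q *ₚ r)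
  *ₚ-assoc []      q r = P.refl
  *ₚ-assoc (a ∷ p) q r = begin
    (scale a q +ₚ (0# ∷ p *ₚ q)) *ₚ r
      ≈⟨ *ₚ-distribʳ r (scale a q) (0# ∷ p *ₚ q) ⟩
    scale a q *ₚ r +ₚ (scale 0# r +ₚ (0# ∷ (p *ₚ q) *ₚ r))
      ≈⟨ +ₚ-cong (scale-*ₚ a q r) (+ₚ-cong (scale-zero r refl) (refl ∷-cong *ₚ-assoc p q r)) ⟩
    scale a (q *ₚ r) +ₚ (0# ∷ p *ₚ (q *ₚ r)) ∎

  *ₚ-identityˡ : ∀ p → 1ₚ *ₚ p ≈ₚ p
  *ₚ-identityˡ p = begin
    scale 1# p +ₚ (0# ∷ [])  ≈⟨ +ₚ-cong (scale-one p) (0∷≈0 refl P.refl) ⟩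
    p +ₚ []                  ≈⟨ +ₚ-identityʳ p ⟩
    p                        ∎

  *ₚ-identityʳ : ∀ p → p *ₚ 1ₚ ≈ₚ p
  *ₚ-identityʳ p = P.trans (*ₚ-comm p 1ₚ) (*ₚ-identityˡ p)

  polynomialRing : CommutativeRing c e
  polynomialRing = record
    { Carrier = Poly
    ; _≈_ = _≈ₚ_
    ; _+_ = _+ₚ_ ; _*_ = _*ₚ_ ; -_ = -ₚ_ ; 0# = [] ; 1# = 1ₚ
    ; isCommutativeRing = record
      { isRing = record
        { +-isAbelianGroup = record
          { isGroup = record
            { isMonoid = record
              { isSemigroup = record
                { isMagma = record { isEquivalence = P.isEquivalence ; ∙-cong = +ₚ-cong }
                ; assoc = +ₚ-assoc
                }
              ; identity = (λ _ → P.refl) , +ₚ-identityʳ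
              }
            ; inverse = -ₚ-inverseˡ , -ₚ-inverseʳ
            ; ⁻¹-cong = -ₚ-cong
            }
          ; comm = +ₚ-comm
          }
        ; *-cong = *ₚ-cong
        ; *-assoc = *ₚ-assoc
        ; *-identity = *ₚ-identityˡ , *ₚ-identityʳ
        ; distrib = *ₚ-distribˡ , *ₚ-distribʳ
        }
      ; *-comm = *ₚ-comm
      }
    }

IsDomain : ∀ {c e} → CommutativeRing c e → Set (c ⊔ e)
IsDomain R = ¬ (0# ≈ 1#) × (∀ x y → x * y ≈ 0# → x ≈ 0# ⊎ y ≈ 0#)
  where open CommutativeRing R

module _ {c e} (F : Field c e) (_≟_ : Decidable (Field._≈_ F)) where
  open Field F hiding (zero)
  open Polynomials commutativeRing
  private
    module P = CommutativeRing polynomialRing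

    cancel : ∀ {a b} → ¬ (a ≈ 0#) → a * b ≈ 0# → b ≈ 0#
    cancel {a} {b} a≉0 ab≈0 with proj₂ isField a a≉0
    ... | a⁻¹ , aa⁻¹≈1 = begin
      b              ≈⟨ *-identityˡ b ⟨
      1# * b         ≈⟨ *-congʳ (trans (*-comm a⁻¹ a) aa⁻¹≈1) ⟨
      (a⁻¹ * a) * b  ≈⟨ *-assoc a⁻¹ a b ⟩
      a⁻¹ * (a * b)  ≈⟨ *-congˡ ab≈0 ⟩
      a⁻¹ * 0#       ≈⟨ zeroʳ a⁻¹ ⟩
      0#             ∎
      where open SetoidReasoning setoid

    drop-0 : ∀ {a} p q → a ≈ 0# → (a ∷ p) *ₚ q ≈ₚ [] → p *ₚ q ≈ₚ []
    drop-0 {a} p q a≈0 eq = tail-≈0 (P.trans (P.sym (P.+-congʳ {x = 0# ∷ p *ₚ q} (scale-zero q a≈0))) eq)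

    cancelₚ : ∀ a p q → ¬ (a ≈ 0#) → (a ∷ p) *ₚ q ≈ₚ [] → q ≈ₚ []
    cancelₚ a p []      a≉0 eq = P.refl
    cancelₚ a p (b ∷ q) a≉0 eq = 0∷≈0 b≈0 (cancelₚ a p q a≉0
      (P.trans (*ₚ-comm (a ∷ p) q)
        (drop-0 q (a ∷ p) b≈0 (P.trans (*ₚ-comm (b ∷ q) (a ∷ p)) eq))))
      where
      b≈0 : b ≈ 0#
      b≈0 = cancel a≉0 (trans (sym (+-identityʳ (a * b))) (coeff-≈ eq zero))

    noZeroDivisors : ∀ p q → p *ₚ q ≈ₚ [] → p ≈ₚ [] ⊎ q ≈ₚ []
    noZeroDivisors []      q eq = inj₁ P.refl
    noZeroDivisors (a ∷ p) q eq with a ≟ 0#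
    ... | no  a≉0 = inj₂ (cancelₚ a p q a≉0 eq)
    ... | yes a≈0 with noZeroDivisors p q (drop-0 p q a≈0 eq)
    ...   | inj₁ p≈0 = inj₁ (0∷≈0 a≈0 p≈0)
    ...   | inj₂ q≈0 = inj₂ q≈0

  polynomialRing-isDomain : IsDomain polynomialRing
  polynomialRing-isDomain = (λ 0≈1 → proj₁ isField (coeff-≈ 0≈1 zero)) , noZeroDivisors

IsHom : ∀ {a ℓ b ℓ′} (A : CommutativeRing a ℓ) (B : CommutativeRing b ℓ′) →
        (CommutativeRing.Carrier A → CommutativeRing.Carrier B) → Set (a ⊔ ℓ ⊔ ℓ′)
IsHom A B = RingMorphisms.IsRingHomomorphism (CommutativeRing.rawRing A) (CommutativeRing.rawRing B)

module FractionField {c e} (A : CommutativeRing c e) (domain : IsDomain A) where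
  open CommutativeRing A
  open import Algebra.Properties.Ring ring using (-‿distribˡ-*; [y-z]x≈yx-zx; x∙y⁻¹≈ε⇒x≈y)
  open import Algebra.Solver.Ring.NaturalCoefficients.Default commutativeSemiring
    using (solve; _:+_; _:*_; con; _:=_)

  record Fraction : Set (c ⊔ e) where
    constructor fraction
    field
      num   : Carrier
      den   : Carrier
      den≉0 : ¬ (den ≈ 0#)
  open Fraction public

  infix 4 _≈ᶠ_
  record _≈ᶠ_ (x y : Fraction) : Set e where
    constructor cross
    field cross-≈ : num x * den y ≈ num y * den x
  open _≈ᶠ_ public

  nonzero-* : ∀ {a b} → ¬ (a ≈ 0#) → ¬ (b ≈ 0#) → ¬ (a * b ≈ 0#)
  nonzero-* {a} {b} a≉0 b≉0 ab≈0 with proj₂ domain a b ab≈0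
  ... | inj₁ a≈0 = a≉0 a≈0
  ... | inj₂ b≈0 = b≉0 b≈0

  cancelʳ : ∀ {a b z} → ¬ (z ≈ 0#) → a * z ≈ b * z → a ≈ b
  cancelʳ {a} {b} {z} z≉0 eq with proj₂ domain (a - b) z
    (trans ([y-z]x≈yx-zx z a b) (trans (+-congʳ eq) (-‿inverseʳ (b * z))))
  ... | inj₁ a-b≈0 = x∙y⁻¹≈ε⇒x≈y a b a-b≈0
  ... | inj₂ z≈0   = ⊥-elim (z≉0 z≈0)

  infixl 6 _+ᶠ_
  infixl 7 _*ᶠ_
  _+ᶠ_ _*ᶠ_ : Fraction → Fraction → Fraction
  x +ᶠ y = fraction (num x * den y + num y * den x) (den x * den y) (nonzero-* (den≉0 x) (den≉0 y))
  x *ᶠ y = fraction (num x * num y) (den x * den y) (nonzero-* (den≉0 x) (den≉0 y))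

  -ᶠ_ : Fraction → Fraction
  -ᶠ x = fraction (- num x) (den x) (den≉0 x)

  fromA : Carrier → Fraction
  fromA a = fraction a 1# (proj₁ domain ∘ sym)

  private
    open SetoidReasoning setoid

    ≈ᶠ-trans : ∀ {x y z} → x ≈ᶠ y → y ≈ᶠ z → x ≈ᶠ z
    ≈ᶠ-trans {fraction a b _} {fraction a′ b′ b′≉0} {fraction a″ b″ _} (cross p) (cross q) =
      cross (cancelʳ b′≉0 (begin
        (a * b″) * b′  ≈⟨ solve 3 (λ x y z → (x :* y) :* z := (x :* z) :* y) refl a b″ b′ ⟩
        (a * b′) * b″  ≈⟨ *-congʳ p ⟩
        (a′ * b) * b″  ≈⟨ solve 3 (λ x y z → (x :* y) :* z := (x :* z) :* y) refl a′ b b″ ⟩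
        (a′ * b″) * b  ≈⟨ *-congʳ q ⟩
        (a″ * b′) * b  ≈⟨ solve 3 (λ x y z → (x :* y) :* z := (x :* z) :* y) refl a″ b′ b ⟩
        (a″ * b) * b′  ∎))

    +ᶠ-cong : ∀ {x x′ y y′} → x ≈ᶠ x′ → y ≈ᶠ y′ → x +ᶠ y ≈ᶠ x′ +ᶠ y′
    +ᶠ-cong {fraction a b _} {fraction a′ b′ _} {fraction c d _} {fraction c′ d′ _} (cross p) (cross q) = cross (begin
      (a * d + c * b) * (b′ * d′)
        ≈⟨ solve 6 (λ a b c d b′ d′ → (a :* d :+ c :* b) :* (b′ :* d′)
                     := (a :* b′) :* (d :* d′) :+ (c :* d′) :* (b :* b′)) refl a b c d b′ d′ ⟩
      (a * b′) * (d * d′) + (c * d′) * (b * b′)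
        ≈⟨ +-cong (*-congʳ p) (*-congʳ q) ⟩
      (a′ * b) * (d * d′) + (c′ * d) * (b * b′)
        ≈⟨ solve 6 (λ a′ b c′ d b′ d′ → (a′ :* b) :* (d :* d′) :+ (c′ :* d) :* (b :* b′)
                     := (a′ :* d′ :+ c′ :* b′) :* (b :* d)) refl a′ b c′ d b′ d′ ⟩
      (a′ * d′ + c′ * b′) * (b * d) ∎)

    *ᶠ-cong : ∀ {x x′ y y′} → x ≈ᶠ x′ → y ≈ᶠ y′ → x *ᶠ y ≈ᶠ x′ *ᶠ y′
    *ᶠ-cong {fraction a b _} {fraction a′ b′ _} {fraction c d _} {fraction c′ d′ _} (cross p) (cross q) = cross (begin
      (a * c) * (b′ * d′)  ≈⟨ solve 4 (λ x y z w → (x :* y) :* (z :* w) := (x :* z) :* (y :* w)) refl a c b′ d′ ⟩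
      (a * b′) * (c * d′)  ≈⟨ *-cong p q ⟩
      (a′ * b) * (c′ * d)  ≈⟨ solve 4 (λ x y z w → (x :* y) :* (z :* w) := (x :* z) :* (y :* w)) refl a′ b c′ d ⟩
      (a′ * c′) * (b * d)  ∎)

    -ᶠ-cong : ∀ {x y} → x ≈ᶠ y → -ᶠ x ≈ᶠ -ᶠ y
    -ᶠ-cong {fraction a b _} {fraction a′ b′ _} (cross p) = cross (begin
      - a * b′    ≈⟨ -‿distribˡ-* a b′ ⟨
      - (a * b′)  ≈⟨ -‿cong p ⟩
      - (a′ * b)  ≈⟨ -‿distribˡ-* a′ b ⟩
      - a′ * b    ∎)

    +ᶠ-comm : ∀ x y → x +ᶠ y ≈ᶠ y +ᶠ x
    +ᶠ-comm (fraction a b _) (fraction c d _) = cross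
      (solve 4 (λ a b c d → (a :* d :+ c :* b) :* (d :* b) := (c :* b :+ a :* d) :* (b :* d)) refl a b c d)

    +ᶠ-identityˡ : ∀ x → fromA 0# +ᶠ x ≈ᶠ x
    +ᶠ-identityˡ (fraction a b _) = cross
      (solve 2 (λ a b → (con 0 :* b :+ a :* con 1) :* b := a :* (con 1 :* b)) refl a b)

    -ᶠ-inverseˡ : ∀ x → -ᶠ x +ᶠ x ≈ᶠ fromA 0#
    -ᶠ-inverseˡ (fraction a b _) = cross (begin
      (- a * b + a * b) * 1#  ≈⟨ *-congʳ (distribʳ b (- a) a) ⟨
      ((- a + a) * b) * 1#    ≈⟨ *-congʳ (*-congʳ (-‿inverseˡ a)) ⟩
      (0# * b) * 1#           ≈⟨ solve 1 (λ b → (con 0 :* b) :* con 1 := con 0 :* (b :* b)) refl b ⟩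
      0# * (b * b)            ∎)

    *ᶠ-identityˡ : ∀ x → fromA 1# *ᶠ x ≈ᶠ x
    *ᶠ-identityˡ (fraction a b _) = cross
      (solve 2 (λ a b → (con 1 :* a) :* b := a :* (con 1 :* b)) refl a b)

    *ᶠ-comm : ∀ x y → x *ᶠ y ≈ᶠ y *ᶠ x
    *ᶠ-comm (fraction a b _) (fraction c d _) = cross
      (solve 4 (λ a b c d → (a :* c) :* (d :* b) := (c :* a) :* (b :* d)) refl a b c d)

    distribʳᶠ : ∀ x y z → (y +ᶠ z) *ᶠ x ≈ᶠ y *ᶠ x +ᶠ z *ᶠ x
    distribʳᶠ (fraction a b _) (fraction c d _) (fraction r s _) = cross
      (solve 6 (λ a b c d r s →
          ((c :* s :+ r :* d) :* a) :* ((d :* b) :* (s :* b))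
          := ((c :* a) :* (s :* b) :+ (r :* a) :* (d :* b)) :* ((d :* s) :* b)) refl a b c d r s)

    +ᶠ-assoc : ∀ x y z → (x +ᶠ y) +ᶠ z ≈ᶠ x +ᶠ (y +ᶠ z)
    +ᶠ-assoc (fraction a b _) (fraction c d _) (fraction r s _) = cross
      (solve 6 (λ a b c d r s →
          ((a :* d :+ c :* b) :* s :+ r :* (b :* d)) :* (b :* (d :* s))
          := (a :* (d :* s) :+ (c :* s :+ r :* d) :* b) :* ((b :* d) :* s)) refl a b c d r s)

    *ᶠ-assoc : ∀ x y z → (x *ᶠ y) *ᶠ z ≈ᶠ x *ᶠ (y *ᶠ z)
    *ᶠ-assoc (fraction a b _) (fraction c d _) (fraction r s _) = cross
      (solve 6 (λ a b c d r s →
          ((a :* c) :* r) :* (b :* (d :* s)) := (a :* (c :* r)) :* ((b :* d) :* s)) refl a b c d r s)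

  fractionRing : CommutativeRing (c ⊔ e) e
  fractionRing = record
    { Carrier = Fraction
    ; _≈_ = _≈ᶠ_
    ; _+_ = _+ᶠ_ ; _*_ = _*ᶠ_ ; -_ = -ᶠ_ ; 0# = fromA 0# ; 1# = fromA 1#
    ; isCommutativeRing = record
      { isRing = record
        { +-isAbelianGroup = record
          { isGroup = record
            { isMonoid = record
              { isSemigroup = record
                { isMagma = record
                  { isEquivalence = record
                    { refl = cross refl ; sym = λ (cross p) → cross (sym p) ; trans = ≈ᶠ-trans }
                  ; ∙-cong = +ᶠ-cong
                  }
                ; assoc = +ᶠ-assoc
                }
              ; identity = +ᶠ-identityˡ , λ x → ≈ᶠ-trans (+ᶠ-comm x (fromA 0#)) (+ᶠ-identityˡ x)
              }
            ; inverse = -ᶠ-inverseˡ , λ x → ≈ᶠ-trans (+ᶠ-comm x (-ᶠ x)) (-ᶠ-inverseˡ x)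
            ; ⁻¹-cong = -ᶠ-cong
            }
          ; comm = +ᶠ-comm
          }
        ; *-cong = *ᶠ-cong
        ; *-assoc = *ᶠ-assoc
        ; *-identity = *ᶠ-identityˡ , λ x → ≈ᶠ-trans (*ᶠ-comm x (fromA 1#)) (*ᶠ-identityˡ x)
        ; distrib = (λ x y z → ≈ᶠ-trans (*ᶠ-comm x (y +ᶠ z)) (≈ᶠ-trans (distribʳᶠ x y z)
                      (+ᶠ-cong (*ᶠ-comm y x) (*ᶠ-comm z x))))
                    , distribʳᶠ
        }
      ; *-comm = *ᶠ-comm
      }
    }

  fractionField : Field (c ⊔ e) e
  fractionField = record
    { commutativeRing = fractionRing
    ; isField =
        (λ (cross 0≈1) → proj₁ domain (trans (sym (*-identityʳ 0#)) (trans 0≈1 (*-identityʳ 1#)))) ,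
        λ x x≉0 → fraction (den x) (num x)
            (λ n≈0 → x≉0 (cross (trans (*-identityʳ _) (trans n≈0 (sym (zeroˡ (den x))))))) ,
          cross (solve 2 (λ a b → (a :* b) :* con 1 := con 1 :* (b :* a)) refl (num x) (den x))
    }

  fromA-isHom : IsHom A fractionRing fromA
  fromA-isHom = record
    { isSemiringHomomorphism = record
      { isNearSemiringHomomorphism = record
        { +-isMonoidHomomorphism = record
          { isMagmaHomomorphism = record
            { isRelHomomorphism = record { cong = λ eq → cross (*-congʳ eq) }
            ; homo = λ a b → cross
                (solve 2 (λ a b → (a :+ b) :* (con 1 :* con 1) := (a :* con 1 :+ b :* con 1) :* con 1) refl a b)
            }
          ; ε-homo = cross refl
          }
        ; *-homo = λ a b → cross
            (solve 2 (λ a b → (a :* b) :* (con 1 :* con 1) := (a :* b) :* con 1) refl a b)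
        }
      ; 1#-homo = cross refl
      }
    ; -‿homo = λ a → cross refl
    }

module IntegralClosure {a ℓ b ℓ′} (A : CommutativeRing a ℓ) (B : CommutativeRing b ℓ′)
  (f : CommutativeRing.Carrier A → CommutativeRing.Carrier B) (f-isHom : IsHom A B f) where
  private module A = CommutativeRing A
  open CommRing B

  IsIntegral : Carrier → Set (a ⊔ ℓ′)
  IsIntegral x = ∃ λ n → Σ (Fin n → A.Carrier) λ c →
    x ^ n + sum (λ i → f (c i) * x ^ toℕ i) ≈ 0#

  open RingMorphisms.IsRingHomomorphism f-isHom
  open import Algebra.Properties.Semiring.Sum semiring
    using (*-distribˡ-sum; *-distribʳ-sum; ∑-distrib-+; sum-cong-≋; sum-replicate-zero)
  open import Algebra.Solver.Ring.NaturalCoefficients.Default commutativeSemiring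
    using (solve; _:+_; _:*_; con; _:=_)
  open import Algebra.Properties.Ring ring using (-‿distribˡ-*; -0#≈0#; +-inverseˡ-unique)
  open SetoidReasoning setoid

  sum-0 : ∀ {n} {v : Fin n → Carrier} → (∀ i → v i ≈ 0#) → sum v ≈ 0#
  sum-0 {n} v≈0 = trans (sum-cong-≋ v≈0) (sum-replicate-zero n)

  -- Low d y (Monic d y): y is the value at x of a polynomial over A of
  -- degree below d (of a monic polynomial of degree d).
  module Values (x : Carrier) where
    data Low : ℕ → Carrier → Set (a ⊔ b ⊔ ℓ′) where
      zero : ∀ {y} → y ≈ 0# → Low zero y
      step : ∀ {d y z} c → Low d y → z ≈ f c + x * y → Low (suc d) z

    data Monic : ℕ → Carrier → Set (a ⊔ b ⊔ ℓ′) where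
      zero : ∀ {y} → y ≈ 1# → Monic zero y
      step : ∀ {d y z} c → Monic d y → z ≈ f c + x * y → Monic (suc d) z

    low-resp : ∀ {d y z} → y ≈ z → Low d y → Low d z
    low-resp y≈z (zero y≈0)    = zero (trans (sym y≈z) y≈0)
    low-resp y≈z (step c l eq) = step c l (trans (sym y≈z) eq)

    monic-resp : ∀ {d y z} → y ≈ z → Monic d y → Monic d z
    monic-resp y≈z (zero y≈1)    = zero (trans (sym y≈z) y≈1)
    monic-resp y≈z (step c l eq) = step c l (trans (sym y≈z) eq)

    low-0 : ∀ d → Low d 0#
    low-0 zero    = zero refl
    low-0 (suc d) = step A.0# (low-0 d) (sym (trans (+-cong 0#-homo (zeroʳ x)) (+-identityˡ 0#)))

    low-suc : ∀ {d y} → Low d y → Low (suc d) y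
    low-suc (zero y≈0)    = low-resp (sym y≈0) (low-0 1)
    low-suc (step c l eq) = step c (low-suc l) eq

    low-weaken : ∀ k {d y} → Low d y → Low (k ℕ.+ d) y
    low-weaken zero    l = l
    low-weaken (suc k) l = low-suc (low-weaken k l)

    low-scale : ∀ {d y} c → Low d y → Low d (f c * y)
    low-scale c (zero y≈0)    = zero (trans (*-congˡ y≈0) (zeroʳ (f c)))
    low-scale {y = z} c (step {y = y} c′ l eq) = step (c A.* c′) (low-scale c l) (begin
      f c * z                         ≈⟨ *-congˡ eq ⟩
      f c * (f c′ + x * y)            ≈⟨ solve 4 (λ p q r s → p :* (q :+ r :* s) := p :* q :+ r :* (p :* s))
                                           refl (f c) (f c′) x y ⟩
      f c * f c′ + x * (f c * y)      ≈⟨ +-congʳ (*-homo c c′) ⟨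
      f (c A.* c′) + x * (f c * y)    ∎)

    low-shift : ∀ {d y} → Low d y → Low (suc d) (x * y)
    low-shift l = step A.0# l (sym (trans (+-congʳ 0#-homo) (+-identityˡ _)))

    monic-shift : ∀ {d y} → Monic d y → Monic (suc d) (x * y)
    monic-shift m = step A.0# m (sym (trans (+-congʳ 0#-homo) (+-identityˡ _)))

    step-+ : ∀ {c c′ y y′ z z′} → z ≈ f c + x * y → z′ ≈ f c′ + x * y′ →
             z + z′ ≈ f (c A.+ c′) + x * (y + y′)
    step-+ {c} {c′} {y} {y′} {z} {z′} eq eq′ = begin
      z + z′                             ≈⟨ +-cong eq eq′ ⟩
      (f c + x * y) + (f c′ + x * y′)    ≈⟨ solve 5 (λ p q r s t → (p :+ r :* s) :+ (q :+ r :* t)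
                                              := (p :+ q) :+ r :* (s :+ t)) refl (f c) (f c′) x y y′ ⟩
      (f c + f c′) + x * (y + y′)        ≈⟨ +-congʳ (+-homo c c′) ⟨
      f (c A.+ c′) + x * (y + y′)        ∎

    low-+ : ∀ {d y z} → Low d y → Low d z → Low d (y + z)
    low-+ (zero p) (zero q) = zero (trans (+-cong p q) (+-identityˡ 0#))
    low-+ (step c l eq) (step c′ l′ eq′) = step (c A.+ c′) (low-+ l l′) (step-+ eq eq′)

    monic+low : ∀ {d y z} → Monic d y → Low d z → Monic d (y + z)
    monic+low (zero p) (zero q) = zero (trans (+-cong p q) (+-identityʳ 1#))
    monic+low (step c l eq) (step c′ l′ eq′) = step (c A.+ c′) (monic+low l l′) (step-+ eq eq′)

    monic⇒low : ∀ {d y} → Monic d y → Low (suc d) y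
    monic⇒low (zero y≈1) = step A.1# (zero refl)
      (trans y≈1 (sym (trans (+-cong 1#-homo (zeroʳ x)) (+-identityʳ 1#))))
    monic⇒low (step c m eq) = step c (monic⇒low m) eq

    step-* : ∀ {c y z} w → z ≈ f c + x * y → f c * w + x * (y * w) ≈ z * w
    step-* {c} {y} {z} w eq = sym (trans (*-congʳ eq)
      (solve 4 (λ p q r s → (p :+ q :* r) :* s := p :* s :+ q :* (r :* s)) refl (f c) x y w))

    low*low : ∀ {d d′ y z} → Low d y → Low d′ z → Low (d ℕ.+ d′) (y * z)
    low*low {d′ = d′} {z = z} (zero y≈0) l′ = low-resp (sym (trans (*-congʳ y≈0) (zeroˡ z))) (low-0 d′)
    low*low {suc d} {z = z} (step c l eq) l′ = low-resp (step-* z eq)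
      (low-+ (low-weaken (suc d) (low-scale c l′)) (low-shift (low*low l l′)))

    monic*low : ∀ {d d′ y z} → Monic d y → Low d′ z → Low (d ℕ.+ d′) (y * z)
    monic*low {z = z} (zero y≈1) l = low-resp (sym (trans (*-congʳ y≈1) (*-identityˡ z))) l
    monic*low {suc d} {z = z} (step c m eq) l = low-resp (step-* z eq)
      (low-+ (low-weaken (suc d) (low-scale c l)) (low-shift (monic*low m l)))

    monic*monic : ∀ {d d′ y z} → Monic d y → Monic d′ z → Monic (d ℕ.+ d′) (y * z)
    monic*monic {z = z} (zero y≈1) m = monic-resp (sym (trans (*-congʳ y≈1) (*-identityˡ z))) m
    monic*monic {suc d} {d′} {z = z} (step c m eq) m′ = monic-resp (trans (+-comm _ _) (step-* z eq))
      (monic+low (monic-shift (monic*monic m m′))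
        (≡.subst (λ k → Low k (f c * z)) (ℕ.+-suc d d′) (low-weaken d (low-scale c (monic⇒low m′)))))

    low-neg : ∀ {d y} → Low d y → Low d (- y)
    low-neg {y = y} l = low-resp (begin
      f (A.- A.1#) * y  ≈⟨ *-congʳ (trans (-‿homo A.1#) (-‿cong 1#-homo)) ⟩
      - 1# * y          ≈⟨ -‿distribˡ-* 1# y ⟨
      - (1# * y)        ≈⟨ -‿cong (*-identityˡ y) ⟩
      - y               ∎) (low-scale (A.- A.1#) l)

    Dominant : ∀ {n} → ℕ → (Fin n → Fin n → Carrier) → Set (a ⊔ b ⊔ ℓ′)
    Dominant d M = (∀ i → Monic d (M i i)) × (∀ i j → i ≢ j → Low d (M i j))

    -- Fraction-free elimination.
    annihilator : ∀ {n} d (M : Fin n → Fin n → Carrier) (v : Fin n → Carrier) → Dominant d M →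
      (∀ i → sum (λ j → M i j * v j) ≈ 0#) →
      ∃ λ k → ∃ λ p → Monic k p × (∀ j → p * v j ≈ 0#)
    annihilator {zero}  d M v _ _ = zero , 1# , zero refl , λ ()
    annihilator {suc n} d M v (diag , off) rows
      with annihilator (d ℕ.+ d) M′ (v ∘ suc) (diag′ , off′) rows′
      where
      p = M zero zero
      r : Fin n → Carrier
      r i = - M (suc i) zero
      M′ : Fin n → Fin n → Carrier
      M′ i j = p * M (suc i) (suc j) + r i * M zero (suc j)
      offʳ : ∀ i → Low d (r i)
      offʳ i = low-neg (off (suc i) zero λ ())
      suc-inj : ∀ {i j : Fin n} → i ≢ j → Fin.suc i ≢ suc j
      suc-inj i≢j ≡.refl = i≢j ≡.refl
      diag′ : ∀ i → Monic (d ℕ.+ d) (M′ i i)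
      diag′ i = monic+low (monic*monic (diag zero) (diag (suc i))) (low*low (offʳ i) (off zero (suc i) λ ()))
      off′ : ∀ i j → i ≢ j → Low (d ℕ.+ d) (M′ i j)
      off′ i j i≢j = low-+ (monic*low (diag zero) (off (suc i) (suc j) (suc-inj i≢j)))
                           (low*low (offʳ i) (off zero (suc j) λ ()))
      rows′ : ∀ i → sum (λ j → M′ i j * v (suc j)) ≈ 0#
      rows′ i = begin
        sum (λ j → M′ i j * v (suc j))
          ≈⟨ sum-cong-≋ (λ j → solve 5 (λ p m r m₀ w → (p :* m :+ r :* m₀) :* w
               := p :* (m :* w) :+ r :* (m₀ :* w)) refl p (M (suc i) (suc j)) (r i) (M zero (suc j)) (v (suc j))) ⟩
        sum (λ j → p * (M (suc i) (suc j) * v (suc j)) + r i * (M zero (suc j) * v (suc j)))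
          ≈⟨ ∑-distrib-+ (λ j → p * (M (suc i) (suc j) * v (suc j))) (λ j → r i * (M zero (suc j) * v (suc j))) ⟩
        sum (λ j → p * (M (suc i) (suc j) * v (suc j))) + sum (λ j → r i * (M zero (suc j) * v (suc j)))
          ≈⟨ +-cong (*-distribˡ-sum p (λ j → M (suc i) (suc j) * v (suc j)))
                    (*-distribˡ-sum (r i) (λ j → M zero (suc j) * v (suc j))) ⟨
        p * S₁ + r i * S₀
          ≈⟨ +-identityˡ _ ⟨
        0# + (p * S₁ + r i * S₀)
          ≈⟨ +-congʳ (trans (*-congʳ (-‿inverseʳ q)) (zeroˡ (p * v zero))) ⟨
        (q + r i) * (p * v zero) + (p * S₁ + r i * S₀)
          ≈⟨ solve 6 (λ q r p w s₁ s₀ → (q :+ r) :* (p :* w) :+ (p :* s₁ :+ r :* s₀)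
               := p :* (q :* w :+ s₁) :+ r :* (p :* w :+ s₀)) refl q (r i) p (v zero) S₁ S₀ ⟩
        p * (q * v zero + S₁) + r i * (p * v zero + S₀)
          ≈⟨ +-cong (*-congˡ (rows (suc i))) (*-congˡ (rows zero)) ⟩
        p * 0# + r i * 0#
          ≈⟨ solve 2 (λ p r → p :* con 0 :+ r :* con 0 := con 0) refl p (r i) ⟩
        0# ∎
        where
        q  = M (suc i) zero
        S₁ = sum (λ j → M (suc i) (suc j) * v (suc j))
        S₀ = sum (λ j → M zero (suc j) * v (suc j))
    ... | k , p′ , m , kills = k ℕ.+ d , p′ * p , monic*monic m (diag zero) , λ
      { zero → begin
          (p′ * p) * v zero                     ≈⟨ +-identityʳ _ ⟨
          (p′ * p) * v zero + 0#                ≈⟨ +-congˡ tail≈0 ⟨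
          (p′ * p) * v zero + p′ * S₀           ≈⟨ solve 4 (λ p′ p w s → (p′ :* p) :* w :+ p′ :* s
                                                    := p′ :* (p :* w :+ s)) refl p′ p (v zero) S₀ ⟩
          p′ * (p * v zero + S₀)                ≈⟨ *-congˡ (rows zero) ⟩
          p′ * 0#                               ≈⟨ zeroʳ p′ ⟩
          0#                                    ∎
      ; (suc j) → begin
          (p′ * p) * v (suc j)  ≈⟨ solve 3 (λ p′ p w → (p′ :* p) :* w := p :* (p′ :* w)) refl p′ p (v (suc j)) ⟩
          p * (p′ * v (suc j))  ≈⟨ *-congˡ (kills j) ⟩
          p * 0#                ≈⟨ zeroʳ p ⟩
          0#                    ∎
      }
      where
      p = M zero zero
      S₀ = sum (λ j → M zero (suc j) * v (suc j))
      tail≈0 : p′ * S₀ ≈ 0#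
      tail≈0 = trans (*-distribˡ-sum p′ (λ j → M zero (suc j) * v (suc j))) (sum-0 λ j → begin
        p′ * (M zero (suc j) * v (suc j))  ≈⟨ solve 3 (λ p m w → p :* (m :* w) := m :* (p :* w))
                                                refl p′ (M zero (suc j)) (v (suc j)) ⟩
        M zero (suc j) * (p′ * v (suc j))  ≈⟨ *-congˡ (kills j) ⟩
        M zero (suc j) * 0#                ≈⟨ zeroʳ _ ⟩
        0#                                 ∎)

    coefficients : ∀ {d y} → Monic d y →
      Σ (Fin d → A.Carrier) λ c → y ≈ x ^ d + sum (λ i → f (c i) * x ^ toℕ i)
    coefficients (zero y≈1) = (λ ()) , trans y≈1 (sym (+-identityʳ 1#))
    coefficients {suc d} {z} (step {y = y} c₀ m eq) with coefficients m
    ... | c , y≈ = (λ { zero → c₀ ; (suc i) → c i }) , (begin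
      z                                        ≈⟨ eq ⟩
      f c₀ + x * y                             ≈⟨ +-congˡ (*-congˡ y≈) ⟩
      f c₀ + x * (x ^ d + S)                   ≈⟨ solve 4 (λ c x p s → c :+ x :* (p :+ s)
                                                   := x :* p :+ (c :* con 1 :+ x :* s)) refl (f c₀) x (x ^ d) S ⟩
      x * x ^ d + (f c₀ * 1# + x * S)          ≈⟨ +-congˡ (+-congˡ (trans
                                                   (*-distribˡ-sum x (λ i → f (c i) * x ^ toℕ i))
                                                   (sum-cong-≋ λ i → solve 3 (λ x c p → x :* (c :* p) := c :* (x :* p))
                                                     refl x (f (c i)) (x ^ toℕ i)))) ⟩
      x * x ^ d + (f c₀ * 1# + sum (λ i → f (c i) * (x * x ^ toℕ i)))  ∎)
      where S = sum (λ i → f (c i) * x ^ toℕ i)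

  Span : ∀ {n} → (Fin n → Carrier) → Carrier → Set (a ⊔ ℓ′)
  Span {n} v y = Σ (Fin n → A.Carrier) λ c → y ≈ sum (λ j → f (c j) * v j)

  span-resp : ∀ {n} {v : Fin n → Carrier} {y z} → y ≈ z → Span v y → Span v z
  span-resp y≈z (c , eq) = c , trans (sym y≈z) eq

  span-0 : ∀ {n} (v : Fin n → Carrier) → Span v 0#
  span-0 v = (λ _ → A.0#) , sym (sum-0 λ j → trans (*-congʳ 0#-homo) (zeroˡ (v j)))

  span-+ : ∀ {n} {v : Fin n → Carrier} {y z} → Span v y → Span v z → Span v (y + z)
  span-+ {v = v} {y} {z} (c , eq) (c′ , eq′) = (λ j → c j A.+ c′ j) , (begin
    y + z                                                        ≈⟨ +-cong eq eq′ ⟩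
    sum (λ j → f (c j) * v j) + sum (λ j → f (c′ j) * v j)       ≈⟨ ∑-distrib-+ (λ j → f (c j) * v j) (λ j → f (c′ j) * v j) ⟨
    sum (λ j → f (c j) * v j + f (c′ j) * v j)                   ≈⟨ sum-cong-≋ (λ j → trans (sym (distribʳ (v j) (f (c j)) (f (c′ j))))
                                                                      (*-congʳ (sym (+-homo (c j) (c′ j))))) ⟩
    sum (λ j → f (c j A.+ c′ j) * v j)                           ∎)

  span-scale : ∀ {n} {v : Fin n → Carrier} {y} k → Span v y → Span v (f k * y)
  span-scale {v = v} {y} k (c , eq) = (λ j → k A.* c j) , (begin
    f k * y                                ≈⟨ *-congˡ eq ⟩
    f k * sum (λ j → f (c j) * v j)        ≈⟨ *-distribˡ-sum (f k) (λ j → f (c j) * v j) ⟩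
    sum (λ j → f k * (f (c j) * v j))      ≈⟨ sum-cong-≋ (λ j → trans (sym (*-assoc (f k) (f (c j)) (v j)))
                                                (*-congʳ (sym (*-homo k (c j))))) ⟩
    sum (λ j → f (k A.* c j) * v j)        ∎)

  span-gen : ∀ {n} (v : Fin n → Carrier) i → Span v (v i)
  span-gen v zero = (λ { zero → A.1# ; (suc _) → A.0# }) , sym (trans
    (+-cong (trans (*-congʳ 1#-homo) (*-identityˡ (v zero)))
            (sum-0 λ j → trans (*-congʳ 0#-homo) (zeroˡ (v (suc j)))))
    (+-identityʳ (v zero)))
  span-gen v (suc i) with span-gen (v ∘ suc) i
  ... | c , eq = (λ { zero → A.0# ; (suc j) → c j }) , trans eq (sym (trans
    (+-congʳ (trans (*-congʳ 0#-homo) (zeroˡ (v zero)))) (+-identityˡ _)))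

  span-sum : ∀ {m n} {v : Fin n → Carrier} (y : Fin m → Carrier) → (∀ i → Span v (y i)) → Span v (sum y)
  span-sum {zero}  {v = v} y s = span-0 v
  span-sum {suc m} y s = span-+ (s zero) (span-sum (y ∘ suc) (s ∘ suc))

  span-map : ∀ {m n} {u : Fin m → Carrier} {v : Fin n → Carrier} g →
             (∀ i → Span v (g * u i)) → ∀ {y} → Span u y → Span v (g * y)
  span-map {u = u} {v} g s {y} (c , eq) = span-resp (begin
    sum (λ i → f (c i) * (g * u i))  ≈⟨ sum-cong-≋ (λ i → solve 3 (λ p q r → p :* (q :* r) := q :* (p :* r))
                                          refl (f (c i)) g (u i)) ⟩
    sum (λ i → g * (f (c i) * u i))  ≈⟨ *-distribˡ-sum g (λ i → f (c i) * u i) ⟨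
    g * sum (λ i → f (c i) * u i)    ≈⟨ *-congˡ eq ⟨
    g * y                            ∎)
    (span-sum (λ i → f (c i) * (g * u i)) λ i → span-scale (c i) (s i))

  infixl 7 _⊗_
  _⊗_ : ∀ {m n} → (Fin m → Carrier) → (Fin n → Carrier) → Fin (m ℕ.* n) → Carrier
  _⊗_ {m} {n} u w k = u (proj₁ (remQuot {m} n k)) * w (proj₂ (remQuot {m} n k))

  span-⊗ : ∀ {m n} {u : Fin m → Carrier} {w : Fin n → Carrier} {y z} →
           Span u y → Span w z → Span (u ⊗ w) (y * z)
  span-⊗ {m} {n} {u} {w} {y} {z} sy sz = span-resp (*-comm z y) (span-map z
    (λ i → span-resp (*-comm (u i) z) (span-map (u i) (generator i) sz)) sy)
    where
    generator : ∀ i j → Span (u ⊗ w) (u i * w j)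
    generator i j = span-resp
      (reflexive (≡.cong (λ (i , j) → u i * w j) (remQuot-combine {m} {n} i j)))
      (span-gen (u ⊗ w) (combine i j))

  Stable : ∀ {n} → (Fin n → Carrier) → Carrier → Set (a ⊔ ℓ′)
  Stable v x = ∀ i → Span v (x * v i)

  stable⇒integral : ∀ {n} {v : Fin n → Carrier} {x} → Stable v x → Span v 1# → IsIntegral x
  stable⇒integral {n} {v} {x} s (c₁ , 1≈) = fromAnnihilator (annihilator 1 M v (diag , off) rows)
    where
    open Values x
    N : Fin n → Fin n → A.Carrier
    N i = proj₁ (s i)

    δ : ∀ {n} → Fin n → Fin n → Carrier
    δ zero    zero    = x
    δ zero    (suc j) = 0#
    δ (suc i) zero    = 0#
    δ (suc i) (suc j) = δ i j

    δ-diag : ∀ {n} (i : Fin n) → δ i i ≈ x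
    δ-diag zero    = refl
    δ-diag (suc i) = δ-diag i

    δ-off : ∀ {n} (i j : Fin n) → i ≢ j → δ i j ≈ 0#
    δ-off zero    zero    i≢j = ⊥-elim (i≢j ≡.refl)
    δ-off zero    (suc j) i≢j = refl
    δ-off (suc i) zero    i≢j = refl
    δ-off (suc i) (suc j) i≢j = δ-off i j (i≢j ∘ ≡.cong suc)

    δ-sum : ∀ {n} (i : Fin n) (v : Fin n → Carrier) → sum (λ j → δ i j * v j) ≈ x * v i
    δ-sum zero    v = trans (+-congˡ (sum-0 λ j → zeroˡ (v (suc j)))) (+-identityʳ _)
    δ-sum (suc i) v = trans (+-cong (zeroˡ (v zero)) (δ-sum i (v ∘ suc))) (+-identityˡ _)

    M : Fin n → Fin n → Carrier
    M i j = f (A.- N i j) + δ i j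

    diag : ∀ i → Monic 1 (M i i)
    diag i = step (A.- N i i) (zero refl) (+-congˡ (trans (δ-diag i) (sym (*-identityʳ x))))

    off : ∀ i j → i ≢ j → Low 1 (M i j)
    off i j i≢j = step (A.- N i j) (zero refl) (+-congˡ (trans (δ-off i j i≢j) (sym (zeroʳ x))))

    rows : ∀ i → sum (λ j → M i j * v j) ≈ 0#
    rows i = begin
      sum (λ j → M i j * v j)
        ≈⟨ sum-cong-≋ (λ j → distribʳ (v j) (f (A.- N i j)) (δ i j)) ⟩
      sum (λ j → f (A.- N i j) * v j + δ i j * v j)
        ≈⟨ ∑-distrib-+ (λ j → f (A.- N i j) * v j) (λ j → δ i j * v j) ⟩
      sum (λ j → f (A.- N i j) * v j) + sum (λ j → δ i j * v j)
        ≈⟨ +-congˡ (trans (δ-sum i v) (proj₂ (s i))) ⟩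
      sum (λ j → f (A.- N i j) * v j) + sum (λ j → f (N i j) * v j)
        ≈⟨ ∑-distrib-+ (λ j → f (A.- N i j) * v j) (λ j → f (N i j) * v j) ⟨
      sum (λ j → f (A.- N i j) * v j + f (N i j) * v j)
        ≈⟨ sum-0 (λ j → trans (sym (distribʳ (v j) _ _)) (trans (*-congʳ (trans (sym (+-homo _ _))
             (trans (⟦⟧-cong (A.-‿inverseˡ (N i j))) 0#-homo))) (zeroˡ (v j)))) ⟩
      0# ∎

    fromAnnihilator : (∃ λ k → ∃ λ p → Monic k p × (∀ j → p * v j ≈ 0#)) → IsIntegral x
    fromAnnihilator (k , p , m , kills) with coefficients m
    ... | c , p≈ = k , c , trans (sym p≈) (begin
      p                                          ≈⟨ *-identityʳ p ⟨
      p * 1#                                     ≈⟨ *-congˡ 1≈ ⟩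
      p * sum (λ j → f (c₁ j) * v j)             ≈⟨ *-distribˡ-sum p (λ j → f (c₁ j) * v j) ⟩
      sum (λ j → p * (f (c₁ j) * v j))           ≈⟨ sum-0 (λ j → trans
          (solve 3 (λ p q r → p :* (q :* r) := q :* (p :* r)) refl p (f (c₁ j)) (v j))
          (trans (*-congˡ (kills j)) (zeroʳ (f (c₁ j))))) ⟩
      0#                                         ∎)

  powers : Carrier → ∀ n → Fin n → Carrier
  powers x n i = x ^ toℕ i

  module _ {x : Carrier} where
    last-power : ((n , c , eq) : IsIntegral x) → Span (powers x n) (x ^ n)
    last-power (n , c , eq) = (λ i → A.- c i) , (begin
      x ^ n                                        ≈⟨ +-inverseˡ-unique (x ^ n) S eq ⟩
      - S                                          ≈⟨ +-inverseˡ-unique _ S (begin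
        sum (λ i → f (A.- c i) * x ^ toℕ i) + S
          ≈⟨ ∑-distrib-+ (λ i → f (A.- c i) * x ^ toℕ i) (λ i → f (c i) * x ^ toℕ i) ⟨
        sum (λ i → f (A.- c i) * x ^ toℕ i + f (c i) * x ^ toℕ i)
          ≈⟨ sum-0 (λ i → trans (sym (distribʳ (x ^ toℕ i) _ _)) (trans (*-congʳ (trans (sym (+-homo _ _))
             (trans (⟦⟧-cong (A.-‿inverseˡ (c i))) 0#-homo))) (zeroˡ (x ^ toℕ i)))) ⟩
        0# ∎) ⟨
      sum (λ i → f (A.- c i) * x ^ toℕ i)          ∎)
      where S = sum (λ i → f (c i) * x ^ toℕ i)

    powers-stable : ((n , c , eq) : IsIntegral x) → Stable (powers x n) x
    powers-stable int@(n , _) i with suc (toℕ i) ℕ.<? n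
    ... | yes i+1<n = span-resp (reflexive (≡.cong (x ^_) (toℕ-fromℕ< i+1<n)))
                        (span-gen (powers x n) (fromℕ< i+1<n))
    ... | no  i+1≮n = span-resp (reflexive (≡.cong (x ^_) (≡.sym (ℕ.≤-antisym (toℕ<n i) (ℕ.≮⇒≥ i+1≮n)))))
                        (last-power int)

    powers-1 : ((n , c , eq) : IsIntegral x) → Span (powers x n) 1#
    powers-1 int@(zero  , _) = last-power int
    powers-1     (suc n , _) = span-gen (powers x (suc n)) zero

  integral-resp : ∀ {x y} → x ≈ y → IsIntegral x → IsIntegral y
  integral-resp {x} {y} x≈y (n , c , eq) = n , c , trans (sym (+-cong (^-congˡ n x≈y)
    (sum-cong-≋ {n} {λ i → f (c i) * x ^ toℕ i} {λ i → f (c i) * y ^ toℕ i}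
      λ i → *-congˡ (^-congˡ (toℕ i) x≈y)))) eq
    where open import Algebra.Properties.Semiring.Exp semiring using (^-congˡ)

  module _ {x y : Carrier} (ix : IsIntegral x) (iy : IsIntegral y) where
    m = proj₁ ix
    n = proj₁ iy
    u = powers x m
    w = powers y n

    row : Fin (m ℕ.* n) → Fin m
    row k = proj₁ (remQuot {m} n k)

    col : Fin (m ℕ.* n) → Fin n
    col k = proj₂ (remQuot {m} n k)

    1∈u⊗w : Span (u ⊗ w) 1#
    1∈u⊗w = span-resp (*-identityˡ 1#) (span-⊗ (powers-1 ix) (powers-1 iy))

    stable-+ : Stable (u ⊗ w) (x + y)
    stable-+ k = span-resp
      (solve 4 (λ x y u w → (x :* u) :* w :+ u :* (y :* w) := (x :+ y) :* (u :* w)) refl x y (u (row k)) (w (col k)))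
      (span-+ (span-⊗ {u = u} {w} (powers-stable ix (row k)) (span-gen w (col k)))
              (span-⊗ {u = u} {w} (span-gen u (row k)) (powers-stable iy (col k))))

    stable-* : Stable (u ⊗ w) (x * y)
    stable-* k = span-resp
      (solve 4 (λ x y u w → (x :* u) :* (y :* w) := (x :* y) :* (u :* w)) refl x y (u (row k)) (w (col k)))
      (span-⊗ {u = u} {w} (powers-stable ix (row k)) (powers-stable iy (col k)))

  integral-+ : ∀ {x y} → IsIntegral x → IsIntegral y → IsIntegral (x + y)
  integral-+ ix iy = stable⇒integral (stable-+ ix iy) (1∈u⊗w ix iy)

  integral-* : ∀ {x y} → IsIntegral x → IsIntegral y → IsIntegral (x * y)
  integral-* ix iy = stable⇒integral (stable-* ix iy) (1∈u⊗w ix iy)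

  integral-image : ∀ k → IsIntegral (f k)
  integral-image k = stable⇒integral {v = λ (_ : Fin 1) → 1#} (λ i → (λ _ → k) , sym (+-identityʳ _))
    ((λ _ → A.1#) , sym (trans (+-identityʳ _) (trans (*-congʳ 1#-homo) (*-identityˡ 1#))))

  integral-neg : ∀ {x} → IsIntegral x → IsIntegral (- x)
  integral-neg {x} ix = integral-resp (begin
    f (A.- A.1#) * x  ≈⟨ *-congʳ (trans (-‿homo A.1#) (-‿cong 1#-homo)) ⟩
    - 1# * x          ≈⟨ -‿distribˡ-* 1# x ⟨
    - (1# * x)        ≈⟨ -‿cong (*-identityˡ x) ⟩
    - x               ∎) (integral-* (integral-image (A.- A.1#)) ix)

  integralClosure : CommutativeRing (a ⊔ b ⊔ ℓ′) ℓ′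
  integralClosure = record
    { Carrier = Σ Carrier IsIntegral
    ; _≈_ = λ x y → proj₁ x ≈ proj₁ y
    ; _+_ = λ (x , ix) (y , iy) → x + y , integral-+ ix iy
    ; _*_ = λ (x , ix) (y , iy) → x * y , integral-* ix iy
    ; -_  = λ (x , ix) → - x , integral-neg ix
    ; 0#  = 0# , integral-resp 0#-homo (integral-image A.0#)
    ; 1#  = 1# , integral-resp 1#-homo (integral-image A.1#)
    ; isCommutativeRing = record
      { isRing = record
        { +-isAbelianGroup = record
          { isGroup = record
            { isMonoid = record
              { isSemigroup = record
                { isMagma = record
                  { isEquivalence = record { refl = refl ; sym = sym ; trans = trans }
                  ; ∙-cong = +-cong
                  }
                ; assoc = λ _ _ _ → +-assoc _ _ _
                }
              ; identity = (λ _ → +-identityˡ _) , (λ _ → +-identityʳ _)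
              }
            ; inverse = (λ _ → -‿inverseˡ _) , (λ _ → -‿inverseʳ _)
            ; ⁻¹-cong = -‿cong
            }
          ; comm = λ _ _ → +-comm _ _
          }
        ; *-cong = *-cong
        ; *-assoc = λ _ _ _ → *-assoc _ _ _
        ; *-identity = (λ _ → *-identityˡ _) , (λ _ → *-identityʳ _)
        ; distrib = (λ _ _ _ → distribˡ _ _ _) , (λ _ _ _ → distribʳ _ _ _)
        }
      ; *-comm = λ _ _ → *-comm _ _
      }
    }

record Extension {c e} (k : Field c e) c′ e′ : Set (c ⊔ e ⊔ lsuc (c′ ⊔ e′)) where
  private module k = Field k
  field
    overfield : Field c′ e′
    embed     : k.Carrier → Field.Carrier overfield
    isHom     : IsHom k.commutativeRing (Field.commutativeRing overfield) embed

  ring : CommutativeRing c′ e′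
  ring = Field.commutativeRing overfield

  open CommRing ring public hiding (ring)

module _ {c e} {k : Field c e} where
  private module k = Field k

  record Basis {c′ e′} (L : Extension k c′ e′) (n : ℕ) : Set (c ⊔ e ⊔ c′ ⊔ e′) where
    open Extension L
    field
      vector      : Fin n → Carrier
      coordinate  : Carrier → Fin n → k.Carrier
      spanning    : ∀ x → x ≈ sum (λ j → embed (coordinate x j) * vector j)
      independent : ∀ (a : Fin n → k.Carrier) → sum (λ j → embed (a j) * vector j) ≈ 0# → ∀ j → a j k.≈ k.0#

    -- The trace of multiplication by x, computed from its matrix in this
    -- basis; the value does not depend on the basis.
    trace : Carrier → k.Carrier
    trace x = CommRing.sum k.commutativeRing (λ i → coordinate (x * vector i) i)

    discriminant : (Fin n → Carrier) → k.Carrier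
    discriminant x = det k.commutativeRing (λ i j → trace (x i * x j))

  infix 4 _≅_
  record _≅_ {c₁ e₁ c₂ e₂} (L : Extension k c₁ e₁) (M : Extension k c₂ e₂) :
             Set (c ⊔ c₁ ⊔ e₁ ⊔ c₂ ⊔ e₂) where
    private
      module L = Extension L
      module M = Extension M
    open RingMorphisms L.rawRing M.rawRing using (IsRingIsomorphism)
    field
      ⟦_⟧               : L.Carrier → M.Carrier
      isRingIsomorphism : IsRingIsomorphism ⟦_⟧
      fixes-k           : ∀ a → ⟦ L.embed a ⟧ M.≈ M.embed a
    open IsRingIsomorphism isRingIsomorphism public

  module _ {c′ e′} (L : Extension k c′ e′) where
    open Extension L

    ≅-refl : L ≅ L
    ≅-refl = record
      { ⟦_⟧ = id
      ; isRingIsomorphism = Identity.isRingIsomorphism rawRing refl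
      ; fixes-k = λ _ → refl
      }

    ≅-trans : L ≅ L → L ≅ L → L ≅ L
    ≅-trans σ τ = record
      { ⟦_⟧ = τ.⟦_⟧ ∘ σ.⟦_⟧
      ; isRingIsomorphism = Composition.isRingIsomorphism trans σ.isRingIsomorphism τ.isRingIsomorphism
      ; fixes-k = λ a → trans (τ.⟦⟧-cong (σ.fixes-k a)) (τ.fixes-k a)
      } where module σ = _≅_ σ
              module τ = _≅_ τ

    ≅-sym : L ≅ L → L ≅ L
    ≅-sym σ = record
      { ⟦_⟧ = inv
      ; isRingIsomorphism = record
        { isRingMonomorphism = record
          { isRingHomomorphism = record
            { isSemiringHomomorphism = record
              { isNearSemiringHomomorphism = record
                { +-isMonoidHomomorphism = record
                  { isMagmaHomomorphism = record
                    { isRelHomomorphism = record { cong = λ eq → from (trans (right _) (trans eq (sym (right _)))) }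
                    ; homo = λ x y → from (trans (right _) (sym (trans (σ.+-homo _ _) (+-cong (right x) (right y)))))
                    }
                  ; ε-homo = from (trans (right _) (sym σ.0#-homo))
                  }
                ; *-homo = λ x y → from (trans (right _) (sym (trans (σ.*-homo _ _) (*-cong (right x) (right y)))))
                }
              ; 1#-homo = from (trans (right _) (sym σ.1#-homo))
              }
            ; -‿homo = λ x → from (trans (right _) (sym (trans (σ.-‿homo _) (-‿cong (right x)))))
            }
          ; injective = λ eq → trans (sym (right _)) (trans (σ.⟦⟧-cong eq) (right _))
          }
        ; surjective = λ y → σ.⟦ y ⟧ , λ eq → from (trans (right _) eq)
        }
      ; fixes-k = λ a → from (trans (right _) (sym (σ.fixes-k a)))
      }
      where
      module σ = _≅_ σ
      inv : Carrier → Carrier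
      inv y = proj₁ (σ.surjective y)
      right : ∀ y → σ.⟦ inv y ⟧ ≈ y
      right y = proj₂ (σ.surjective y) refl
      from : ∀ {x y} → σ.⟦ x ⟧ ≈ σ.⟦ y ⟧ → x ≈ y
      from = σ.injective

    automorphismGroup : Group (c ⊔ c′ ⊔ e′) (c′ ⊔ e′)
    automorphismGroup = record
      { Carrier = L ≅ L
      ; _≈_ = λ σ τ → ∀ x → _≅_.⟦ σ ⟧ x ≈ _≅_.⟦ τ ⟧ x
      ; _∙_ = λ σ τ → ≅-trans τ σ
      ; ε = ≅-refl
      ; _⁻¹ = ≅-sym
      ; isGroup = record
        { isMonoid = record
          { isSemigroup = record
            { isMagma = record
              { isEquivalence = record
                { refl = λ _ → refl ; sym = λ p x → sym (p x) ; trans = λ p q x → trans (p x) (q x) }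
              ; ∙-cong = λ {σ} {σ′} {τ} {τ′} p q x → trans (_≅_.⟦⟧-cong σ (q x)) (p (_≅_.⟦ τ′ ⟧ x))
              }
            ; assoc = λ _ _ _ _ → refl
            }
          ; identity = (λ _ _ → refl) , (λ _ _ → refl)
          }
        ; inverse = (λ σ x → _≅_.injective σ (proj₂ (_≅_.surjective σ (_≅_.⟦ σ ⟧ x)) refl))
                  , (λ σ x → proj₂ (_≅_.surjective σ x) refl)
        ; ⁻¹-cong = λ {σ} {τ} p x → _≅_.injective σ
            (trans (proj₂ (_≅_.surjective σ x) refl)
              (sym (trans (p _) (proj₂ (_≅_.surjective τ x) refl))))
        }
      }

    FixedFieldIsBase : Set (c ⊔ c′ ⊔ e′)
    FixedFieldIsBase = ∀ x → (∀ (σ : L ≅ L) → _≅_.⟦ σ ⟧ x ≈ x) → ∃ λ a → x ≈ embed a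

IsCyclicGroup : ∀ {c e} → Group c e → Set (c ⊔ e)
IsCyclicGroup G = ∃ λ g → ∀ h → ∃ λ n → h ≈ power g n
  where
  open Group G
  open RawMonoidDefinitions rawMonoid renaming (_×_ to _times_)
  power : Carrier → ℤ → Carrier
  power g (+ n)    = n times g
  power g -[1+ n ] = (suc n times g) ⁻¹

-- A finite extension is taken to be Galois when the base is the fixed
-- field of its automorphism group.
record CyclicExtension {c e} (k : Field c e) c′ e′ (n : ℕ) : Set (c ⊔ e ⊔ lsuc (c′ ⊔ e′)) where
  field
    extension : Extension k c′ e′
    basis     : Basis extension n
    isGalois  : FixedFieldIsBase extension
    isCyclic  : IsCyclicGroup (automorphismGroup extension)

-- Isomorphic over k.  Two Galois extensions inside a common algebraic
-- closure are isomorphic over k exactly when they are equal.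
infix 4 _≅ᶜ_
_≅ᶜ_ : ∀ {c e} {k : Field c e} {c′ e′ n} → CyclicExtension k c′ e′ n → CyclicExtension k c′ e′ n → Set (c ⊔ c′ ⊔ e′)
K ≅ᶜ L = CyclicExtension.extension K ≅ CyclicExtension.extension L

-- Elements related by _~_ are counted as one.
InfinitelyMany : ∀ {a r p} {A : Set a} → (A → A → Set r) → (A → Set p) → Set (a ⊔ r ⊔ p)
InfinitelyMany {A = A} _~_ P = Σ (ℕ → A) λ s → (∀ i → P (s i)) × (∀ {i j} → i ≢ j → ¬ (s i ~ s j))

module RationalFunctions {c e} (F : Field c e) {q : ℕ}
                         (|F|≡q : HasCardinality (Field.commutativeRing F) q) where
  open Field F using () renaming (_≈_ to _≈F_; setoid to F-setoid)
  open Polynomials (Field.commutativeRing F) public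
    using (Poly; _≈ₚ_; polynomialRing; HasDegree; IsMonicOfDegree)

  _≟F_ : Decidable _≈F_
  x ≟F y = map′ injective to-cong (to x Fin.≟ to y)
    where
    open Inverse |F|≡q
    module F = Field F
    injective : to x ≡ to y → x ≈F y
    injective eq = F.trans (F.sym (inverseʳ ≡.refl)) (F.trans (from-cong eq) (inverseʳ ≡.refl))

  F[t] : CommutativeRing c e
  F[t] = polynomialRing

  module Frac = FractionField F[t] (polynomialRing-isDomain F _≟F_)

  private module F[t] = CommRing F[t]

  open RawSemiringDefinitions (Semiring.rawSemiring F[t].semiring) public
    using (Irreducible) renaming (_∣_ to _∣ₚ_)

  F⟨t⟩ : Field (c ⊔ e) e
  F⟨t⟩ = Frac.fractionField

  SquareFree : Poly → Set (c ⊔ e)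
  SquareFree g = ∀ h → (h F[t].* h) ∣ₚ g → h ∣ₚ F[t].1#

  -- P divides the ideal I when I ⊆ (P).
  RelativelyPrimeTo : ∀ {p} → Poly → Ideal F[t] p → Set (c ⊔ e ⊔ p)
  RelativelyPrimeTo g I = ∀ P → Irreducible P → P ∣ₚ g →
    ¬ (∀ a → Ideal.Member I a → P ∣ₚ a)

  module _ {c′ e′} (K : Extension F⟨t⟩ c′ e′) where
    private module K = Extension K

    module 𝒪 = IntegralClosure F[t] K.ring (K.embed ∘ Frac.fromA)
      (Composition.isRingHomomorphism K.trans Frac.fromA-isHom K.isHom)

    𝒪-ring : CommutativeRing (c ⊔ c′ ⊔ e′) e′
    𝒪-ring = 𝒪.integralClosure

    fromPolynomial : Poly → CommutativeRing.Carrier 𝒪-ring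
    fromPolynomial p = K.embed (Frac.fromA p) , 𝒪.integral-image p

    IsCarmichaelIn : CommutativeRing.Carrier 𝒪-ring → Set (c ⊔ c′ ⊔ e′)
    IsCarmichaelIn α = IsCarmichaelIdeal 𝒪-ring (principalIdeal 𝒪-ring α)

    -- The trace form takes values in F(t), so the discriminants generate
    -- an F[t]-submodule of F(t); as F[t] is integrally closed, this
    -- submodule is the image of an ideal of F[t].
    data DiscriminantSpan {n} (B : Basis K n) : Field.Carrier F⟨t⟩ → Set (c ⊔ e ⊔ c′ ⊔ e′) where
      discriminant : ∀ (x : Fin n → CommutativeRing.Carrier 𝒪-ring) →
                     DiscriminantSpan B (Basis.discriminant B (proj₁ ∘ x))
      zero         : DiscriminantSpan B (Field.0# F⟨t⟩)
      _+_          : ∀ {x y} → DiscriminantSpan B x → DiscriminantSpan B y →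
                     DiscriminantSpan B (Field._+_ F⟨t⟩ x y)
      scale        : ∀ p {x} → DiscriminantSpan B x → DiscriminantSpan B (Field._*_ F⟨t⟩ (Frac.fromA p) x)
      resp-≈       : ∀ {x y} → Field._≈_ F⟨t⟩ x y → DiscriminantSpan B x → DiscriminantSpan B y

    discriminantIdeal : ∀ {n} → Basis K n → Ideal F[t] (c ⊔ e ⊔ c′ ⊔ e′)
    discriminantIdeal B = record
      { Member   = λ p → DiscriminantSpan B (Frac.fromA p)
      ; ∈-resp-≈ = λ eq → resp-≈ (ι.⟦⟧-cong eq)
      ; 0∈       = zero
      ; +-closed = λ {p} {q} m n → resp-≈ (k.sym (ι.+-homo p q)) (m + n)
      ; *-closed = λ p {q} m → resp-≈ (k.sym (ι.*-homo p q)) (scale p m)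
      }
      where
      module k = Field F⟨t⟩
      module ι = RingMorphisms.IsRingHomomorphism Frac.fromA-isHom

{-# OPTIONS --safe #-}
module Submission where

-- Take the Kummer extensions K_j = F_q(t)(y) with y^ℓ = D_j, where
-- D_j = 1 + t G_j^ℓ, G_0 = g and G_(j+1) = G_j D_j.  The degree of D_j is 1
-- modulo ℓ, and the D_j are 1 modulo g and pairwise coprime.  An identity
-- v^ℓ X = u^ℓ Y with X and Y coprime forces ℓ to divide deg X; this shows both
-- that D_j is not an ℓ-th power, so that K_j is a field, and, as the elements
-- whose ℓ-th power lies in the base are the monomials a y^n, that the K_j are
-- pairwise non-isomorphic.  The discriminant of 1, y, …, y^(ℓ-1) is
-- ± ℓ^ℓ D_j^(ℓ-1), which is prime to g.  For x integral over F_q[t] the traces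
-- of x y^(ℓ-i) show that D_j x lies in F_q[t][y], so modulo g the ring of
-- integers is (F_q[t]/g)[y]/(y^ℓ - 1), with (q^d)^ℓ elements and with zero
-- divisors.  It is spanned by the eigenspaces of y, on each of which every
-- element acts as some element of F_q[t]/g, so a^(q^(dℓ)) = a has to be checked
-- in F_q[t]/g only.  As g is square-free, this holds because the degrees of
-- its irreducible factors divide dℓ, being divisors of d or equal to ℓ.

open import Defs
open import Data.Fin.Base using (Fin)
open import Data.Nat.Base using (ℕ; _≤_; _∸_)
open import Data.Nat.Primality using (Prime)
open import Data.Product.Base using (_×_; ∃-syntax)
open import Function.Bundles using (_⇔_)
open import Level using (_⊔_) renaming (suc to lsuc)
open import Relation.Nullary using (¬_)

import Algebra.Morphism.Construct.Composition as Composition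
import Algebra.Properties.Monoid.Mult.TCOptimised as TCMult
import Algebra.Solver.Ring as Solver
import Data.Fin.Base as Fin
import Data.Fin.Properties as Fin
import Data.Integer.Base as ℤ
import Data.Integer.Properties as ℤ
import Data.Nat.Base as ℕ
import Data.Nat.Properties as ℕ
import Data.Nat.DivMod as ℕ
import Data.Nat.Divisibility as ℕ
import Data.Nat.Primality as ℕ
import Relation.Binary.PropositionalEquality as ≡
import Relation.Binary.Reasoning.Setoid as SetoidReasoning
import Algebra.Definitions.RawMonoid as RawMonoidDefinitions
open import Algebra.Bundles using (CommutativeRing; Group; Semiring)
open import Algebra.Morphism.Structures using (module RingMorphisms)
open import Algebra.Solver.Ring.AlmostCommutativeRing using (_-Raw-AlmostCommutative⟶_; fromCommutativeRing; AlmostCommutativeRing)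
open import Data.Empty using (⊥; ⊥-elim)
open import Data.Fin.Base using (zero; suc; toℕ; fromℕ<; punchIn)
open import Data.Fin.Permutation using (Permutation; permutation; remove; _⟨$⟩ʳ_; punchIn-permute)
open import Data.List.Base using (List; []; _∷_; tabulate)
open import Data.Nat.Coprimality using (coprime-Bézout; prime⇒coprime)
open import Data.Nat.GCD using (module Bézout)
open import Data.Maybe.Base using (Maybe; just; nothing)
open import Data.Nat.Base using (zero; suc; _<_; z≤n; s≤s)
open import Data.Product.Base using (∃; ∃₂; _,_; proj₁; proj₂)
open import Data.Sum.Base using (_⊎_; inj₁; inj₂)
open import Function.Base using (_∘_; id)
open import Function.Bundles using (Inverse; Equivalence)
open import Relation.Binary.Bundles using (Setoid)
open import Relation.Binary.Definitions using (Decidable; tri<; tri≈; tri>)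
open import Relation.Binary.PropositionalEquality using (_≡_; _≢_)
open import Relation.Nullary using (Dec; yes; no)
open import Relation.Nullary.Decidable using (decidable-stable; map′; ¬?)

-- Since D_j is 1 modulo g, multiplication by D_j is the identity on the ring of integers modulo g.
-- This is why knowing that D_j x lies in F_q[t][y] suffices, and the ring of integers is never
-- determined exactly. The size q^(dℓ) of the quotient is also the exponent in the Carmichael
-- condition; a residue field of degree m satisfies it when m divides dℓ, and this is where the
-- degrees of the factors of g enter. The argument is constructive, which shapes its tools.
-- Coprimality means a Bézout identity, g is never factored, and irreducible factors are produced
-- only on the way to a contradiction. That ζ is primitive is expressed by vanishing geometric sums,
-- because this survives in quotients with zero divisors, where the order of an element says little.
-- The same sums, formed from ζ^j y, are the projectors behind three steps: ℓ-th roots of unity in a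
-- domain are powers of ζ, the sum of the conjugates lies in the base field, and the Carmichael
-- identity reduces to F_q[t]/g.

-- A ring solver with integer coefficients

module IntegerSolver {c e} (R : CommutativeRing c e) where
  open CommutativeRing R hiding (zero)
  open import Algebra.Properties.Semiring.Mult semiring using (×-homo-+; ×1-homo-*) renaming (_×_ to _times_)
  open import Algebra.Properties.Ring ring
    using (-0#≈0#; -‿distribˡ-*; -‿distribʳ-*; -‿involutive; -‿+-comm)
  open TCMult +-monoid using (×ᵤ≈×) renaming (_×_ to _•_)
  open SetoidReasoning setoid

  private
    -- With the optimised multiple `_•_` the integers 0 and 1 reduce to `0#` and `1#`, so solved
    -- equations match the goals as written.
    ⟦_⟧ : ℤ.ℤ → Carrier
    ⟦ ℤ.+ n ⟧      = n • 1#
    ⟦ ℤ.-[1+ n ] ⟧ = - (suc n • 1#)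

    +-homo-× : ∀ m n → (m ℕ.+ n) • 1# ≈ m • 1# + n • 1#
    +-homo-× m n = begin
      (m ℕ.+ n) • 1#  ≈⟨ ×ᵤ≈× (m ℕ.+ n) 1# ⟨
      (m ℕ.+ n) times 1#  ≈⟨ ×-homo-+ 1# m n ⟩
      m times 1# + n times 1#  ≈⟨ +-cong (×ᵤ≈× m 1#) (×ᵤ≈× n 1#) ⟩
      m • 1# + n • 1#  ∎

    *-homo-× : ∀ m n → (m ℕ.* n) • 1# ≈ (m • 1#) * (n • 1#)
    *-homo-× m n = begin
      (m ℕ.* n) • 1#  ≈⟨ ×ᵤ≈× (m ℕ.* n) 1# ⟨
      (m ℕ.* n) times 1#  ≈⟨ ×1-homo-* m n ⟩
      (m times 1#) * (n times 1#) ≈⟨ *-cong (×ᵤ≈× m 1#) (×ᵤ≈× n 1#) ⟩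
      (m • 1#) * (n • 1#)  ∎

    ⊖-homo : ∀ m n → ⟦ m ℤ.⊖ n ⟧ ≈ m • 1# - n • 1#
    ⊖-homo m       zero    = sym (trans (+-congˡ -0#≈0#) (+-identityʳ _))
    ⊖-homo zero    (suc n) = sym (+-identityˡ _)
    ⊖-homo (suc m) (suc n) = begin
      ⟦ suc m ℤ.⊖ suc n ⟧  ≡⟨ ≡.cong ⟦_⟧ (ℤ.[1+m]⊖[1+n]≡m⊖n m n) ⟩
      ⟦ m ℤ.⊖ n ⟧  ≈⟨ ⊖-homo m n ⟩
      m • 1# - n • 1#  ≈⟨ +-congʳ (trans (sym (+-identityˡ _)) (+-congʳ (sym (-‿inverseʳ 1#)))) ⟩
      ((1# - 1#) + m • 1#) - n • 1#  ≈⟨ +-congʳ (trans (+-assoc _ _ _) (trans (+-congˡ (+-comm _ _)) (sym (+-assoc _ _ _)))) ⟩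
      ((1# + m • 1#) - 1#) - n • 1#  ≈⟨ +-assoc _ _ _ ⟩
      (1# + m • 1#) + (- 1# - n • 1#)  ≈⟨ +-cong (sym (+-homo-× 1 m)) (trans (-‿+-comm 1# _) (-‿cong (sym (+-homo-× 1 n)))) ⟩
      suc m • 1# - suc n • 1#  ∎

    neg-homo : ∀ i → ⟦ ℤ.- i ⟧ ≈ - ⟦ i ⟧
    neg-homo (ℤ.+ zero)    = sym -0#≈0#
    neg-homo ℤ.+[1+ n ]    = refl
    neg-homo (ℤ.-[1+ n ])  = sym (-‿involutive _)

    +-homo : ∀ i j → ⟦ i ℤ.+ j ⟧ ≈ ⟦ i ⟧ + ⟦ j ⟧
    +-homo (ℤ.+ m)    (ℤ.+ n)    = +-homo-× m n
    +-homo (ℤ.+ m)    ℤ.-[1+ n ] = ⊖-homo m (suc n)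
    +-homo ℤ.-[1+ m ] (ℤ.+ n)    = trans (⊖-homo n (suc m)) (+-comm _ _)
    +-homo ℤ.-[1+ m ] ℤ.-[1+ n ] = trans
      (-‿cong (trans (reflexive (≡.cong (_• 1#) (≡.sym (ℕ.+-suc (suc m) n)))) (+-homo-× (suc m) (suc n))))
      (sym (-‿+-comm _ _))

    *-homo⁺ : ∀ m j → ⟦ (ℤ.+ m) ℤ.* j ⟧ ≈ (m • 1#) * ⟦ j ⟧
    *-homo⁺ m (ℤ.+ n)    = trans (reflexive (≡.cong ⟦_⟧ (≡.sym (ℤ.pos-* m n)))) (*-homo-× m n)
    *-homo⁺ m ℤ.-[1+ n ] = begin
      ⟦ (ℤ.+ m) ℤ.* ℤ.-[1+ n ] ⟧  ≡⟨ ≡.cong ⟦_⟧ (≡.sym (ℤ.neg-distribʳ-* (ℤ.+ m) ℤ.+[1+ n ])) ⟩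
      ⟦ ℤ.- ((ℤ.+ m) ℤ.* ℤ.+[1+ n ]) ⟧  ≈⟨ neg-homo ((ℤ.+ m) ℤ.* ℤ.+[1+ n ]) ⟩
      - ⟦ (ℤ.+ m) ℤ.* ℤ.+[1+ n ] ⟧  ≈⟨ -‿cong (*-homo⁺ m ℤ.+[1+ n ]) ⟩
      - ((m • 1#) * (suc n • 1#))  ≈⟨ -‿distribʳ-* _ _ ⟩
      (m • 1#) * - (suc n • 1#)  ∎

    *-homo : ∀ i j → ⟦ i ℤ.* j ⟧ ≈ ⟦ i ⟧ * ⟦ j ⟧
    *-homo (ℤ.+ m)    j = *-homo⁺ m j
    *-homo ℤ.-[1+ m ] j = begin
      ⟦ ℤ.-[1+ m ] ℤ.* j ⟧  ≡⟨ ≡.cong ⟦_⟧ (≡.sym (ℤ.neg-distribˡ-* ℤ.+[1+ m ] j)) ⟩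
      ⟦ ℤ.- (ℤ.+[1+ m ] ℤ.* j) ⟧  ≈⟨ neg-homo (ℤ.+[1+ m ] ℤ.* j) ⟩
      - ⟦ ℤ.+[1+ m ] ℤ.* j ⟧  ≈⟨ -‿cong (*-homo⁺ (suc m) j) ⟩
      - ((suc m • 1#) * ⟦ j ⟧)  ≈⟨ -‿distribˡ-* _ _ ⟩
      - (suc m • 1#) * ⟦ j ⟧  ∎

    almostCommutativeRing : AlmostCommutativeRing c e
    almostCommutativeRing = fromCommutativeRing R

    morphism : CommutativeRing.rawRing ℤ.+-*-commutativeRing -Raw-AlmostCommutative⟶ almostCommutativeRing
    morphism = record
      { ⟦_⟧ = ⟦_⟧ ; +-homo = +-homo ; *-homo = *-homo ; -‿homo = neg-homo ; 0-homo = refl ; 1-homo = refl }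

    -- Distinct integers may still agree in R, so `nothing` asserts nothing.
    _≟_ : ∀ i j → Maybe (⟦ i ⟧ ≈ ⟦ j ⟧)
    i ≟ j with i ℤ.≟ j
    ... | yes i≡j = just (reflexive (≡.cong ⟦_⟧ i≡j))
    ... | no  _   = nothing

    module S = Solver (CommutativeRing.rawRing ℤ.+-*-commutativeRing) almostCommutativeRing morphism _≟_

  open S public using (Polynomial; con; _:+_; _:*_; :-_; _:-_; _:=_; solve)
  1′ 0′ : ∀ {n} → Polynomial n
  1′ = con ℤ.1ℤ
  0′ = con ℤ.0ℤ

-- Commutative rings: divisibility, comaximal elements, geometric sums

domain-cancelʳ : ∀ {c e} (R : CommutativeRing c e) → IsDomain R → let open CommutativeRing R in
                 ∀ {a b z} → ¬ (z ≈ 0#) → a * z ≈ b * z → a ≈ b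
domain-cancelʳ R domain = FractionField.cancelʳ R domain

module _ {a b c d} (A : CommutativeRing a b) (B : CommutativeRing c d) where
  private
    module A = CommutativeRing A
    module B = CommutativeRing B

  mkIsHom : ∀ {f} → (∀ {x y} → x A.≈ y → f x B.≈ f y) → (∀ x y → f (x A.+ y) B.≈ f x B.+ f y) → f A.0# B.≈ B.0# →
            (∀ x y → f (x A.* y) B.≈ f x B.* f y) → f A.1# B.≈ B.1# → (∀ x → f (A.- x) B.≈ B.- f x) → IsHom A B f
  mkIsHom cong +-homo 0#-homo *-homo 1#-homo -‿homo = record
    { isSemiringHomomorphism = record
      { isNearSemiringHomomorphism = record
        { +-isMonoidHomomorphism = record
          { isMagmaHomomorphism = record { isRelHomomorphism = record { cong = cong } ; homo = +-homo } ; ε-homo = 0#-homo }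
        ; *-homo = *-homo
        }
      ; 1#-homo = 1#-homo
      }
    ; -‿homo = -‿homo
    }

module RingTheory {c e} (R : CommutativeRing c e) where
  open CommRing R
  open IntegerSolver R
  open import Algebra.Definitions.RawMagma *-rawMagma using (_,_)
  open import Algebra.Definitions.RawSemiring (Semiring.rawSemiring semiring) public using (product)
  open import Algebra.Properties.Semiring.Divisibility semiring public
    using () renaming (∣ʳ-refl to ∣-refl; ∣ʳ-trans to ∣-trans; ∣ʳ-respʳ-≈ to ∣-respʳ; ∣ʳ-respˡ-≈ to ∣-respˡ)
  open import Algebra.Properties.Semiring.Sum semiring public
    using (*-distribˡ-sum; *-distribʳ-sum; ∑-distrib-+; ∑-comm; sum-cong-≋; sum-replicate-zero; sum-replicate)
  open import Algebra.Properties.Semiring.Exp semiring public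
    using (^-congˡ; ^-congʳ; ^-homo-*; ^-assocʳ)
  open import Algebra.Properties.CommutativeSemiring.Exp commutativeSemiring public
    using (^-distrib-*)
  open import Algebra.Definitions.RawMonoid +-rawMonoid public using () renaming (_×_ to _times_)
  open SetoidReasoning setoid

  x-y≈0⇒x≈y : ∀ {x y} → x - y ≈ 0# → x ≈ y
  x-y≈0⇒x≈y {x} {y} = x∙y⁻¹≈ε⇒x≈y x y
    where open import Algebra.Properties.Ring ring using (x∙y⁻¹≈ε⇒x≈y)

  x≈y⇒x-y≈0 : ∀ {x y} → x ≈ y → x - y ≈ 0#
  x≈y⇒x-y≈0 {x} {y} x≈y = trans (+-congʳ x≈y) (-‿inverseʳ y)

  open import Algebra.Properties.Ring ring public using (-1*x≈-x; x[y-z]≈xy-xz)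

  1^ : ∀ n → 1# ^ n ≈ 1#
  1^ zero    = refl
  1^ (suc n) = trans (*-identityˡ _) (1^ n)

  0^ : ∀ {n} → 0 < n → 0# ^ n ≈ 0#
  0^ {suc n} _ = zeroˡ _

  ^-comm : ∀ x m n → (x ^ m) ^ n ≈ (x ^ n) ^ m
  ^-comm x m n = trans (^-assocʳ x m n) (trans (^-congʳ x (ℕ.*-comm m n)) (sym (^-assocʳ x n m)))

  ^-mult : ∀ {x n} m → x ^ n ≈ 1# → x ^ (m ℕ.* n) ≈ 1#
  ^-mult {x} {n} m eq = trans (^-congʳ x (ℕ.*-comm m n))
    (trans (sym (^-assocʳ x n m)) (trans (^-congˡ m eq) (1^ m)))

  sum-0 : ∀ {n} {v : Fin n → Carrier} → (∀ i → v i ≈ 0#) → sum v ≈ 0#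
  sum-0 {n} v≈0 = trans (sum-cong-≋ v≈0) (sum-replicate-zero n)

  sum-single : ∀ {n} (v : Fin n → Carrier) i → (∀ j → j ≢ i → v j ≈ 0#) → sum v ≈ v i
  sum-single v zero    off = trans (+-congˡ (sum-0 λ j → off (suc j) λ ())) (+-identityʳ _)
  sum-single v (suc i) off = trans
    (+-cong (off zero λ ()) (sum-single (v ∘ suc) i λ j j≢i → off (suc j) (j≢i ∘ Fin.suc-injective)))
    (+-identityˡ _)

  quotient : ∀ {x y} → x ∣ y → Carrier
  quotient (q , _) = q

  quotient*divisor : ∀ {x y} (x∣y : x ∣ y) → quotient x∣y * x ≈ y
  quotient*divisor (_ , eq) = eq

  x∣x*y : ∀ x y → x ∣ x * y
  x∣x*y x y = y , *-comm y x

  ∣-*ˡ : ∀ {x y} z → x ∣ y → x ∣ z * y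
  ∣-*ˡ z (q , eq) = z * q , trans (*-assoc z q _) (*-congˡ eq)

  ∣-*ʳ : ∀ {x y} z → x ∣ y → x ∣ y * z
  ∣-*ʳ z x∣y = ∣-respʳ (*-comm z _) (∣-*ˡ z x∣y)

  ∣-+ : ∀ {x y z} → x ∣ y → x ∣ z → x ∣ y + z
  ∣-+ (p , eq) (q , eq′) = p + q , trans (distribʳ _ p q) (+-cong eq eq′)

  ∣-neg : ∀ {x y} → x ∣ y → x ∣ - y
  ∣-neg {x} (p , eq) = - p , trans (solve 2 (λ p x → (:- p) :* x := :- (p :* x)) refl p x) (-‿cong eq)

  ∣-- : ∀ {x y z} → x ∣ y → x ∣ z → x ∣ y - z
  ∣-- x∣y x∣z = ∣-+ x∣y (∣-neg x∣z)

  ∣0 : ∀ x → x ∣ 0#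
  ∣0 x = 0# , zeroˡ x

  1∣ : ∀ x → 1# ∣ x
  1∣ x = x , *-identityʳ x

  ∣-sum : ∀ {n x} {v : Fin n → Carrier} → (∀ i → x ∣ v i) → x ∣ sum v
  ∣-sum {zero}  _   = ∣0 _
  ∣-sum {suc n} x∣v = ∣-+ (x∣v zero) (∣-sum (x∣v ∘ suc))

  *-mono-∣ : ∀ {x y u v} → x ∣ u → y ∣ v → x * y ∣ u * v
  *-mono-∣ {x} {y} (p , eq) (q , eq′) = p * q ,
    trans (solve 4 (λ p q x y → (p :* q) :* (x :* y) := (p :* x) :* (q :* y)) refl p q x y) (*-cong eq eq′)

  ^-mono-∣ : ∀ x {m n} → m ≤ n → x ^ m ∣ x ^ n
  ^-mono-∣ x {m} {n} m≤n = x ^ (n ∸ m) ,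
    trans (sym (^-homo-* x (n ∸ m) m)) (^-congʳ x (ℕ.m∸n+n≡m m≤n))

  x-y∣x^n-y^n : ∀ x y n → (x - y) ∣ (x ^ n - y ^ n)
  x-y∣x^n-y^n x y zero    = ∣-respʳ (sym (-‿inverseʳ 1#)) (∣0 _)
  x-y∣x^n-y^n x y (suc n) = ∣-respʳ
    (solve 4 (λ x y p q → x :* (p :- q) :+ (x :- y) :* q := x :* p :- y :* q) refl x y (x ^ n) (y ^ n))
    (∣-+ (∣-*ˡ x (x-y∣x^n-y^n x y n)) (x∣x*y (x - y) (y ^ n)))

  -- Coprimality as a Bézout identity makes sense in every commutative ring and passes to products,
  -- powers and divisors by explicit formulas.
  Comaximal : Carrier → Carrier → Set (c ⊔ e)
  Comaximal a b = ∃₂ λ u v → u * a + v * b ≈ 1#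

  comaximal-sym : ∀ {a b} → Comaximal a b → Comaximal b a
  comaximal-sym (u , v , eq) = v , u , trans (+-comm _ _) eq

  comaximal-1 : ∀ a → Comaximal 1# a
  comaximal-1 a = 1# , 0# , solve 1 (λ a → 1′ :* 1′ :+ 0′ :* a := 1′) refl a

  -- The second Bézout identity is inserted into the term u a of the first, as u a = u a (u′ b + v′
  -- x).
  comaximal-* : ∀ {a b x} → Comaximal a x → Comaximal b x → Comaximal (a * b) x
  comaximal-* {a} {b} {x} (u , v , eq) (u′ , v′ , eq′) = u * u′ , (u * a) * v′ + v , (begin
    (u * u′) * (a * b) + ((u * a) * v′ + v) * x
      ≈⟨ +-cong (solve 4 (λ u w a b → (u :* w) :* (a :* b) := (u :* a) :* (w :* b)) refl u u′ a b)
                (solve 4 (λ p w v x → (p :* w :+ v) :* x := p :* (w :* x) :+ v :* x) refl (u * a) v′ v x) ⟩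
    (u * a) * (u′ * b) + ((u * a) * (v′ * x) + v * x)
      ≈⟨ trans (sym (+-assoc _ _ _)) (+-congʳ (sym (distribˡ (u * a) (u′ * b) (v′ * x)))) ⟩
    (u * a) * (u′ * b + v′ * x) + v * x
      ≈⟨ +-congʳ (trans (*-congˡ eq′) (*-identityʳ (u * a))) ⟩
    u * a + v * x
      ≈⟨ eq ⟩
    1# ∎)

  comaximal-^ : ∀ {a x} n → Comaximal a x → Comaximal (a ^ n) x
  comaximal-^ zero    cm = comaximal-1 _
  comaximal-^ (suc n) cm = comaximal-* cm (comaximal-^ n cm)

  comaximal-∣ : ∀ {a b x} → a ∣ b → Comaximal b x → Comaximal a x
  comaximal-∣ (q , eq) (u , v , eq′) = u * q , v ,
    trans (+-congʳ (trans (*-assoc u q _) (*-congˡ eq))) eq′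

  unit⇒comaximal : ∀ {a t} x → t * a ≈ 1# → Comaximal a x
  unit⇒comaximal {a} {t} x eq = t , 0# , trans (+-congˡ (zeroˡ x)) (trans (+-identityʳ _) eq)

  -1*-1≈1 : - 1# * - 1# ≈ 1#
  -1*-1≈1 = solve 0 ((:- 1′) :* (:- 1′) := 1′) refl

  -- The shape of the discriminant of 1, y, ..., y^(ℓ-1): for a = ℓ, b = D and n = ℓ - 1 it is ± ℓ
  -- (ℓ D)^(ℓ-1).
  signed-power : Carrier → Carrier → ℕ → ℕ → Carrier
  signed-power a b m n = a * ((- 1#) ^ m * (a * b) ^ n)

  comaximal-signed-power : ∀ {a t b x} m n → t * a ≈ 1# → Comaximal b x → Comaximal (signed-power a b m n) x
  comaximal-signed-power {x = x} m n ta≈1 cm = comaximal-* (unit⇒comaximal x ta≈1) (comaximal-*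
    (comaximal-^ m (unit⇒comaximal x -1*-1≈1)) (comaximal-^ n (comaximal-* (unit⇒comaximal x ta≈1) cm)))

  comaximal-product : ∀ {n x} (f : Fin n → Carrier) → (∀ i → Comaximal (f i) x) → Comaximal (product f) x
  comaximal-product {zero}  f cm = comaximal-1 _
  comaximal-product {suc n} f cm = comaximal-* (cm zero) (comaximal-product (f ∘ suc) (cm ∘ suc))

  ∣⇒comaximal-1+ : ∀ {a b} → a ∣ b → Comaximal a (1# + b)
  ∣⇒comaximal-1+ {a} {b} (q , eq) = - q , 1# , trans
    (solve 3 (λ q a b → (:- q) :* a :+ 1′ :* (1′ :+ b) := 1′ :+ (b :- q :* a)) refl q a b)
    (trans (+-congˡ (x≈y⇒x-y≈0 (sym eq))) (+-identityʳ 1#))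

  comaximal-1+ : ∀ {a b x} → x ≈ 1# + b * a → Comaximal a x
  comaximal-1+ {a} {b} eq = proj₁ cm , proj₁ (proj₂ cm) , trans (+-congˡ (*-congˡ eq)) (proj₂ (proj₂ cm))
    where
    cm : Comaximal a (1# + b * a)
    cm = ∣⇒comaximal-1+ (b , refl)

  euclid : ∀ {a b x} → Comaximal a b → a ∣ b * x → a ∣ x
  euclid {a} {b} {x} (u , v , eq) a∣bx = ∣-respʳ (begin
      (u * x) * a + v * (b * x)  ≈⟨ solve 5 (λ u v a b x → (u :* x) :* a :+ v :* (b :* x)
                                       := (u :* a :+ v :* b) :* x) refl u v a b x ⟩
      (u * a + v * b) * x  ≈⟨ trans (*-congʳ eq) (*-identityˡ x) ⟩
      x  ∎)
    (∣-+ (∣-*ˡ (u * x) ∣-refl) (∣-*ˡ v a∣bx))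

  *-∣ : ∀ {a b x} → Comaximal a b → a ∣ x → b ∣ x → a * b ∣ x
  *-∣ {a} {b} {x} cm (p , pa≈x) b∣x = conclude (euclid (comaximal-sym cm) (∣-respʳ (trans (sym pa≈x) (*-comm p a)) b∣x))
    where
    conclude : b ∣ p → a * b ∣ x
    conclude (r , rb≈p) = r , trans (solve 3 (λ r a b → r :* (a :* b) := (r :* b) :* a) refl r a b)
      (trans (*-congʳ rb≈p) pa≈x)

  product-∣ : ∀ {n x} (f : Fin n → Carrier) → (∀ i j → i ≢ j → Comaximal (f i) (f j)) →
              (∀ i → f i ∣ x) → product f ∣ x
  product-∣ {zero}  f cm f∣x = 1∣ _
  product-∣ {suc n} f cm f∣x = *-∣
    (comaximal-sym (comaximal-product (f ∘ suc) λ i → cm (suc i) zero λ ()))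
    (f∣x zero)
    (product-∣ (f ∘ suc) (λ i j i≢j → cm (suc i) (suc j) (i≢j ∘ Fin.suc-injective)) (f∣x ∘ suc))

  [x+y]-y≈x : ∀ x y → (x + y) - y ≈ x
  [x+y]-y≈x = solve 2 (λ x y → (x :+ y) :- y := x) refl

  [x-y]+[y-z]≈x-z : ∀ x y z → (x - y) + (y - z) ≈ x - z
  [x-y]+[y-z]≈x-z = solve 3 (λ x y z → (x :- y) :+ (y :- z) := x :- z) refl

  [x-y]-[x-z]≈z-y : ∀ x y z → (x - y) - (x - z) ≈ z - y
  [x-y]-[x-z]≈z-y = solve 3 (λ x y z → (x :- y) :- (x :- z) := z :- y) refl

  [x-y]-[z-w]≈[x-z]-[y-w] : ∀ x y z w → (x - y) - (z - w) ≈ (x - z) - (y - w)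
  [x-y]-[z-w]≈[x-z]-[y-w] = solve 4 (λ x y z w → (x :- y) :- (z :- w) := (x :- z) :- (y :- w)) refl

  y+z≈[x+y]+[z-x] : ∀ x y z → y + z ≈ (x + y) + (z - x)
  y+z≈[x+y]+[z-x] = solve 3 (λ x y z → y :+ z := (x :+ y) :+ (z :- x)) refl

  bezout-step : ∀ {a b q r s u v} → a ≈ q * b + r → u * b + v * r ≈ s → v * a + (u - v * q) * b ≈ s
  bezout-step {a} {b} {q} {r} {s} {u} {v} eq eq′ = begin
    v * a + (u - v * q) * b  ≈⟨ +-congʳ (*-congˡ eq) ⟩
    v * (q * b + r) + (u - v * q) * b  ≈⟨ solve 5 (λ u v q b r → v :* (q :* b :+ r) :+ (u :- v :* q) :* b
                                            := u :* b :+ v :* r) refl u v q b r ⟩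
    u * b + v * r  ≈⟨ eq′ ⟩
    s  ∎

  unit-gcd⇒comaximal : ∀ {a b s t u v} → u * a + v * b ≈ s → t * s ≈ 1# → Comaximal a b
  unit-gcd⇒comaximal {a} {b} {s} {t} {u} {v} eq eq′ = t * u , t * v , (begin
    (t * u) * a + (t * v) * b  ≈⟨ solve 5 (λ t u v a b → (t :* u) :* a :+ (t :* v) :* b
                                    := t :* (u :* a :+ v :* b)) refl t u v a b ⟩
    t * (u * a + v * b)  ≈⟨ *-congˡ eq ⟩
    t * s  ≈⟨ eq′ ⟩
    1#  ∎)

  -- Both sides keep the factor s, because only a domain allows it to be cancelled; what remains
  -- then is a Bézout identity for the cofactors.
  bezout-cofactors : ∀ {a b a′ b′ s u v} → u * a + v * b ≈ s → a′ * s ≈ a → b′ * s ≈ b →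
                     (u * a′ + v * b′) * s ≈ 1# * s
  bezout-cofactors {a} {b} {a′} {b′} {s} {u} {v} eq eqa eqb = begin
    (u * a′ + v * b′) * s  ≈⟨ solve 5 (λ u v a b s → (u :* a :+ v :* b) :* s
                                        := u :* (a :* s) :+ v :* (b :* s)) refl u v a′ b′ s ⟩
    u * (a′ * s) + v * (b′ * s)  ≈⟨ +-cong (*-congˡ eqa) (*-congˡ eqb) ⟩
    u * a + v * b  ≈⟨ trans eq (sym (*-identityˡ s)) ⟩
    1# * s  ∎

  x+y≈0⇒-y≈x : ∀ {x y} → x + y ≈ 0# → - y ≈ x
  x+y≈0⇒-y≈x {x} {y} eq = trans (solve 2 (λ x y → :- y := x :- (x :+ y)) refl x y)
    (trans (+-congˡ (-‿cong eq)) (solve 1 (λ x → x :- 0′ := x) refl x))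

  x+y≈z⇒x≈z-y : ∀ {x y z} → x + y ≈ z → x ≈ z - y
  x+y≈z⇒x≈z-y {x} {y} eq = trans (sym ([x+y]-y≈x x y)) (+-congʳ eq)

  [x+y]-x≈y : ∀ x y → (x + y) - x ≈ y
  [x+y]-x≈y = solve 2 (λ x y → (x :+ y) :- x := y) refl

  x-[x-y]≈y : ∀ x y → x - (x - y) ≈ y
  x-[x-y]≈y = solve 2 (λ x y → x :- (x :- y) := y) refl

  -[x-y]≈y-x : ∀ x y → - (x - y) ≈ y - x
  -[x-y]≈y-x = solve 2 (λ x y → :- (x :- y) := y :- x) refl

  [z-h*x]*g : ∀ z h x g → (z - h * x) * g ≈ (g * z + x) - (1# + h * g) * x
  [z-h*x]*g = solve 4 (λ z h x g → (z :- h :* x) :* g := (g :* z :+ x) :- (1′ :+ h :* g) :* x) refl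

  g*[D*w]≈D*r : ∀ {g d w r} → w * g ≈ r → g * (d * w) ≈ d * r
  g*[D*w]≈D*r {g} {d} {w} eq = trans (solve 3 (λ g d w → g :* (d :* w) := d :* (w :* g)) refl g d w) (*-congˡ eq)

  *-cancelˡ-domain : IsDomain R → ∀ {x y z} → ¬ (x ≈ 0#) → x * y ≈ x * z → y ≈ z
  *-cancelˡ-domain domain x≉0 eq = domain-cancelʳ R domain x≉0 (trans (*-comm _ _) (trans eq (*-comm _ _)))

  x-0≈x : ∀ x → x - 0# ≈ x
  x-0≈x = solve 1 (λ x → x :- 0′ := x) refl

  [1+x]*y-y : ∀ {x y z} → z ≈ 1# + x → x * y ≈ z * y - y
  [1+x]*y-y {x} {y} eq = trans (solve 2 (λ x y → x :* y := (1′ :+ x) :* y :- y) refl x y) (+-congʳ (*-congʳ (sym eq)))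

  [x-1]*y≈0 : ∀ {x y} → x * y ≈ y → (x - 1#) * y ≈ 0#
  [x-1]*y≈0 {x} {y} eq = trans (solve 2 (λ x y → (x :- 1′) :* y := x :* y :- y) refl x y) (x≈y⇒x-y≈0 eq)

  inverse-cancel : ∀ {x x⁻¹ y} → x * x⁻¹ ≈ 1# → x * y ≈ 0# → y ≈ 0#
  inverse-cancel {x} {x⁻¹} {y} inv xy≈0 = begin
    y  ≈⟨ trans (*-congʳ inv) (*-identityˡ y) ⟨
    x * x⁻¹ * y  ≈⟨ solve 3 (λ x z y → x :* z :* y := z :* (x :* y)) refl x x⁻¹ y ⟩
    x⁻¹ * (x * y)  ≈⟨ trans (*-congˡ xy≈0) (zeroʳ x⁻¹) ⟩
    0#  ∎

  -[0-x]≈x : ∀ x → - (0# - x) ≈ x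
  -[0-x]≈x = solve 1 (λ x → :- (0′ :- x) := x) refl

  comaximal⇒inverse : ∀ {a b u v} → u * a + v * b ≈ 1# → - (u * a) ≈ b * v - 1#
  comaximal⇒inverse {a} {b} {u} {v} eq = trans
    (solve 4 (λ a b u v → :- (u :* a) := b :* v :- (u :* a :+ v :* b)) refl a b u v) (+-congˡ (-‿cong eq))

  difference-unit⇒comaximal : ∀ x a b t → t * (a - b) ≈ 1# → Comaximal (x - a) (x - b)
  difference-unit⇒comaximal x a b t eq = - t , t , trans
    (solve 4 (λ x a b t → (:- t) :* (x :- a) :+ t :* (x :- b) := t :* (a :- b)) refl x a b t) eq

  [x*y]^n*z : ∀ {x y w} n z → x * y ≈ w → (x ^ n * z) * y ^ n ≈ w ^ n * z
  [x*y]^n*z {x} {y} {w} n z eq = begin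
    (x ^ n * z) * y ^ n  ≈⟨ solve 3 (λ x y z → (x :* z) :* y := (x :* y) :* z) refl (x ^ n) (y ^ n) z ⟩
    (x ^ n * y ^ n) * z  ≈⟨ *-congʳ (^-distrib-* x y n) ⟨
    (x * y) ^ n * z  ≈⟨ *-congʳ (^-congˡ n eq) ⟩
    w ^ n * z  ∎

  horner : ∀ {n} (w : Fin (suc n) → Carrier) y →
           w zero + y * sum {n} (λ j → w (suc j) * y ^ toℕ j) ≈ sum {suc n} (λ j → w j * y ^ toℕ j)
  horner {n} w y = +-cong (sym (*-identityʳ _)) (trans (*-distribˡ-sum {n} y λ j → w (suc j) * y ^ toℕ j)
    (sum-cong-≋ {n} λ j → solve 3 (λ y w p → y :* (w :* p) := w :* (y :* p)) refl y (w (suc j)) (y ^ toℕ j)))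

  geometric : Carrier → ℕ → Carrier
  geometric w n = sum {n} λ i → w ^ toℕ i

  geometric-suc : ∀ w n → geometric w (suc n) ≈ 1# + w * geometric w n
  geometric-suc w n = +-congˡ (sym (*-distribˡ-sum {n} w λ i → w ^ toℕ i))

  -- The two ends of the telescope stand on opposite sides, so that the induction needs no
  -- subtraction.
  geometric-telescopes : ∀ w n → w * geometric w n + 1# ≈ geometric w n + w ^ n
  geometric-telescopes w zero    = trans (+-congʳ (zeroʳ w)) refl
  geometric-telescopes w (suc n) = begin
    w * geometric w (suc n) + 1#  ≈⟨ +-congʳ (*-congˡ (geometric-suc w n)) ⟩
    w * (1# + w * geometric w n) + 1#  ≈⟨ solve 2 (λ w g → w :* (1′ :+ g) :+ 1′ := 1′ :+ w :* (g :+ 1′))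
                                                  refl w (w * geometric w n) ⟩
    1# + w * (w * geometric w n + 1#)  ≈⟨ +-congˡ (*-congˡ (geometric-telescopes w n)) ⟩
    1# + w * (geometric w n + w ^ n)  ≈⟨ solve 3 (λ w g p → 1′ :+ w :* (g :+ p) := (1′ :+ w :* g) :+ w :* p)
                                                  refl w (geometric w n) (w ^ n) ⟩
    (1# + w * geometric w n) + w * w ^ n  ≈⟨ +-congʳ (geometric-suc w n) ⟨
    geometric w (suc n) + w ^ suc n  ∎

  geometric-fixed : ∀ {w n} → w ^ n ≈ 1# → w * geometric w n ≈ geometric w n
  geometric-fixed {w} {n} eq = +-cancelʳ 1# _ _ (trans (geometric-telescopes w n) (+-congˡ eq))
    where open import Algebra.Properties.Ring ring using (+-cancelʳ)

  geometric-cong : ∀ {w w′} n → w ≈ w′ → geometric w n ≈ geometric w′ n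
  geometric-cong n eq = sum-cong-≋ {n} λ i → ^-congˡ (toℕ i) eq

  geometric-1 : ∀ n → geometric 1# n ≈ n times 1#
  geometric-1 n = trans (sum-cong-≋ {n} λ i → 1^ (toℕ i)) (sum-replicate n)

-- Roots of unity and the projectors onto eigenspaces

-- The condition on ζ says that the powers of ζ are pairwise distinct in
-- every nonzero quotient of R.
record RootOfUnity {c e} (R : CommutativeRing c e) (ℓ : ℕ) : Set (c ⊔ e) where
  open CommRing R
  open RingTheory R using (geometric; _times_)
  field
    ζ              : Carrier
    ζ^ℓ≈1          : ζ ^ ℓ ≈ 1#
    geometric-ζ^≈0 : ∀ i → 0 < i → i < ℓ → geometric (ζ ^ i) ℓ ≈ 0#
    ℓ⁻¹            : Carrier
    ℓ⁻¹*ℓ≈1        : ℓ⁻¹ * (ℓ times 1#) ≈ 1#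

module _ {a b c d} (A : CommutativeRing a b) (B : CommutativeRing c d)
         {f : CommutativeRing.Carrier A → CommutativeRing.Carrier B} (f-isHom : IsHom A B f) where
  private
    module A = CommRing A
    module B = CommRing B
    module AT = RingTheory A
    module BT = RingTheory B
  open RingMorphisms.IsRingHomomorphism f-isHom

  hom-^ : ∀ x n → f (x A.^ n) B.≈ f x B.^ n
  hom-^ x zero    = 1#-homo
  hom-^ x (suc n) = B.trans (*-homo _ _) (B.*-congˡ (hom-^ x n))

  hom-sum : ∀ {n} (v : Fin n → A.Carrier) → f (A.sum v) B.≈ B.sum (f ∘ v)
  hom-sum {zero}  v = 0#-homo
  hom-sum {suc n} v = B.trans (+-homo _ _) (B.+-congˡ (hom-sum (v ∘ suc)))

  hom-times : ∀ n → f (n AT.times A.1#) B.≈ n BT.times B.1#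
  hom-times zero    = 0#-homo
  hom-times (suc n) = B.trans (+-homo _ _) (B.+-cong 1#-homo (hom-times n))

  hom-geometric : ∀ w n → f (AT.geometric w n) B.≈ BT.geometric (f w) n
  hom-geometric w n = B.trans (hom-sum {n} λ i → w A.^ toℕ i) (BT.sum-cong-≋ {n} λ i → hom-^ w (toℕ i))

  hom-signed-power : ∀ a b m n → f (AT.signed-power a b m n) B.≈ BT.signed-power (f a) (f b) m n
  hom-signed-power a b m n = B.trans (*-homo a _) (B.*-congˡ (B.trans (*-homo _ _) (B.*-cong
    (B.trans (hom-^ (A.- A.1#) m) (BT.^-congˡ m (B.trans (-‿homo A.1#) (B.-‿cong 1#-homo))))
    (B.trans (hom-^ (a A.* b) n) (BT.^-congˡ n (*-homo a b))))))

  -- The record consists of equations only, hence it is carried along by every homomorphism,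
  -- including the one into the ring of integers modulo g, where "ζ^i ≠ 1" would be too weak to use.
  mapRootOfUnity : ∀ {ℓ} → RootOfUnity A ℓ → RootOfUnity B ℓ
  mapRootOfUnity {ℓ} ω = record
    { ζ = f ζ
    ; ζ^ℓ≈1 = B.trans (B.sym (hom-^ ζ ℓ)) (B.trans (⟦⟧-cong ζ^ℓ≈1) 1#-homo)
    ; geometric-ζ^≈0 = λ i 0<i i<ℓ → B.trans (BT.geometric-cong ℓ (B.sym (hom-^ ζ i)))
        (B.trans (B.sym (hom-geometric (ζ A.^ i) ℓ)) (B.trans (⟦⟧-cong (geometric-ζ^≈0 i 0<i i<ℓ)) 0#-homo))
    ; ℓ⁻¹ = f ℓ⁻¹
    ; ℓ⁻¹*ℓ≈1 = B.trans (B.*-congˡ (B.sym (hom-times ℓ))) (B.trans (B.sym (*-homo _ _))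
        (B.trans (⟦⟧-cong ℓ⁻¹*ℓ≈1) 1#-homo))
    } where open RootOfUnity ω

module RootsOfUnity {c e} (R : CommutativeRing c e) {ℓ} (ω : RootOfUnity R ℓ) where
  open CommRing R
  open RingTheory R
  open RootOfUnity ω
  open IntegerSolver R
  open SetoidReasoning setoid

  ζ^n^ℓ≈1 : ∀ n → (ζ ^ n) ^ ℓ ≈ 1#
  ζ^n^ℓ≈1 n = trans (^-comm ζ n ℓ) (trans (^-congˡ n ζ^ℓ≈1) (1^ n))

  ζ^-inverse : ∀ n → n ≤ ℓ → ζ ^ (ℓ ∸ n) * ζ ^ n ≈ 1#
  ζ^-inverse n n≤ℓ = trans (sym (^-homo-* ζ (ℓ ∸ n) n)) (trans (^-congʳ ζ (ℕ.m∸n+n≡m n≤ℓ)) ζ^ℓ≈1)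

  ζ^-twist : ∀ j y → y ^ ℓ ≈ 1# → (ζ ^ j * y) ^ ℓ ≈ 1#
  ζ^-twist j y eq = trans (^-distrib-* (ζ ^ j) y ℓ) (trans (*-cong (ζ^n^ℓ≈1 j) eq) (*-identityˡ 1#))

  -- For y^ℓ = 1 the elements geometric (ζ ^ j * y) ℓ are ℓ times the
  -- idempotents projecting onto the eigenspaces of y.
  eigen : ∀ (j : Fin ℓ) y → y ^ ℓ ≈ 1# →
    y * geometric (ζ ^ toℕ j * y) ℓ ≈ ζ ^ (ℓ ∸ toℕ j) * geometric (ζ ^ toℕ j * y) ℓ
  eigen j y eq = begin
    y * E  ≈⟨ trans (*-congʳ (ζ^-inverse (toℕ j) (ℕ.<⇒≤ (Fin.toℕ<n j)))) (*-identityˡ _) ⟨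
    (ζ ^ (ℓ ∸ toℕ j) * ζ ^ toℕ j) * (y * E)  ≈⟨ solve 4 (λ a b y E → (a :* b) :* (y :* E) := a :* ((b :* y) :* E))
                                                   refl (ζ ^ (ℓ ∸ toℕ j)) (ζ ^ toℕ j) y E ⟩
    ζ ^ (ℓ ∸ toℕ j) * ((ζ ^ toℕ j * y) * E)  ≈⟨ *-congˡ (geometric-fixed {n = ℓ} (ζ^-twist (toℕ j) y eq)) ⟩
    ζ ^ (ℓ ∸ toℕ j) * E  ∎
    where E = geometric (ζ ^ toℕ j * y) ℓ

  -- The factor `0# ^ i` is a Kronecker delta: it is 1 for i = 0 and 0 otherwise.
  orthogonality : ∀ i → i < ℓ → sum {ℓ} (λ j → (ζ ^ toℕ j) ^ i) ≈ (ℓ times 1#) * 0# ^ i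
  orthogonality zero    _   = trans (sum-replicate ℓ) (sym (*-identityʳ _))
  orthogonality (suc i) i<ℓ = trans (sum-cong-≋ {ℓ} λ j → ^-comm ζ (toℕ j) (suc i))
    (trans (geometric-ζ^≈0 (suc i) (s≤s z≤n) i<ℓ) (sym (trans (*-congˡ (0^ {suc i} (s≤s z≤n))) (zeroʳ _))))

  -- After the two sums are exchanged, orthogonality leaves only the term with i = 0. As ℓ is a
  -- unit, an identity may therefore be checked after multiplication by each projector.
  resolution : ∀ y → 0 < ℓ → sum {ℓ} (λ j → geometric (ζ ^ toℕ j * y) ℓ) ≈ ℓ times 1#
  resolution y 0<ℓ = begin
    sum {ℓ} (λ j → sum {ℓ} λ i → (ζ ^ toℕ j * y) ^ toℕ i)
      ≈⟨ ∑-comm {ℓ} {ℓ} (λ j i → (ζ ^ toℕ j * y) ^ toℕ i) ⟩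
    sum {ℓ} (λ i → sum {ℓ} λ j → (ζ ^ toℕ j * y) ^ toℕ i)
      ≈⟨ sum-cong-≋ {ℓ} (λ i → trans (sum-cong-≋ {ℓ} λ j → ^-distrib-* (ζ ^ toℕ j) y (toℕ i))
           (trans (sym (*-distribʳ-sum {ℓ} (y ^ toℕ i) λ j → (ζ ^ toℕ j) ^ toℕ i))
             (*-congʳ (orthogonality (toℕ i) (Fin.toℕ<n i))))) ⟩
    sum {ℓ} (λ i → ((ℓ times 1#) * 0# ^ toℕ i) * y ^ toℕ i)
      ≈⟨ sum-head 0<ℓ ⟩
    ℓ times 1# ∎
    where
    sum-head : ∀ {m} → 0 < m → sum {m} (λ i → ((ℓ times 1#) * 0# ^ toℕ i) * y ^ toℕ i) ≈ ℓ times 1#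
    sum-head {suc m} _ = trans
      (sum-single {suc m} (λ i → ((ℓ times 1#) * 0# ^ toℕ i) * y ^ toℕ i) zero
        λ { zero 0≢0 → ⊥-elim (0≢0 ≡.refl)
          ; (suc i) _ → trans (*-congʳ (trans (*-congˡ (0^ {suc (toℕ i)} (s≤s z≤n))) (zeroʳ _))) (zeroˡ _) })
      (trans (*-identityʳ _) (*-identityʳ _))

  module _ (domain : IsDomain R) (_≟_ : Decidable _≈_) where
    -- The projectors belonging to w add up to the unit ℓ, so one of them is nonzero; in a domain it
    -- can be cancelled from its eigenvalue equation, which leaves w equal to a power of ζ. No count
    -- of roots is involved.
    root-of-1 : 0 < ℓ → ∀ w → w ^ ℓ ≈ 1# → ∃ λ n → w ≈ ζ ^ n
    root-of-1 0<ℓ w eq = from-eigenspace (Fin.any? λ j → ¬? (E j ≟ 0#))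
      where
      E : Fin ℓ → Carrier
      E j = geometric (ζ ^ toℕ j * w) ℓ
      from-eigenspace : Dec (∃ λ j → ¬ (E j ≈ 0#)) → ∃ λ n → w ≈ ζ ^ n
      from-eigenspace (no ¬E≉0) = ⊥-elim (proj₁ domain (begin
        0#  ≈⟨ zeroʳ ℓ⁻¹ ⟨
        ℓ⁻¹ * 0#  ≈⟨ *-congˡ (sum-0 {ℓ} λ j → decidable-stable (E j ≟ 0#) λ E≉0 → ¬E≉0 (j , E≉0)) ⟨
        ℓ⁻¹ * sum E  ≈⟨ *-congˡ (resolution w 0<ℓ) ⟩
        ℓ⁻¹ * (ℓ times 1#)  ≈⟨ ℓ⁻¹*ℓ≈1 ⟩
        1#  ∎))
      from-eigenspace (yes (j , E≉0)) = ℓ ∸ toℕ j , domain-cancelʳ R domain E≉0 (eigen j w eq)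

-- Polynomials over a field: degree, division, common divisors

domain-^≉0 : ∀ {c e} (R : CommutativeRing c e) → IsDomain R → let open CommRing R in
             ∀ {a} n → ¬ (a ≈ 0#) → ¬ (a ^ n ≈ 0#)
domain-^≉0 R domain zero    a≉0 1≈0 = proj₁ domain (CommutativeRing.sym R 1≈0)
domain-^≉0 R domain (suc n) a≉0 = FractionField.nonzero-* R domain a≉0 (domain-^≉0 R domain n a≉0)

field-isDomain : ∀ {c e} (k : Field c e) → Decidable (Field._≈_ k) → IsDomain (Field.commutativeRing k)
field-isDomain k _≟_ = proj₁ isField , λ x y xy≈0 → split x y xy≈0 (x ≟ 0#)
  where
  open Field k
  split : ∀ x y → x * y ≈ 0# → Dec (x ≈ 0#) → x ≈ 0# ⊎ y ≈ 0#
  split x y xy≈0 (yes x≈0) = inj₁ x≈0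
  split x y xy≈0 (no x≉0) with proj₂ isField x x≉0
  ... | x⁻¹ , xx⁻¹≈1 = inj₂ (trans (sym (trans (*-congʳ (trans (*-comm x⁻¹ x) xx⁻¹≈1)) (*-identityˡ y)))
    (trans (*-assoc x⁻¹ x y) (trans (*-congˡ xy≈0) (zeroʳ x⁻¹))))

module PolynomialsOverField {c e} (k : Field c e) (_≟_ : Decidable (Field._≈_ k)) where
  open Field k hiding (zero)
  open Polynomials commutativeRing public
  module P = CommRing polynomialRing
  module PT = RingTheory polynomialRing
  open PT using (Comaximal; comaximal-sym; comaximal-^; euclid; ∣-trans; ∣-respʳ; ∣-refl; ∣-*ˡ; ∣-+; ∣--; ∣0)
  open import Algebra.Definitions.RawMagma P.*-rawMagma using (_,_)

  domain : IsDomain polynomialRing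
  domain = polynomialRing-isDomain k _≟_

  -- A strict bound on the degree that the zero polynomial satisfies as well, as is needed for
  -- remainders.
  Below : Poly → ℕ → Set e
  Below p n = ∀ m → n ≤ m → coeff p m ≈ 0#

  below-mono : ∀ {p m n} → m ≤ n → Below p m → Below p n
  below-mono m≤n b i n≤i = b i (ℕ.≤-trans m≤n n≤i)

  below-resp : ∀ {p q n} → p ≈ₚ q → Below p n → Below q n
  below-resp p≈q b i n≤i = trans (sym (coeff-≈ p≈q i)) (b i n≤i)

  below-+ : ∀ p q {n} → Below p n → Below q n → Below (p +ₚ q) n
  below-+ p q b b′ i n≤i = trans (coeff-+ p q i) (trans (+-cong (b i n≤i) (b′ i n≤i)) (+-identityˡ 0#))

  below-neg : ∀ p {n} → Below p n → Below (-ₚ p) n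
  below-neg p b i n≤i = trans (coeff-neg p i) (trans (-‿cong (b i n≤i)) -0#≈0#)
    where open import Algebra.Properties.Ring ring using (-0#≈0#)

  below-scale : ∀ a p {n} → Below p n → Below (scale a p) n
  below-scale a p b i n≤i = trans (coeff-scale a p i) (trans (*-congˡ (b i n≤i)) (zeroʳ a))

  below-∷ : ∀ {a p n} → Below p n → Below (a ∷ p) (suc n)
  below-∷ b (suc i) (s≤s n≤i) = b i n≤i

  below-0 : ∀ {p} → Below p 0 → p ≈ₚ []
  below-0 b = coeffs λ n → b n z≤n

  coeff-0 : ∀ {p} → p ≈ₚ [] → ∀ n → coeff p n ≈ 0#
  coeff-0 p≈0 n = coeff-≈ p≈0 n

  0*≈0 : ∀ {p} q → p ≈ₚ [] → p *ₚ q ≈ₚ []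
  0*≈0 q p≈0 = P.*-congʳ {x = q} p≈0

  -- The bounds say that the degrees are at most m - 1 and n, so that of the product is at most m +
  -- n - 1. Writing the second bound as a successor avoids truncated subtraction.
  below-* : ∀ p q {m n} → Below p m → Below q (suc n) → Below (p *ₚ q) (m ℕ.+ n)
  below-* []      q b b′ i _ = refl
  below-* (a ∷ p) q {zero}  {n} b b′ i n≤i = coeff-0 (0*≈0 {a ∷ p} q (below-0 b)) i
  below-* (a ∷ p) q {suc m} {n} b b′ = below-+ (scale a q) (0# ∷ p *ₚ q)
    (below-scale a q (below-mono {q} (s≤s (ℕ.m≤n+m n m)) b′))
    (below-∷ (below-* p q {m} {n} (λ i m≤i → b (suc i) (s≤s m≤i)) b′))

  coeff-*-top : ∀ p q {m n} → Below p (suc m) → Below q (suc n) →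
                coeff (p *ₚ q) (m ℕ.+ n) ≈ coeff p m * coeff q n
  coeff-*-top []      q b b′ = sym (zeroˡ _)
  coeff-*-top (a ∷ p) q {zero}  {n} b b′ = trans (coeff-+ (scale a q) (0# ∷ p *ₚ q) n)
    (trans (+-cong (coeff-scale a q n) (coeff-0 (0∷≈0 refl (0*≈0 {p} q p≈0)) n)) (+-identityʳ _))
    where
    p≈0 : p ≈ₚ []
    p≈0 = coeffs λ i → b (suc i) (s≤s z≤n)
  coeff-*-top (a ∷ p) q {suc m} {n} b b′ = trans (coeff-+ (scale a q) (0# ∷ p *ₚ q) (suc (m ℕ.+ n)))
    (trans (+-cong (below-scale a q b′ (suc (m ℕ.+ n)) (s≤s (ℕ.m≤n+m n m)))
                   (coeff-*-top p q {m} {n} (λ i m<i → b (suc i) (s≤s m<i)) b′))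
      (+-identityˡ _))

  below-degree : ∀ {p m n} → HasDegree p m → Below p n → m < n
  below-degree {p} {m} {n} (lc≉0 , _) b with n ℕ.≤? m
  ... | yes n≤m = ⊥-elim (lc≉0 (b m n≤m))
  ... | no  n≰m = ℕ.≰⇒> n≰m

  degree-unique : ∀ {p m n} → HasDegree p m → HasDegree p n → m ≡ n
  degree-unique {p} h h′ = ℕ.≤-antisym (ℕ.≤-pred (below-degree {p} h (proj₂ h′))) (ℕ.≤-pred (below-degree {p} h′ (proj₂ h)))

  degree-resp : ∀ {p q n} → p ≈ₚ q → HasDegree p n → HasDegree q n
  degree-resp {p} {q} {n} p≈q (lc≉0 , b) = (λ eq → lc≉0 (trans (coeff-≈ p≈q n) eq)) , below-resp {p} {q} p≈q b

  degree≉0 : ∀ {p n} → HasDegree p n → ¬ (p ≈ₚ [])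
  degree≉0 {n = n} (lc≉0 , _) p≈0 = lc≉0 (coeff-≈ p≈0 n)

  -- Trailing zeros hide the degree in the list, so the tail is examined before the head; the head
  -- matters only if the tail is zero.
  degree? : ∀ p → p ≈ₚ [] ⊎ ∃ (HasDegree p)
  degree? [] = inj₁ P.refl
  degree? (a ∷ p) with degree? p
  ... | inj₂ (n , lc≉0 , b) = inj₂ (suc n , lc≉0 , below-∷ {n = suc n} b)
  ... | inj₁ p≈0 with a ≟ 0#
  ...   | yes a≈0 = inj₁ (0∷≈0 a≈0 p≈0)
  ...   | no  a≉0 = inj₂ (0 , a≉0 , λ { (suc m) _ → coeff-≈ p≈0 m })

  ≉0⇒degree : ∀ {p} → ¬ (p ≈ₚ []) → ∃ (HasDegree p)
  ≉0⇒degree {p} p≉0 with degree? p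
  ... | inj₁ p≈0 = ⊥-elim (p≉0 p≈0)
  ... | inj₂ h   = h

  _≟ₚ_ : Decidable _≈ₚ_
  p ≟ₚ q with degree? (p P.- q)
  ... | inj₁ p-q≈0   = yes (PT.x-y≈0⇒x≈y p-q≈0)
  ... | inj₂ (_ , h) = no (degree≉0 {p P.- q} h ∘ PT.x≈y⇒x-y≈0)

  degree-* : ∀ {p q m n} → HasDegree p m → HasDegree q n → HasDegree (p *ₚ q) (m ℕ.+ n)
  degree-* {p} {q} (lc≉0 , b) (lc≉0′ , b′) =
    (λ eq → FractionField.nonzero-* commutativeRing (field-isDomain k _≟_) lc≉0 lc≉0′
      (trans (sym (coeff-*-top p q b b′)) eq)) ,
    below-* p q b b′

  degree-+-below : ∀ {p q n} → HasDegree p n → Below q n → HasDegree (p +ₚ q) n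
  degree-+-below {p} {q} {n} (lc≉0 , b) b′ =
    (λ eq → lc≉0 (trans (sym (trans (coeff-+ p q n) (trans (+-congˡ (b′ n ℕ.≤-refl)) (+-identityʳ _)))) eq)) ,
    below-+ p q b (below-mono {q} (ℕ.n≤1+n n) b′)

  degree-1 : HasDegree 1ₚ 0
  degree-1 = (proj₁ isField ∘ sym) , λ { (suc m) _ → refl }

  degree-^ : ∀ {p m} n → HasDegree p m → HasDegree (p P.^ n) (n ℕ.* m)
  degree-^ zero    h = degree-1
  degree-^ {p} (suc n) h = degree-* {p} {p P.^ n} h (degree-^ n h)

  degree-product : ∀ {n m} (f : Fin n → Poly) → (∀ i → HasDegree (f i) m) → HasDegree (PT.product f) (n ℕ.* m)
  degree-product {zero}  f h = degree-1
  degree-product {suc n} f h = degree-* {f zero} {PT.product (f ∘ suc)} (h zero) (degree-product (f ∘ suc) (h ∘ suc))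

  divisor-degree : ∀ {p q n} → HasDegree q n → p P.∣ q → ∃ λ m → HasDegree p m × m ≤ n
  divisor-degree {p} {q} {n} h (r , rp≈q) with degree? p | degree? r
  ... | inj₁ p≈0     | _            = ⊥-elim (degree≉0 {q} h (P.trans (P.sym rp≈q) (P.trans (P.*-congˡ {x = r} p≈0) (P.zeroʳ r))))
  ... | inj₂ _       | inj₁ r≈0     = ⊥-elim (degree≉0 {q} h (P.trans (P.sym rp≈q) (0*≈0 {r} p r≈0)))
  ... | inj₂ (m , h₁) | inj₂ (l , h₂) = m , h₁ ,
    ≡.subst (m ≤_) (degree-unique {q} (degree-resp {r *ₚ p} {q} rp≈q (degree-* {r} {p} h₂ h₁)) h) (ℕ.m≤n+m m l)

  mutual-∣⇒degree≡ : ∀ {p q m n} → p P.∣ q → q P.∣ p → HasDegree p m → HasDegree q n → m ≡ n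
  mutual-∣⇒degree≡ {p} {q} p∣q q∣p h h′ with divisor-degree {p} {q} h′ p∣q | divisor-degree {q} {p} h q∣p
  ... | m , h₁ , m≤n | n , h₂ , n≤m = ℕ.≤-antisym
    (≡.subst (_≤ _) (degree-unique {p} h₁ h) m≤n) (≡.subst (_≤ _) (degree-unique {q} h₂ h′) n≤m)

  constant : Carrier → Poly
  constant a = a ∷ []

  constant-* : ∀ a p → constant a *ₚ p ≈ₚ scale a p
  constant-* a p = P.trans (P.+-congˡ {x = scale a p} (0∷≈0 refl P.refl)) (+ₚ-identityʳ (scale a p))

  constant-isHom : IsHom commutativeRing polynomialRing constant
  constant-isHom = mkIsHom commutativeRing polynomialRing (λ a≈b → a≈b ∷-cong P.refl) (λ a b → P.refl) (0∷≈0 refl P.refl)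
    (λ a b → sym (+-identityʳ _) ∷-cong P.refl) P.refl (λ a → P.refl)

  degree-0⇒unit : ∀ {p} → HasDegree p 0 → p P.∣ 1ₚ
  degree-0⇒unit {p} (lc≉0 , b) with proj₂ isField (coeff p 0) lc≉0
  ... | lc⁻¹ , eq = constant lc⁻¹ , P.trans (constant-* lc⁻¹ p) (coeffs
    λ { zero    → trans (coeff-scale lc⁻¹ p 0) (trans (*-comm lc⁻¹ _) eq)
      ; (suc n) → below-scale lc⁻¹ p b (suc n) (s≤s z≤n) })

  unit⇒degree-0 : ∀ {p} → p P.∣ 1ₚ → HasDegree p 0
  unit⇒degree-0 {p} p∣1 with divisor-degree {p} {1ₚ} degree-1 p∣1
  ... | zero , h , z≤n = h

  degree>0⇒∤1 : ∀ {p n} → HasDegree p n → 0 < n → ¬ (p P.∣ 1ₚ)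
  degree>0⇒∤1 {p} h 0<n p∣1 with degree-unique {p} h (unit⇒degree-0 {p} p∣1)
  degree>0⇒∤1 h () p∣1 | ≡.refl

  module _ {f n} (h : HasDegree f n) (a : Carrier) (p q r : Poly) where
    private
      lc⁻¹ x : Carrier
      lc⁻¹ = proj₁ (proj₂ isField (coeff f n) (proj₁ h))
      x = coeff (a ∷ r) n * lc⁻¹

      x*lc : x * coeff f n ≈ coeff (a ∷ r) n
      x*lc = trans (*-assoc (coeff (a ∷ r) n) lc⁻¹ (coeff f n)) (trans
        (*-congˡ (trans (*-comm lc⁻¹ (coeff f n)) (proj₂ (proj₂ isField (coeff f n) (proj₁ h)))))
        (*-identityʳ (coeff (a ∷ r) n)))

      top : coeff ((a ∷ r) P.- scale x f) n ≈ 0#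
      top = trans (coeff-+ (a ∷ r) (-ₚ scale x f) n) (trans
        (+-congˡ (trans (coeff-neg (scale x f) n) (-‿cong (trans (coeff-scale x f n) x*lc))))
        (-‿inverseʳ (coeff (a ∷ r) n)))

    -- From p = q f + r follows a + t p = (t q) f + (a + t r). Only the coefficient of index n of a
    -- + t r can be too high, and the multiple x f removes it.
    divide-step : p ≈ₚ q *ₚ f +ₚ r → Below r n → ∃₂ λ q r → a ∷ p ≈ₚ q *ₚ f +ₚ r × Below r n
    divide-step eq b = x ∷ q , (a ∷ r) P.- scale x f ,
      P.trans (sym (+-identityˡ a) ∷-cong eq) (PT.y+z≈[x+y]+[z-x] (scale x f) (0# ∷ q *ₚ f) (a ∷ r)) , below
      where
      below : Below ((a ∷ r) P.- scale x f) n
      below i n≤i with ℕ.m≤n⇒m<n∨m≡n n≤i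
      ... | inj₁ n<i = below-+ (a ∷ r) (-ₚ scale x f) (below-∷ {n = n} b)
                         (below-neg (scale x f) (below-scale x f (proj₂ h))) i n<i
      ... | inj₂ ≡.refl = top

  opaque
    divide : ∀ {f n} → HasDegree f n → ∀ p → ∃₂ λ q r → p ≈ₚ q *ₚ f +ₚ r × Below r n
    divide h [] = [] , [] , P.refl , λ _ _ → refl
    divide h (a ∷ p) with divide h p
    ... | q , r , eq , b = divide-step h a p q r eq b

  small-multiple : ∀ {f n r} → HasDegree f n → Below r n → f P.∣ r → r ≈ₚ []
  small-multiple {f} {n} {r} h b f∣r with degree? r
  ... | inj₁ r≈0 = r≈0
  ... | inj₂ (m , h′) with divisor-degree {f} {r} h′ f∣r
  ...   | m′ , h″ , m′≤m = ⊥-elim (ℕ.<⇒≱ (below-degree {r} h′ b)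
          (≡.subst (_≤ m) (degree-unique {f} h″ h) m′≤m))

  module Remainder {f n} (h : HasDegree f n) where
    quotient remainder : Poly → Poly
    quotient p  = proj₁ (divide {f} h p)
    remainder p = proj₁ (proj₂ (divide {f} h p))

    division : ∀ p → p ≈ₚ quotient p *ₚ f +ₚ remainder p
    division p = proj₁ (proj₂ (proj₂ (divide {f} h p)))

    remainder-below : ∀ p → Below (remainder p) n
    remainder-below p = proj₂ (proj₂ (proj₂ (divide {f} h p)))

    f∣p-remainder : ∀ p → f P.∣ (p P.- remainder p)
    f∣p-remainder p = quotient p , P.sym (P.trans (P.+-congʳ {x = P.- remainder p} (division p))
      (PT.[x+y]-y≈x (quotient p *ₚ f) (remainder p)))

    remainder-unique : ∀ p r → Below r n → f P.∣ (p P.- r) → remainder p ≈ₚ r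
    remainder-unique p r b f∣p-r = PT.x-y≈0⇒x≈y (small-multiple {f} {n} {remainder p P.- r} h
      (below-+ (remainder p) (-ₚ r) (remainder-below p) (below-neg r b))
      (∣-respʳ (PT.[x-y]-[x-z]≈z-y p r (remainder p))
        (∣-- f∣p-r (f∣p-remainder p))))

    remainder-cong : ∀ {p q} → f P.∣ (p P.- q) → remainder p ≈ₚ remainder q
    remainder-cong {p} {q} f∣ = remainder-unique p (remainder q) (remainder-below q) (∣-respʳ
      (PT.[x-y]+[y-z]≈x-z p q (remainder q))
      (∣-+ f∣ (f∣p-remainder q)))

    remainder-injective : ∀ {p q} → remainder p ≈ₚ remainder q → f P.∣ (p P.- q)
    remainder-injective {p} {q} eq = ∣-respʳ (P.trans
        (PT.[x-y]-[z-w]≈[x-z]-[y-w] p (remainder p) q (remainder q))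
        (P.trans (P.+-congˡ {x = p P.- q} (P.-‿cong (PT.x≈y⇒x-y≈0 eq))) (P.+-identityʳ _)))
      (∣-- (f∣p-remainder p) (f∣p-remainder q))

    remainder≈0⇒∣ : ∀ {p} → remainder p ≈ₚ [] → f P.∣ p
    remainder≈0⇒∣ {p} eq = quotient p , P.sym (P.trans (division p)
      (P.trans (P.+-congˡ {x = quotient p *ₚ f} eq) (+ₚ-identityʳ _)))

    ∣⇒remainder≈0 : ∀ {p} → f P.∣ p → remainder p ≈ₚ []
    ∣⇒remainder≈0 {p} f∣p = remainder-unique p [] (λ _ _ → refl) (∣-respʳ (P.sym (+ₚ-identityʳ p)) f∣p)

  record GCD (a b : Poly) : Set (c ⊔ e) where
    field
      gcd   : Poly
      gcd∣a : gcd P.∣ a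
      gcd∣b : gcd P.∣ b
      u v   : Poly
      bezout : u *ₚ a +ₚ v *ₚ b ≈ₚ gcd

  opaque
    -- The number `n` bounds the degree of the second argument and drops with each division, so it
    -- is the measure of the recursion.
    gcd-below : ∀ n a b → Below b n → GCD a b
    gcd-below n a b below with degree? b
    ... | inj₁ b≈0 = record
      { gcd = a ; gcd∣a = ∣-refl ; gcd∣b = ∣-respʳ (P.sym b≈0) (∣0 a) ; u = 1ₚ ; v = []
      ; bezout = P.trans (+ₚ-identityʳ (1ₚ *ₚ a)) (*ₚ-identityˡ a) }
    gcd-below zero    a b below | inj₂ (m , h) = ⊥-elim (degree≉0 {b} h (below-0 below))
    gcd-below (suc n) a b below | inj₂ (m , h) = record
      { gcd = s.gcd ; gcd∣b = s.gcd∣a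
      ; gcd∣a = ∣-respʳ (P.sym (division a)) (∣-+ (∣-*ˡ (quotient a) s.gcd∣a) s.gcd∣b)
      ; u = s.v ; v = s.u P.- s.v *ₚ quotient a
      ; bezout = PT.bezout-step {a} {b} {quotient a} {remainder a} {s.gcd} {s.u} {s.v} (division a) s.bezout }
      where
      open Remainder {b} h
      module s = GCD (gcd-below n b (remainder a)
        (below-mono {remainder a} (ℕ.≤-pred (below-degree {b} h below)) (remainder-below a)))

  euclidean : ∀ a b → GCD a b
  euclidean a b with degree? b
  ... | inj₁ b≈0           = gcd-below 0 a b (λ n _ → coeff-≈ b≈0 n)
  ... | inj₂ (n , _ , below) = gcd-below (suc n) a b below

  -- The gcd s of p and a gives a factorisation p = r s. If r is a unit, then p divides a along with
  -- s; if s is a unit, its Bézout identity rescales to one for 1.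
  irreducible-∣⊎comaximal : ∀ {p} → P.Irreducible p → ∀ a → p P.∣ a ⊎ Comaximal p a
  irreducible-∣⊎comaximal {p} irr a with euclidean p a
  ... | record { gcd = s ; gcd∣a = r , rs≈p ; gcd∣b = s∣a ; u = u ; v = v ; bezout = eq }
      with P.Irreducible.split-∣1 irr (P.sym rs≈p)
  ...   | inj₁ (r⁻¹ , r⁻¹r≈1) = inj₁ (∣-trans (r⁻¹ , (begin
            r⁻¹ *ₚ p  ≈⟨ P.*-congˡ {x = r⁻¹} rs≈p ⟨
            r⁻¹ *ₚ (r *ₚ s)  ≈⟨ *ₚ-assoc r⁻¹ r s ⟨
            (r⁻¹ *ₚ r) *ₚ s  ≈⟨ P.*-congʳ {x = s} r⁻¹r≈1 ⟩
            1ₚ *ₚ s  ≈⟨ *ₚ-identityˡ s ⟩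
            s  ∎)) s∣a)
          where open SetoidReasoning polySetoid
  ...   | inj₂ (s⁻¹ , s⁻¹s≈1) = inj₂ (PT.unit-gcd⇒comaximal {p} {a} {s} {s⁻¹} {u} {v} eq s⁻¹s≈1)

  irreducible-degree : ∀ {p} → P.Irreducible p → ∃ λ n → HasDegree p n × 0 < n
  irreducible-degree {p} irr with degree? p
  ... | inj₂ (zero , h)  = ⊥-elim (P.Irreducible.p∤1 irr (degree-0⇒unit {p} h))
  ... | inj₂ (suc n , h) = suc n , h , s≤s z≤n
  -- The factorisation 0 = 0 · 0 would make 0 a unit.
  ... | inj₁ p≈0 with P.Irreducible.split-∣1 irr {[]} {[]} p≈0
  ...   | inj₁ 0∣1 = ⊥-elim (degree≉0 {[]} (unit⇒degree-0 {[]} 0∣1) P.refl)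
  ...   | inj₂ 0∣1 = ⊥-elim (degree≉0 {[]} (unit⇒degree-0 {[]} 0∣1) P.refl)

  irreducible-associate : ∀ {p q} → p P.∣ q → q P.∣ p → P.Irreducible p → P.Irreducible q
  irreducible-associate {p} {q} p∣q (v , vq≈p) irr = mkIrred (λ q∣1 → p∤1 (∣-trans p∣q q∣1)) split
    where
    open P.Irreducible irr
    open import Algebra.Definitions.RawSemiring (Semiring.rawSemiring P.semiring) using (mkIrred)
    split : ∀ {x y} → q ≈ₚ x *ₚ y → x P.∣ 1ₚ ⊎ y P.∣ 1ₚ
    split {x} {y} q≈xy with split-∣1 {v *ₚ x} {y}
      (P.trans (P.sym vq≈p) (P.trans (P.*-congˡ {x = v} q≈xy) (P.sym (*ₚ-assoc v x y))))
    ... | inj₁ vx∣1 = inj₁ (∣-trans (∣-*ˡ v ∣-refl) vx∣1)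
    ... | inj₂ y∣1  = inj₂ y∣1

  -- Choosing between irreducible and reducible would require a search for factors. Under double
  -- negation it suffices to refute the absence of a factor: then h itself is irreducible, since a
  -- splitting into two parts of positive degree gives, by induction, a factor of the first part.
  -- Each use has a contradiction as its goal.
  ¬¬-irreducible-factor : ∀ b {h n} → n ≤ b → HasDegree h n → 0 < n → ¬ ¬ (∃ λ p → P.Irreducible p × p P.∣ h)
  ¬¬-irreducible-factor zero    z≤n d ()
  ¬¬-irreducible-factor (suc b) {h} {n} n≤b d 0<n none = none (h , mkIrred (degree>0⇒∤1 {h} d 0<n) split , ∣-refl)
    where
    open import Algebra.Definitions.RawSemiring (Semiring.rawSemiring P.semiring) using (mkIrred)
    split : ∀ {x y} → h ≈ₚ x *ₚ y → x P.∣ 1ₚ ⊎ y P.∣ 1ₚ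
    split {x} {y} h≈xy with divisor-degree {x} {h} d (∣-respʳ (P.sym h≈xy) (PT.x∣x*y x y))
                          | divisor-degree {y} {h} d (∣-respʳ (P.sym h≈xy) (∣-*ˡ x ∣-refl))
    ... | zero  , dx , _ | _               = inj₁ (degree-0⇒unit {x} dx)
    ... | suc _ , dx , _ | zero , dy , _   = inj₂ (degree-0⇒unit {y} dy)
    ... | suc l , dx , _ | suc m , dy , _  = ⊥-elim (¬¬-irreducible-factor b {x}
      (ℕ.≤-pred (ℕ.≤-trans (≡.subst (suc (suc l) ≤_)
        (degree-unique {h} (degree-resp {x *ₚ y} {h} (P.sym h≈xy) (degree-* {x} {y} dx dy)) d)
        (s≤s (ℕ.≤-trans (ℕ.m≤n+m (suc l) m) (ℕ.≤-reflexive (≡.trans (ℕ.+-comm m (suc l)) (≡.sym (ℕ.+-suc l m))))))) n≤b))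
      dx (s≤s z≤n)
      λ (p , irr , p∣x) → none (p , irr , ∣-trans p∣x (∣-respʳ (P.sym h≈xy) (PT.x∣x*y x y))))

  record ReducedPair (a b : Poly) : Set (c ⊔ e) where
    field
      s a′ b′ : Poly
      s≉0     : ¬ (s ≈ₚ [])
      a′s≈a   : a′ *ₚ s ≈ₚ a
      b′s≈b   : b′ *ₚ s ≈ₚ b
      comaximal : Comaximal a′ b′

  reduce-pair : ∀ a b → ¬ (b ≈ₚ []) → ReducedPair a b
  reduce-pair a b b≉0 with euclidean a b
  ... | record { gcd = s ; gcd∣a = a′ , eqa ; gcd∣b = b′ , eqb ; u = u ; v = v ; bezout = eq } = record
    { s = s ; a′ = a′ ; b′ = b′ ; s≉0 = s≉0 ; a′s≈a = eqa ; b′s≈b = eqb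
    ; comaximal = u , v , domain-cancelʳ polynomialRing domain {z = s} s≉0 (PT.bezout-cofactors {a} {b} {a′} {b′} {s} {u} {v} eq eqa eqb)
    }
    where
    s≉0 : ¬ (s ≈ₚ [])
    s≉0 s≈0 = b≉0 (P.trans (P.sym eqb) (P.trans (P.*-congˡ {x = b′} s≈0) (P.zeroʳ b′)))

  -- Once the gcd of u and v is cancelled, v′^ℓ X = u′^ℓ Y with u′ and v′ coprime. Now X is coprime
  -- to Y and so divides u′^ℓ, while u′^ℓ is coprime to v′^ℓ and so divides X. Hence deg X = ℓ deg
  -- u′.
  power-ratio-degree : ∀ ℓ {u v X Y n} → 0 < ℓ → ¬ (v ≈ₚ []) → Comaximal X Y → v P.^ ℓ *ₚ X ≈ₚ u P.^ ℓ *ₚ Y →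
                       HasDegree X n → ℓ ℕ.∣ n
  power-ratio-degree ℓ@(suc ℓ-1) {u} {v} {X} {Y} {n} 0<ℓ v≉0 XY eq h = fromReducedPair (reduce-pair u v v≉0)
    where
    module _ (pair : ReducedPair u v) where
      open ReducedPair pair
      reduced : b′ P.^ ℓ *ₚ X ≈ₚ a′ P.^ ℓ *ₚ Y
      reduced = domain-cancelʳ polynomialRing domain {z = s P.^ ℓ} (domain-^≉0 polynomialRing domain ℓ s≉0)
        (P.trans (PT.[x*y]^n*z {b′} {s} {v} ℓ X b′s≈b) (P.trans eq (P.sym (PT.[x*y]^n*z {a′} {s} {u} ℓ Y a′s≈a))))
      X∣a′^ℓ : X P.∣ a′ P.^ ℓ
      X∣a′^ℓ = euclid {X} {Y} {a′ P.^ ℓ} XY (∣-respʳ {X} (P.trans reduced (*ₚ-comm (a′ P.^ ℓ) Y)) (∣-*ˡ {X} {X} (b′ P.^ ℓ) ∣-refl))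
      a′^ℓ∣X : a′ P.^ ℓ P.∣ X
      a′^ℓ∣X = euclid {a′ P.^ ℓ} {b′ P.^ ℓ} {X}
          (comaximal-^ {a′} {b′ P.^ ℓ} ℓ (comaximal-sym {b′ P.^ ℓ} {a′} (comaximal-^ {b′} {a′} ℓ (comaximal-sym {a′} {b′} comaximal))))
        (∣-respʳ {a′ P.^ ℓ} (P.sym reduced) (PT.x∣x*y (a′ P.^ ℓ) Y))
      a′≉0 : ¬ (a′ ≈ₚ [])
      a′≉0 a′≈0 = degree≉0 {a′ P.^ ℓ} (proj₁ (proj₂ (divisor-degree {a′ P.^ ℓ} {X} h a′^ℓ∣X)))
        (0*≈0 {a′} (a′ P.^ ℓ-1) a′≈0)

      fromReducedPair : ℓ ℕ.∣ n
      fromReducedPair = ℕ.divides (proj₁ d) (≡.trans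
        (mutual-∣⇒degree≡ {X} {a′ P.^ ℓ} X∣a′^ℓ a′^ℓ∣X h (degree-^ {a′} ℓ (proj₂ d))) (ℕ.*-comm ℓ (proj₁ d)))
        where
        d : ∃ (HasDegree a′)
        d = ≉0⇒degree {a′} a′≉0

-- Finite rings and finite fields

funToFin-cong : ∀ {m n} {f g : Fin m → Fin n} → (∀ i → f i ≡ g i) → Fin.funToFin f ≡ Fin.funToFin g
funToFin-cong {zero}  f≗g = ≡.refl
funToFin-cong {suc m} f≗g = ≡.cong₂ Fin.combine (f≗g zero) (funToFin-cong (f≗g ∘ suc))

module _ {a b a′ b′} {S : Setoid a b} {T : Setoid a′ b′} {q n : ℕ} (|S|≡q : Inverse S (≡.setoid (Fin q))) where
  private
    module S = Setoid S
    module T = Setoid T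
    open Inverse |S|≡q

  -- Only a bijection of setoids between T and the n-th power of S is asked for, so one argument
  -- counts both forms of a polynomial residue ring and the ring of integers modulo g.
  power-cardinality : (coordinate : T.Carrier → Fin n → S.Carrier)
                      (vector : (Fin n → S.Carrier) → T.Carrier) →
                      (∀ {x y} → x T.≈ y → ∀ i → coordinate x i S.≈ coordinate y i) →
                      (∀ {x y} → (∀ i → coordinate x i S.≈ coordinate y i) → x T.≈ y) →
                      (∀ v i → coordinate (vector v) i S.≈ v i) →
                      Inverse T (≡.setoid (Fin (q ℕ.^ n)))
  power-cardinality coordinate vector cong injective section = record
    { to = encode
    ; from = decode
    ; to-cong = λ x≈y → funToFin-cong λ i → to-cong (cong x≈y i)
    ; from-cong = λ { ≡.refl → T.refl }
    ; inverse =
        (λ {k} {y} y≈ → ≡.trans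
          (funToFin-cong λ i → inverseˡ (S.trans (cong y≈ i) (section (from ∘ Fin.finToFun k) i)))
          (Fin.funToFin-finToFin {n} {q} k))
      , (λ { {y} ≡.refl → injective λ i → S.trans (section (from ∘ Fin.finToFun (encode y)) i)
          (inverseʳ (Fin.finToFun-funToFin (λ j → to (coordinate y j)) i)) })
    }
    where
    encode : T.Carrier → Fin (q ℕ.^ n)
    encode x = Fin.funToFin λ i → to (coordinate x i)
    decode : Fin (q ℕ.^ n) → T.Carrier
    decode k = vector (from ∘ Fin.finToFun k)

module FiniteRing {c e} (R : CommutativeRing c e) {n} (|R|≡n : HasCardinality R n) where
  open CommRing R
  open Inverse |R|≡n
  open RingTheory R

  from∘to : ∀ x → from (to x) ≈ x
  from∘to x = inverseʳ ≡.refl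

  to∘from : ∀ i → to (from i) ≡ i
  to∘from i = inverseˡ refl

  to-injective : ∀ {x y} → to x ≡ to y → x ≈ y
  to-injective eq = trans (sym (from∘to _)) (trans (from-cong eq) (from∘to _))

  infix 4 _≟_
  _≟_ : Decidable _≈_
  x ≟ y = map′ to-injective to-cong (to x Fin.≟ to y)

  private
    induced : (f g : Carrier → Carrier) → (∀ {x y} → x ≈ y → f x ≈ f y) → (∀ {x y} → x ≈ y → g x ≈ g y) →
              (∀ x → f (g x) ≈ x) → (∀ x → g (f x) ≈ x) → Permutation n n
    induced f g f-cong g-cong fg gf = permutation (to ∘ f ∘ from) (to ∘ g ∘ from)
      (λ i → ≡.trans (to-cong (trans (f-cong (from∘to _)) (fg _))) (to∘from i))
      (λ i → ≡.trans (to-cong (trans (g-cong (from∘to _)) (gf _))) (to∘from i))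

  -- Translation by 1 permutes R, so it does not change the sum over R.
  n×1≈0 : n times 1# ≈ 0#
  n×1≈0 = +-cancelˡ (sum from) _ _ (trans
    (+-congˡ (sym (sum-replicate n)))
    (trans (sym (∑-distrib-+ from (λ _ → 1#)))
    (trans (sum-cong-≋ {n} (λ i → sym (from∘to (from i + 1#))))
    (trans (sym (sum-permute from shift)) (sym (+-identityʳ _))))))
    where
    open import Algebra.Properties.Ring ring using (+-cancelˡ)
    open import Algebra.Properties.CommutativeMonoid.Sum +-commutativeMonoid using (sum-permute)
    shift : Permutation n n
    shift = induced (_+ 1#) (_- 1#) +-congʳ +-congʳ
      (λ x → trans (+-assoc x _ _) (trans (+-congˡ (-‿inverseˡ 1#)) (+-identityʳ x)))
      (λ x → [x+y]-y≈x x 1#)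

module FiniteField {c e} (R : CommutativeRing c e) {n-1} (|R|≡n : HasCardinality R (suc n-1)) (isField : IsField R) where
  open CommRing R
  open Inverse |R|≡n
  open RingTheory R
  open FiniteRing R |R|≡n public
  open import Algebra.Properties.CommutativeMonoid.Sum *-commutativeMonoid
    using (sum-permute) renaming (sum-cong-≋ to product-cong; sum-replicate to product-replicate; ∑-distrib-+ to product-distrib-*)

  private
    k : Field c e
    k = record { commutativeRing = R ; isField = isField }

  domain : IsDomain R
  domain = field-isDomain k _≟_

  unit : Fin n-1 → Carrier
  unit i = from (punchIn (to 0#) i)

  unit≉0 : ∀ i → ¬ (unit i ≈ 0#)
  unit≉0 i eq = Fin.punchInᵢ≢i (to 0#) i (≡.trans (≡.sym (to∘from _)) (to-cong eq))

  unit-injective : ∀ {i j} → unit i ≈ unit j → i ≡ j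
  unit-injective {i} {j} eq = Fin.punchIn-injective (to 0#) i j
    (≡.trans (≡.sym (to∘from _)) (≡.trans (to-cong eq) (to∘from _)))

  product-unit≉0 : ∀ {m} (f : Fin m → Carrier) → (∀ i → ¬ (f i ≈ 0#)) → ¬ (product f ≈ 0#)
  product-unit≉0 {zero}  f f≉0 1≈0 = proj₁ domain (sym 1≈0)
  product-unit≉0 {suc m} f f≉0 = FractionField.nonzero-* R domain (f≉0 zero) (product-unit≉0 (f ∘ suc) (f≉0 ∘ suc))

  -- Multiplication by a permutes the nonzero elements.
  unit-fermat : ∀ a → ¬ (a ≈ 0#) → a ^ n-1 ≈ 1#
  unit-fermat a a≉0 = domain-cancelʳ R domain (product-unit≉0 unit unit≉0) (begin
    a ^ n-1 * product unit  ≈⟨ *-congʳ (product-replicate n-1) ⟨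
    product {n-1} (λ _ → a) * product unit ≈⟨ product-distrib-* (λ _ → a) unit ⟨
    product (λ i → a * unit i)  ≈⟨ product-cong {n-1} (λ i → trans (sym (from∘to _))
                                              (from-cong (≡.trans (punchIn-permute π (to 0#) i)
                                                (≡.cong (λ j → punchIn j (remove (to 0#) π ⟨$⟩ʳ i)) π0≡0)))) ⟩
    product (λ i → unit (remove (to 0#) π ⟨$⟩ʳ i)) ≈⟨ sum-permute unit (remove (to 0#) π) ⟨
    product unit  ≈⟨ *-identityˡ _ ⟨
    1# * product unit  ∎)
    where
    open SetoidReasoning setoid
    a⁻¹ : Carrier
    a⁻¹ = proj₁ (proj₂ isField a a≉0)
    aa⁻¹≈1 : a * a⁻¹ ≈ 1#
    aa⁻¹≈1 = proj₂ (proj₂ isField a a≉0)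
    π : Permutation (suc n-1) (suc n-1)
    π = permutation (λ i → to (a * from i)) (λ i → to (a⁻¹ * from i))
      (λ i → ≡.trans (to-cong (trans (*-congˡ (from∘to _)) (trans (sym (*-assoc a a⁻¹ _))
        (trans (*-congʳ aa⁻¹≈1) (*-identityˡ _))))) (to∘from i))
      (λ i → ≡.trans (to-cong (trans (*-congˡ (from∘to _)) (trans (sym (*-assoc a⁻¹ a _))
        (trans (*-congʳ (trans (*-comm a⁻¹ a) aa⁻¹≈1)) (*-identityˡ _))))) (to∘from i))
    π0≡0 : π ⟨$⟩ʳ to 0# ≡ to 0#
    π0≡0 = to-cong (trans (*-congˡ (from∘to 0#)) (zeroʳ a))

  fermat : ∀ a → a ^ suc n-1 ≈ a
  fermat a with a ≟ 0#
  ... | yes a≈0 = trans (*-congʳ a≈0) (trans (zeroˡ _) (sym a≈0))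
  ... | no  a≉0 = trans (*-congˡ (unit-fermat a a≉0)) (*-identityʳ a)

  fermat-^ : ∀ j a → a ^ (suc n-1 ℕ.^ j) ≈ a
  fermat-^ zero    a = *-identityʳ a
  fermat-^ (suc j) a = trans (sym (^-assocʳ a (suc n-1) (suc n-1 ℕ.^ j)))
    (trans (fermat-^ j (a ^ suc n-1)) (fermat a))

-- Residue rings of polynomials

quotientRing-^ : ∀ {c e p} (R : CommutativeRing c e) (I : Ideal R p) x n →
                 CommRing._^_ (quotientRing R I) x n ≡ CommRing._^_ R x n
quotientRing-^ R I x zero    = ≡.refl
quotientRing-^ R I x (suc n) = ≡.cong (CommutativeRing._*_ R x) (quotientRing-^ R I x n)

quotientRing-sum : ∀ {c e p} (R : CommutativeRing c e) (I : Ideal R p) {n} {v w : Fin n → CommutativeRing.Carrier R} →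
                   (∀ i → v i ≡ w i) → CommRing.sum (quotientRing R I) v ≡ CommRing.sum R w
quotientRing-sum R I {zero}  eq = ≡.refl
quotientRing-sum R I {suc n} eq = ≡.cong₂ (CommutativeRing._+_ R) (eq zero) (quotientRing-sum R I (eq ∘ suc))

-- Equality is stated through remainders, not divisibility by f, so that it lives
-- in the universe of the equality of k.
module ResidueRing {c e} (k : Field c e) (_≟_ : Decidable (Field._≈_ k)) {f : List (Field.Carrier k)} {n : ℕ}
                   (h : Polynomials.HasDegree (Field.commutativeRing k) f n) where
  open Field k hiding (zero)
  open PolynomialsOverField k _≟_ hiding (domain)
  open Remainder {f} {n} h public
  open import Algebra.Definitions.RawMagma P.*-rawMagma using (_,_)

  ideal : Ideal polynomialRing e
  ideal = record
    { Member   = λ p → remainder p ≈ₚ []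
    ; ∈-resp-≈ = λ {p} {q} p≈q m → ∣⇒remainder≈0 {q} (PT.∣-respʳ {f} p≈q (remainder≈0⇒∣ {p} m))
    ; 0∈       = ∣⇒remainder≈0 {[]} (PT.∣0 f)
    ; +-closed = λ {p} {q} m m′ → ∣⇒remainder≈0 {p +ₚ q} (PT.∣-+ {f} {p} {q} (remainder≈0⇒∣ {p} m) (remainder≈0⇒∣ {q} m′))
    ; *-closed = λ p {q} m → ∣⇒remainder≈0 {p *ₚ q} (PT.∣-*ˡ {f} {q} p (remainder≈0⇒∣ {q} m))
    }

  residueRing : CommutativeRing c e
  residueRing = quotientRing polynomialRing ideal

  open CommutativeRing residueRing public using () renaming (_≈_ to _≈ᵣ_)

  ≈ᵣ⇒∣ : ∀ {p q} → p ≈ᵣ q → f P.∣ (p P.- q)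
  ≈ᵣ⇒∣ {p} {q} = remainder≈0⇒∣ {p P.- q}

  ∣⇒≈ᵣ : ∀ {p q} → f P.∣ (p P.- q) → p ≈ᵣ q
  ∣⇒≈ᵣ {p} {q} = ∣⇒remainder≈0 {p P.- q}

  ≈ₚ⇒≈ᵣ : ∀ {p q} → p ≈ₚ q → p ≈ᵣ q
  ≈ₚ⇒≈ᵣ {p} {q} p≈q = ∣⇒≈ᵣ {p} {q} (PT.∣-respʳ {f} (P.sym (PT.x≈y⇒x-y≈0 p≈q)) (PT.∣0 f))

  coordinate : Poly → Fin n → Carrier
  coordinate p i = coeff (remainder p) (toℕ i)

  fromCoordinates : ∀ {m} → (Fin m → Carrier) → Poly
  fromCoordinates = tabulate

  coeff-fromCoordinates : ∀ {m} (v : Fin m → Carrier) i → coeff (fromCoordinates v) (toℕ i) ≈ v i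
  coeff-fromCoordinates v zero    = refl
  coeff-fromCoordinates v (suc i) = coeff-fromCoordinates (v ∘ suc) i

  below-fromCoordinates : ∀ {m} (v : Fin m → Carrier) → Below (fromCoordinates v) m
  below-fromCoordinates {zero}  v _ _ = refl
  below-fromCoordinates {suc m} v = below-∷ (below-fromCoordinates (v ∘ suc))

  coordinate-cong : ∀ {p q} → p ≈ᵣ q → ∀ i → coordinate p i ≈ coordinate q i
  coordinate-cong {p} {q} eq i = coeff-≈ (remainder-cong {p} {q} (≈ᵣ⇒∣ {p} {q} eq)) (toℕ i)

  ≈-below : ∀ {p q} → Below p n → Below q n → (∀ (i : Fin n) → coeff p (toℕ i) ≈ coeff q (toℕ i)) → p ≈ₚ q
  ≈-below {p} {q} b b′ eq = coeffs λ m → by-cases m (m ℕ.<? n)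
    where
    by-cases : ∀ m → Dec (m < n) → coeff p m ≈ coeff q m
    by-cases m (yes m<n) = ≡.subst (λ j → coeff p j ≈ coeff q j) (Fin.toℕ-fromℕ< m<n) (eq (fromℕ< m<n))
    by-cases m (no  m≮n) = trans (b m (ℕ.≮⇒≥ m≮n)) (sym (b′ m (ℕ.≮⇒≥ m≮n)))

  coordinate-injective : ∀ {p q} → (∀ i → coordinate p i ≈ coordinate q i) → p ≈ᵣ q
  coordinate-injective {p} {q} eq = ∣⇒≈ᵣ {p} {q} (remainder-injective {p} {q}
    (≈-below {remainder p} {remainder q} (remainder-below p) (remainder-below q) eq))

  remainder-small : ∀ {p} → Below p n → remainder p ≈ₚ p
  remainder-small {p} b = remainder-unique p p b (PT.∣-respʳ {f} (P.sym (P.-‿inverseʳ p)) (PT.∣0 f))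

  coordinate-fromCoordinates : ∀ v i → coordinate (fromCoordinates v) i ≈ v i
  coordinate-fromCoordinates v i = trans
    (coeff-≈ (remainder-small {fromCoordinates v} (below-fromCoordinates v)) (toℕ i)) (coeff-fromCoordinates v i)

  residueRing-cardinality : ∀ {q} → HasCardinality commutativeRing q → HasCardinality residueRing (q ℕ.^ n)
  residueRing-cardinality |k|≡q = power-cardinality {S = setoid} {T = CommutativeRing.setoid residueRing} |k|≡q
    coordinate fromCoordinates
    (λ {p} {q} → coordinate-cong {p} {q}) (λ {p} {q} → coordinate-injective {p} {q}) coordinate-fromCoordinates

  -- The same count when equality is divisibility by f, the form of quotient that is compared with
  -- the ring of integers modulo g.
  principal-cardinality : ∀ {q} → HasCardinality commutativeRing q →
                          HasCardinality (quotientRing polynomialRing (principalIdeal polynomialRing f)) (q ℕ.^ n)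
  principal-cardinality |k|≡q = power-cardinality
    {S = setoid} {T = CommutativeRing.setoid (quotientRing polynomialRing (principalIdeal polynomialRing f))} |k|≡q
    coordinate fromCoordinates
    (λ {p} {q} f∣p-q → coordinate-cong {p} {q} (∣⇒≈ᵣ {p} {q} f∣p-q))
    (λ {p} {q} eq → ≈ᵣ⇒∣ {p} {q} (coordinate-injective {p} {q} eq)) coordinate-fromCoordinates

  irreducible⇒isField : P.Irreducible f → IsField residueRing
  irreducible⇒isField irr =
    (λ 0≈1 → P.Irreducible.p∤1 irr (PT.∣-respʳ {f} (PT.-[0-x]≈x 1ₚ) (PT.∣-neg {f} (≈ᵣ⇒∣ {[]} {1ₚ} 0≈1)))) ,
    λ p p≉0 → inverse p p≉0 (irreducible-∣⊎comaximal irr p)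
    where
    inverse : ∀ p → ¬ (p ≈ᵣ []) → f P.∣ p ⊎ PT.Comaximal f p → ∃ λ q → (p *ₚ q) ≈ᵣ 1ₚ
    inverse p p≉0 (inj₁ f∣p) = ⊥-elim (p≉0 (∣⇒≈ᵣ {p} {[]} (PT.∣-respʳ {f} (P.sym (+ₚ-identityʳ p)) f∣p)))
    inverse p p≉0 (inj₂ (u , v , eq)) = v , ∣⇒≈ᵣ {p *ₚ v} {1ₚ} (PT.∣-respʳ {f}
      (PT.comaximal⇒inverse {f} {p} {u} {v} eq) (PT.∣-neg {f} (PT.∣-*ˡ {f} {f} u PT.∣-refl)))

-- A primitive root of unity in a finite field

module _ {c e} (R : CommutativeRing c e) (domain : IsDomain R) where
  open CommRing R
  open RingTheory R
  open SetoidReasoning setoid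

  power-1-coprime : ∀ {ζ i ℓ} → ζ ^ i ≈ 1# → ζ ^ ℓ ≈ 1# → Bézout.Identity 1 i ℓ → ζ ≈ 1#
  power-1-coprime {ζ} {i} {ℓ} eqi eqℓ (Bézout.+- x y eq) = begin
    ζ  ≈⟨ trans (*-congˡ (^-mult y eqℓ)) (*-identityʳ ζ) ⟨
    ζ ^ suc (y ℕ.* ℓ)  ≡⟨ ≡.cong (ζ ^_) eq ⟩
    ζ ^ (x ℕ.* i)  ≈⟨ ^-mult x eqi ⟩
    1#  ∎
  power-1-coprime {ζ} {i} {ℓ} eqi eqℓ (Bézout.-+ x y eq) = begin
    ζ  ≈⟨ trans (*-congˡ (^-mult x eqi)) (*-identityʳ ζ) ⟨
    ζ ^ suc (x ℕ.* i)  ≡⟨ ≡.cong (ζ ^_) eq ⟩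
    ζ ^ (y ℕ.* ℓ)  ≈⟨ ^-mult y eqℓ ⟩
    1#  ∎

  ζ^i≈1⇒ζ≈1 : ∀ {ℓ ζ} → Prime ℓ → ζ ^ ℓ ≈ 1# → ∀ i → 0 < i → i < ℓ → ζ ^ i ≈ 1# → ζ ≈ 1#
  ζ^i≈1⇒ζ≈1 {ℓ} {ζ} ℓ-prime ζ^ℓ≈1 i@(suc _) _ i<ℓ ζ^i≈1 = power-1-coprime {ζ} {i} {ℓ} ζ^i≈1 ζ^ℓ≈1
    (Bézout.Identity.sym (coprime-Bézout (prime⇒coprime ℓ-prime i<ℓ)))

  geometric≈0 : ∀ {w n} → w ^ n ≈ 1# → ¬ (w ≈ 1#) → geometric w n ≈ 0#
  geometric≈0 {w} {n} w^n≈1 w≉1 = conclude (proj₂ domain (w - 1#) (geometric w n) ([x-1]*y≈0 (geometric-fixed {w} {n} w^n≈1)))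
    where
    conclude : w - 1# ≈ 0# ⊎ geometric w n ≈ 0# → geometric w n ≈ 0#
    conclude (inj₁ w-1≈0) = ⊥-elim (w≉1 (x-y≈0⇒x≈y w-1≈0))
    conclude (inj₂ g≈0)   = g≈0

module _ {c e} (F : Field c e) {n-1} (|F|≡n : HasCardinality (Field.commutativeRing F) (suc n-1)) where
  private
    R = Field.commutativeRing F
  open CommRing R
  open RingTheory R
  open FiniteField R |F|≡n (Field.isField F)
  open PolynomialsOverField F _≟_ hiding (domain)
  private
    X : Poly
    X = 0# ∷ 1# ∷ []

    linear : Carrier → Poly
    linear a = X P.- constant a

    linear-degree : ∀ a → HasDegree (linear a) 1
    linear-degree a = (λ eq → proj₁ domain (sym eq)) , λ { (suc zero) (s≤s ()) ; (suc (suc m)) _ → refl }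

    X-degree : HasDegree X 1
    X-degree = (λ eq → proj₁ domain (sym eq)) , λ { (suc zero) (s≤s ()) ; (suc (suc m)) _ → refl }

    linear-comaximal : ∀ {a b} → ¬ (a ≈ b) → PT.Comaximal (linear a) (linear b)
    linear-comaximal {a} {b} a≉b = PT.difference-unit⇒comaximal X (constant a) (constant b) (constant t) (begin
      constant t *ₚ (constant a P.- constant b)  ≈⟨ *-homo t (a - b) ⟨
      constant (t * (a - b))  ≈⟨ ⟦⟧-cong (trans (*-comm t (a - b)) (proj₂ inv)) ⟩
      1ₚ  ∎)
      where
      open SetoidReasoning polySetoid
      open RingMorphisms.IsRingHomomorphism constant-isHom
      inv = proj₂ (Field.isField F) (a - b) (a≉b ∘ x-y≈0⇒x≈y)
      t = proj₁ inv

    linear∣ : ∀ m a → a ^ m ≈ 1# → linear a P.∣ (X P.^ m P.- 1ₚ)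
    linear∣ m a a^m≈1 = PT.∣-respʳ {linear a}
      (P.+-congˡ {x = X P.^ m} (P.-‿cong (P.trans {constant a P.^ m} {constant (a ^ m)} {1ₚ}
        (P.sym (hom-^ R polynomialRing constant-isHom a m)) (⟦⟧-cong a^m≈1))))
      (PT.x-y∣x^n-y^n X (constant a) m)
      where open RingMorphisms.IsRingHomomorphism constant-isHom

    X^m-1-degree : ∀ m → HasDegree (X P.^ suc m P.- 1ₚ) (suc m)
    X^m-1-degree m = degree-+-below {X P.^ suc m} {P.- 1ₚ}
      (≡.subst (HasDegree (X P.^ suc m)) (ℕ.*-identityʳ (suc m)) (degree-^ {X} (suc m) X-degree))
      (below-mono {P.- 1ₚ} {1} {suc m} (s≤s z≤n) (below-neg 1ₚ (proj₂ degree-1)))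

  -- If every nonzero a had a^(m+1) = 1, the pairwise comaximal polynomials X - a would all divide
  -- X^(m+1) - 1. So would their product, whose degree `n-1` is too large.
  nontrivial-power : ∀ m → suc m < n-1 → ∃ λ a → ¬ (a ≈ 0#) × ¬ (a ^ suc m ≈ 1#)
  nontrivial-power m m<n-1 with Fin.any? (λ i → ¬? (unit i ^ suc m ≟ 1#))
  ... | yes (i , u^m≉1) = unit i , unit≉0 i , u^m≉1
  ... | no  all-powers-trivial = ⊥-elim (ℕ.<⇒≱ m<n-1 (too-many-roots (divisor-degree {PT.product (linear ∘ unit)} (X^m-1-degree m)
      (PT.product-∣ {x = X P.^ suc m P.- 1ₚ} (linear ∘ unit)
        (λ i j i≢j → linear-comaximal (i≢j ∘ unit-injective))
        (λ i → linear∣ (suc m) (unit i) (decidable-stable (unit i ^ suc m ≟ 1#) λ u^m≉1 → all-powers-trivial (i , u^m≉1)))))))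
    where
    too-many-roots : (∃ λ d → HasDegree (PT.product (linear ∘ unit)) d × d ≤ suc m) → n-1 ≤ suc m
    too-many-roots (d , h , d≤) = ≡.subst (_≤ suc m) (≡.trans
      (degree-unique {PT.product (linear ∘ unit)} h (degree-product (linear ∘ unit) (linear-degree ∘ unit)))
      (ℕ.*-identityʳ n-1)) d≤

  -- Here q = `suc n-1` satisfies q · 1 = 0 in F. If ℓ vanished in F, so would its multiple q - 1,
  -- and q · 1 would also equal 1. This gives the invertibility of ℓ without any mention of the
  -- characteristic.
  times≈0 : ∀ {ℓ m} → n-1 ≡ m ℕ.* ℓ → ℓ times 1# ≈ 0# → 0# ≈ 1#
  times≈0 {ℓ} {m} n-1≡mℓ ℓ≈0 = begin
    0#  ≈⟨ n×1≈0 ⟨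
    1# + n-1 times 1#  ≡⟨ ≡.cong (λ j → 1# + j times 1#) n-1≡mℓ ⟩
    1# + (m ℕ.* ℓ) times 1#  ≈⟨ +-congˡ (trans (×1-homo-* m ℓ) (trans (*-congˡ ℓ≈0) (zeroʳ _))) ⟩
    1# + 0#  ≈⟨ +-identityʳ 1# ⟩
    1#  ∎
    where
    open SetoidReasoning setoid
    open import Algebra.Properties.Semiring.Mult semiring using (×1-homo-*)

  -- With q - 1 = (m+1) ℓ, the root is ζ = a^(m+1) for some a whose power is not 1; then ζ^ℓ =
  -- a^(q-1) = 1. As ℓ is prime, ζ^i ≠ 1 for 0 < i < ℓ, and cancelling ζ^i - 1 makes the geometric
  -- sums vanish.
  rootOfUnity : ∀ {ℓ} → Prime ℓ → 0 < n-1 → ℓ ℕ.∣ n-1 → RootOfUnity R ℓ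
  rootOfUnity ℓ-prime 0<n-1 (ℕ.divides zero n-1≡0) = ⊥-elim (ℕ.<⇒≢ 0<n-1 (≡.sym n-1≡0))
  rootOfUnity {ℓ} ℓ-prime 0<n-1 (ℕ.divides (suc m) n-1≡) = record
    { ζ = ζ
    ; ζ^ℓ≈1 = ζ^ℓ≈1
    ; geometric-ζ^≈0 = λ i 0<i i<ℓ → geometric≈0 R domain {ζ ^ i} {ℓ}
        (trans (^-comm ζ i ℓ) (trans (^-congˡ i ζ^ℓ≈1) (1^ i)))
        (ζ≉1 ∘ ζ^i≈1⇒ζ≈1 R domain ℓ-prime ζ^ℓ≈1 i 0<i i<ℓ)
    ; ℓ⁻¹ = proj₁ inv
    ; ℓ⁻¹*ℓ≈1 = trans (*-comm _ _) (proj₂ inv)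
    }
    where
    1<ℓ : 1 < ℓ
    1<ℓ = ℕ.nonTrivial⇒n>1 ℓ {{ℕ.prime⇒nonTrivial ℓ-prime}}
    witness : ∃ λ a → ¬ (a ≈ 0#) × ¬ (a ^ suc m ≈ 1#)
    witness = nontrivial-power m (≡.subst (suc m <_) (≡.sym n-1≡) (ℕ.m<m*n (suc m) ℓ 1<ℓ))
    ζ : Carrier
    ζ = proj₁ witness ^ suc m
    ζ≉1 : ¬ (ζ ≈ 1#)
    ζ≉1 = proj₂ (proj₂ witness)
    ζ^ℓ≈1 : ζ ^ ℓ ≈ 1#
    ζ^ℓ≈1 = trans (^-assocʳ (proj₁ witness) (suc m) ℓ)
      (trans (^-congʳ (proj₁ witness) (≡.sym n-1≡)) (unit-fermat (proj₁ witness) (proj₁ (proj₂ witness))))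
    inv : ∃ λ a → (ℓ times 1#) * a ≈ 1#
    inv = proj₂ (Field.isField F) (ℓ times 1#) (proj₁ domain ∘ times≈0 {ℓ} {suc m} n-1≡)

-- Fermat congruences modulo a square-free polynomial

module _ {c e} (F : Field c e) {q} (|F|≡q : HasCardinality (Field.commutativeRing F) q)
         (_≟_ : Decidable (Field._≈_ F)) where
  open PolynomialsOverField F _≟_ hiding (domain)
  private module F = Field F

  -- The hypothesis on the degrees of factors speaks of monic polynomials, whereas an irreducible
  -- factor comes only up to a unit.
  monic-associate : ∀ {p n} → HasDegree p n → ∃ λ r → IsMonicOfDegree r n × r P.∣ p × p P.∣ r
  monic-associate {p} {n} (lc≉0 , b) = scale t p ,
    (F.trans (coeff-scale t p n) (F.trans (F.*-comm t _) (proj₂ inv)) , below-scale t p b) ,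
    (constant (coeff p n) , (begin
      constant (coeff p n) *ₚ scale t p  ≈⟨ constant-* (coeff p n) (scale t p) ⟩
      scale (coeff p n) (scale t p)  ≈⟨ scale-scale (coeff p n) t p ⟩
      scale (coeff p n F.* t) p  ≈⟨ scale-cong (proj₂ inv) (P.refl {p}) ⟩
      scale F.1# p  ≈⟨ scale-one p ⟩
      p  ∎)) ,
    (constant t , constant-* t p)
    where
    open SetoidReasoning polySetoid
    open import Algebra.Definitions.RawMagma P.*-rawMagma using (_,_)
    inv = proj₂ F.isField (coeff p n) lc≉0
    t = proj₁ inv

  irreducible-∣-fermat : ∀ {p n} → HasDegree p n → P.Irreducible p → ∀ j x → p P.∣ (x P.^ ((q ℕ.^ n) ℕ.^ j) P.- x)
  irreducible-∣-fermat {p} {n} h irr j x = ≈ᵣ⇒∣ {x P.^ ((q ℕ.^ n) ℕ.^ j)} {x}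
    (fermat-with (q ℕ.^ n) (residueRing-cardinality |F|≡q))
    where
    open ResidueRing F _≟_ {p} {n} h
    -- The number q^n of residues becomes a variable, so that it can be matched with a successor;
    -- the case 0 is impossible because the ring has an element.
    fermat-with : ∀ N → HasCardinality residueRing N → (x P.^ (N ℕ.^ j)) ≈ᵣ x
    fermat-with zero    card = ⊥-elim (Fin.¬Fin0 (Inverse.to card []))
    fermat-with (suc N) card = ≡.subst (_≈ᵣ x) (quotientRing-^ polynomialRing ideal x (suc N ℕ.^ j))
      (FiniteField.fermat-^ residueRing card (irreducible⇒isField irr) j x)

  -- Let h be the cofactor in g of the gcd of g and T = x^(q^M) - x. An irreducible factor p of h
  -- divides g, hence T, hence the gcd, so p² divides g against square-freeness. Thus h is constant
  -- and g divides T.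
  squarefree-∣-fermat : ∀ {g d M} → HasDegree g d → (∀ h → (h *ₚ h) P.∣ g → h P.∣ 1ₚ) →
    (∀ p m → P.Irreducible p → IsMonicOfDegree p m → p P.∣ g → m ℕ.∣ M) →
    ∀ x → g P.∣ (x P.^ (q ℕ.^ M) P.- x)
  squarefree-∣-fermat {g} {d} {M} hg squarefree degrees x = conclude (degree? h)
    where
    T : Poly
    T = x P.^ (q ℕ.^ M) P.- x
    module G = GCD (euclidean g T)
    open import Algebra.Definitions.RawMagma P.*-rawMagma using (_,_; _∣ʳ_)
    h : Poly
    h = _∣ʳ_.quotient G.gcd∣a
    h*gcd≈g : h *ₚ G.gcd ≈ₚ g
    h*gcd≈g = _∣ʳ_.equality G.gcd∣a

    irreducible-∣T : ∀ p → P.Irreducible p → p P.∣ g → p P.∣ T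
    irreducible-∣T p irr p∣g = go (irreducible-degree irr)
      where
      go : (∃ λ n → HasDegree p n × 0 < n) → p P.∣ T
      go (n , hp , _) = go′ (monic-associate {p} hp)
        where
        go′ : (∃ λ r → IsMonicOfDegree r n × r P.∣ p × p P.∣ r) → p P.∣ T
        go′ (r , monic , r∣p , p∣r) = go″ (degrees r n (irreducible-associate {p} {r} p∣r r∣p irr) monic (PT.∣-trans r∣p p∣g))
          where
          go″ : n ℕ.∣ M → p P.∣ T
          go″ (ℕ.divides j M≡jn) = ≡.subst (λ N → p P.∣ (x P.^ N P.- x))
            (≡.trans (ℕ.^-*-assoc q n j) (≡.cong (q ℕ.^_) (≡.trans (ℕ.*-comm n j) (≡.sym M≡jn))))
            (irreducible-∣-fermat {p} hp irr j x)

    no-irreducible-factor : ∀ p → P.Irreducible p → ¬ (p P.∣ h)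
    no-irreducible-factor p irr p∣h = P.Irreducible.p∤1 irr (squarefree p
      (PT.∣-respʳ {p *ₚ p} h*gcd≈g (PT.*-mono-∣ {p} {p} {h} {G.gcd} p∣h p∣gcd)))
      where
      p∣g : p P.∣ g
      p∣g = PT.∣-respʳ {p} h*gcd≈g (PT.∣-*ʳ {p} {h} G.gcd p∣h)
      p∣gcd : p P.∣ G.gcd
      p∣gcd = PT.∣-respʳ {p} G.bezout (PT.∣-+ {p} {G.u *ₚ g} {G.v *ₚ T}
        (PT.∣-*ˡ {p} {g} G.u p∣g) (PT.∣-*ˡ {p} {T} G.v (irreducible-∣T p irr p∣g)))

    conclude : h ≈ₚ [] ⊎ ∃ (HasDegree h) → g P.∣ T
    conclude (inj₁ h≈0) = ⊥-elim (degree≉0 {g} hg (P.trans (P.sym h*gcd≈g) (0*≈0 {h} G.gcd h≈0)))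
    conclude (inj₂ (zero , hh)) = PT.∣-trans {g} {G.gcd} {T} (g∣gcd (degree-0⇒unit {h} hh)) G.gcd∣b
      where
      g∣gcd : h P.∣ 1ₚ → g P.∣ G.gcd
      g∣gcd h∣1 = PT.∣-respˡ {G.gcd} h*gcd≈g (PT.∣-respʳ {h *ₚ G.gcd} (*ₚ-identityˡ G.gcd)
        (PT.*-mono-∣ {h} {G.gcd} {1ₚ} {G.gcd} h∣1 (PT.∣-refl {G.gcd})))
    conclude (inj₂ (suc n , hh)) = ⊥-elim (¬¬-irreducible-factor (suc n) {h} ℕ.≤-refl hh (s≤s z≤n)
      λ (p , irr , p∣h) → no-irreducible-factor p irr p∣h)

-- Powers of ζ in a field and the irreducibility of t^ℓ - D

module RootsOfUnityInField {c e} (k : Field c e) (_≟_ : Decidable (Field._≈_ k)) {ℓ} (ℓ-prime : Prime ℓ)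
                           (ω : RootOfUnity (Field.commutativeRing k) ℓ) where
  open CommRing (Field.commutativeRing k)
  open RingTheory (Field.commutativeRing k)
  open RootOfUnity ω public
  open RootsOfUnity (Field.commutativeRing k) ω public
  open SetoidReasoning setoid

  domainₖ : IsDomain (Field.commutativeRing k)
  domainₖ = field-isDomain k _≟_

  1<ℓ : 1 < ℓ
  1<ℓ = ℕ.nonTrivial⇒n>1 ℓ {{ℕ.prime⇒nonTrivial ℓ-prime}}

  0<ℓ : 0 < ℓ
  0<ℓ = ℕ.<-trans ℕ.0<1+n 1<ℓ

  -- Otherwise the geometric sum of ζ, which is 0, would be ℓ, a unit.
  ζ≉1 : ¬ (ζ ≈ 1#)
  ζ≉1 ζ≈1 = proj₁ domainₖ (begin
    0#  ≈⟨ zeroʳ ℓ⁻¹ ⟨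
    ℓ⁻¹ * 0#  ≈⟨ *-congˡ (geometric-ζ^≈0 1 (s≤s z≤n) 1<ℓ) ⟨
    ℓ⁻¹ * geometric (ζ ^ 1) ℓ ≈⟨ *-congˡ (trans (geometric-cong ℓ (trans (*-identityʳ ζ) ζ≈1)) (geometric-1 ℓ)) ⟩
    ℓ⁻¹ * (ℓ times 1#)  ≈⟨ ℓ⁻¹*ℓ≈1 ⟩
    1#  ∎)

  root^i≈1⇒root≈1 : ∀ {η} → η ^ ℓ ≈ 1# → ∀ i → 0 < i → i < ℓ → η ^ i ≈ 1# → η ≈ 1#
  root^i≈1⇒root≈1 = ζ^i≈1⇒ζ≈1 (Field.commutativeRing k) domainₖ ℓ-prime

  ζ^i≉1 : ∀ i → 0 < i → i < ℓ → ¬ (ζ ^ i ≈ 1#)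
  ζ^i≉1 i 0<i i<ℓ = ζ≉1 ∘ root^i≈1⇒root≈1 ζ^ℓ≈1 i 0<i i<ℓ

  x^ℓ≈1⇒x≉0 : ∀ {x} → x ^ ℓ ≈ 1# → ¬ (x ≈ 0#)
  x^ℓ≈1⇒x≉0 {x} x^ℓ≈1 x≈0 = proj₁ domainₖ (trans (sym (0^ 0<ℓ)) (trans (^-congˡ ℓ (sym x≈0)) x^ℓ≈1))

  ζ^n≉0 : ∀ n → ¬ (ζ ^ n ≈ 0#)
  ζ^n≉0 n = x^ℓ≈1⇒x≉0 (ζ^n^ℓ≈1 n)

  private
    exponents-ordered : ∀ {i j r} → i < j → j < ℓ → 0 < r → r < ℓ → ¬ ((ζ ^ i) ^ r ≈ (ζ ^ j) ^ r)
    exponents-ordered {i} {j} {r} i<j j<ℓ 0<r r<ℓ eq =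
      ζ^i≉1 (j ∸ i) (ℕ.m<n⇒0<n∸m i<j) (ℕ.≤-<-trans (ℕ.m∸n≤m j i) j<ℓ)
        (root^i≈1⇒root≈1 (ζ^n^ℓ≈1 (j ∸ i)) r 0<r r<ℓ
          (domain-cancelʳ (Field.commutativeRing k) domainₖ
            (domain-^≉0 (Field.commutativeRing k) domainₖ r (ζ^n≉0 i)) (begin
              (ζ ^ (j ∸ i)) ^ r * (ζ ^ i) ^ r  ≈⟨ ^-distrib-* (ζ ^ (j ∸ i)) (ζ ^ i) r ⟨
              (ζ ^ (j ∸ i) * ζ ^ i) ^ r  ≈⟨ ^-congˡ r (trans (sym (^-homo-* ζ (j ∸ i) i))
                                                     (^-congʳ ζ (ℕ.m∸n+n≡m (ℕ.<⇒≤ i<j)))) ⟩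
              (ζ ^ j) ^ r  ≈⟨ eq ⟨
              (ζ ^ i) ^ r  ≈⟨ *-identityˡ _ ⟨
              1# * (ζ ^ i) ^ r  ∎)))

  -- For i < j the r-th power of ζ^(j-i) would be 1; as ℓ is prime and 0 < r < ℓ, already ζ^(j-i) =
  -- 1, which is excluded. The exponent r is the degree of a factor of t^ℓ - D, or 1 when
  -- eigenvalues are compared.
  exponents-injective : ∀ {i j r} → i < ℓ → j < ℓ → 0 < r → r < ℓ → (ζ ^ i) ^ r ≈ (ζ ^ j) ^ r → i ≡ j
  exponents-injective {i} {j} i<ℓ j<ℓ 0<r r<ℓ eq with ℕ.<-cmp i j
  ... | tri< i<j _ _ = ⊥-elim (exponents-ordered i<j j<ℓ 0<r r<ℓ eq)
  ... | tri≈ _ i≡j _ = i≡j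
  ... | tri> _ _ j<i = ⊥-elim (exponents-ordered j<i i<ℓ 0<r r<ℓ (sym eq))

-- The substitution t ↦ c t.
module Twist {c e} (k : Field c e) (_≟_ : Decidable (Field._≈_ k)) where
  open CommRing (Field.commutativeRing k)
  open RingTheory (Field.commutativeRing k)
  open PolynomialsOverField k _≟_

  open import Algebra.Definitions.RawMagma P.*-rawMagma using (_,_)

  twist : Carrier → Poly → Poly
  twist c []      = []
  twist c (a ∷ p) = a ∷ scale c (twist c p)

  coeff-twist : ∀ c p n → coeff (twist c p) n ≈ c ^ n * coeff p n
  coeff-twist c []      n       = sym (zeroʳ _)
  coeff-twist c (a ∷ p) zero    = sym (*-identityˡ a)
  coeff-twist c (a ∷ p) (suc n) = trans (coeff-scale c (twist c p) n)
    (trans (*-congˡ (coeff-twist c p n)) (sym (*-assoc c _ _)))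

  twist-cong : ∀ {c d p q} → c ≈ d → p ≈ₚ q → twist c p ≈ₚ twist d q
  twist-cong {c} {d} {p} {q} c≈d p≈q = by-coeff _ _ (coeff-twist c p) (coeff-twist d q)
    λ n → *-cong (^-congˡ n c≈d) (coeff-≈ p≈q n)

  twist-+ : ∀ c p q → twist c (p +ₚ q) ≈ₚ twist c p +ₚ twist c q
  twist-+ c p q = by-coeff _ _
    (λ n → trans (coeff-twist c (p +ₚ q) n) (*-congˡ (coeff-+ p q n)))
    (λ n → trans (coeff-+ (twist c p) (twist c q) n) (+-cong (coeff-twist c p n) (coeff-twist c q n)))
    λ n → distribˡ _ _ _

  twist-scale : ∀ c a p → twist c (scale a p) ≈ₚ scale a (twist c p)
  twist-scale c a p = by-coeff _ _
    (λ n → trans (coeff-twist c (scale a p) n) (*-congˡ (coeff-scale a p n)))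
    (λ n → trans (coeff-scale a (twist c p) n) (*-congˡ (coeff-twist c p n)))
    λ n → trans (sym (*-assoc _ a _)) (trans (*-congʳ (*-comm _ a)) (*-assoc a _ _))

  twist-neg : ∀ c p → twist c (-ₚ p) ≈ₚ -ₚ twist c p
  twist-neg c p = by-coeff _ _
    (λ n → trans (coeff-twist c (-ₚ p) n) (*-congˡ (coeff-neg p n)))
    (λ n → trans (coeff-neg (twist c p) n) (-‿cong (coeff-twist c p n)))
    λ n → sym (-‿distribʳ-* _ _)
    where open import Algebra.Properties.Ring ring using (-‿distribʳ-*)

  twist-* : ∀ c p q → twist c (p *ₚ q) ≈ₚ twist c p *ₚ twist c q
  twist-* c []      q = P.refl
  twist-* c (a ∷ p) q = begin
    twist c (scale a q +ₚ (0# ∷ p *ₚ q))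
      ≈⟨ twist-+ c (scale a q) (0# ∷ p *ₚ q) ⟩
    twist c (scale a q) +ₚ (0# ∷ scale c (twist c (p *ₚ q)))
      ≈⟨ +ₚ-cong (twist-scale c a q) (refl ∷-cong P.trans (scale-cong refl (twist-* c p q))
           (P.sym (scale-*ₚ c (twist c p) (twist c q)))) ⟩
    scale a (twist c q) +ₚ (0# ∷ scale c (twist c p) *ₚ twist c q) ∎
    where open SetoidReasoning polySetoid

  twist-isHom : ∀ c → IsHom polynomialRing polynomialRing (twist c)
  twist-isHom c = mkIsHom polynomialRing polynomialRing (twist-cong refl) (twist-+ c) P.refl (twist-* c) P.refl (twist-neg c)

  twist-∘ : ∀ c d p → twist c (twist d p) ≈ₚ twist (c * d) p
  twist-∘ c d p = by-coeff _ _
    (λ n → trans (coeff-twist c (twist d p) n) (trans (*-congˡ (coeff-twist d p n)) (sym (*-assoc _ _ _))))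
    (coeff-twist (c * d) p)
    λ n → *-congʳ (sym (^-distrib-* c d n))

  twist-1 : ∀ p → twist 1# p ≈ₚ p
  twist-1 p = coeffs λ n → trans (coeff-twist 1# p n) (trans (*-congʳ (1^ n)) (*-identityˡ _))

  twist-inverse : ∀ {c d} p → c * d ≈ 1# → twist c (twist d p) ≈ₚ p
  twist-inverse {c} {d} p cd≈1 = P.trans (twist-∘ c d p) (P.trans (twist-cong cd≈1 P.refl) (twist-1 p))

  twist-below : ∀ {c p n} → Below p n → Below (twist c p) n
  twist-below {c} {p} b i n≤i = trans (coeff-twist c p i) (trans (*-congˡ (b i n≤i)) (zeroʳ _))

  twist-degree : ∀ {c p n} → ¬ (c ≈ 0#) → HasDegree p n → HasDegree (twist c p) n
  twist-degree {c} {p} {n} c≉0 (lc≉0 , b) =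
    (λ eq → FractionField.nonzero-* (Field.commutativeRing k) kd (domain-^≉0 (Field.commutativeRing k) kd n c≉0) lc≉0
      (trans (sym (coeff-twist c p n)) eq)) ,
    twist-below {c} {p} b
    where kd = field-isDomain k _≟_

  twist-∣ : ∀ c {p q} → p P.∣ q → twist c p P.∣ twist c q
  twist-∣ c {p} (r , eq) = twist c r , P.trans (P.sym (twist-* c r p)) (twist-cong refl eq)

  twist-irreducible : ∀ {c d p} → c * d ≈ 1# → P.Irreducible p → P.Irreducible (twist c p)
  twist-irreducible {c} {d} {p} cd≈1 irr = mkIrred
    (λ u → p∤1 (PT.∣-respˡ {1ₚ} (twist-inverse p dc≈1) (twist-∣ d {twist c p} {1ₚ} u)))
    λ {x} {y} eq → split x y eq
    where
    open import Algebra.Definitions.RawSemiring (Semiring.rawSemiring P.semiring) using (mkIrred)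
    open P.Irreducible irr
    dc≈1 : d * c ≈ 1#
    dc≈1 = trans (*-comm d c) cd≈1
    untwist : ∀ x → twist d x P.∣ 1ₚ → x P.∣ 1ₚ
    untwist x u = PT.∣-respˡ {1ₚ} (twist-inverse x cd≈1) (twist-∣ c {twist d x} {1ₚ} u)
    split : ∀ x y → twist c p ≈ₚ x *ₚ y → x P.∣ 1ₚ ⊎ y P.∣ 1ₚ
    split x y eq with split-∣1 {twist d x} {twist d y}
      (P.trans (P.sym (twist-inverse p dc≈1)) (P.trans (twist-cong {d} {d} refl eq) (twist-* d x y)))
    ... | inj₁ u = inj₁ (untwist x u)
    ... | inj₂ u = inj₂ (untwist y u)

-- Conjugate proper factors s(ζⁱt) of t^ℓ - D are pairwise comaximal, so an
-- irreducible factor s of degree less than ℓ is linear and yields a root of D.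
module KummerPolynomial {c e} (k : Field c e) (_≟_ : Decidable (Field._≈_ k)) {ℓ} (ℓ-prime : Prime ℓ)
  (ω : RootOfUnity (Field.commutativeRing k) ℓ) (D : Field.Carrier k) where
  open CommRing (Field.commutativeRing k)
  open RingTheory (Field.commutativeRing k)
  open PolynomialsOverField k _≟_
  open Twist k _≟_
  open RootsOfUnityInField k _≟_ ℓ-prime ω
  open import Algebra.Definitions.RawMagma P.*-rawMagma using (_,_)
  open RingMorphisms.IsRingHomomorphism constant-isHom using () renaming (⟦⟧-cong to constant-cong)

  X f : Poly
  X = 0# ∷ 1# ∷ []
  f = X P.^ ℓ P.- constant D

  X-degree : HasDegree X 1
  X-degree = (λ eq → proj₁ domainₖ (sym eq)) , λ { (suc zero) (s≤s ()) ; (suc (suc m)) _ → refl }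

  X^n-degree : ∀ n → HasDegree (X P.^ n) n
  X^n-degree n = ≡.subst (HasDegree (X P.^ n)) (ℕ.*-identityʳ n) (degree-^ {X} n X-degree)

  constant-below : ∀ a → Below (constant a) 1
  constant-below a (suc m) _ = refl

  f-degree : HasDegree f ℓ
  f-degree = degree-+-below {X P.^ ℓ} {P.- constant D} (X^n-degree ℓ)
    (below-mono {P.- constant D} {1} {ℓ} 0<ℓ (below-neg (constant D) (constant-below D)))

  twist-X : ∀ c → twist c X ≈ₚ constant c *ₚ X
  twist-X c = P.sym (P.trans (constant-* c X) (zeroʳ c ∷-cong P.refl))

  twist-f : ∀ {c} → c ^ ℓ ≈ 1# → twist c f ≈ₚ f
  twist-f {c} c^ℓ≈1 = begin
    twist c f  ≈⟨ twist-+ c (X P.^ ℓ) (P.- constant D) ⟩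
    twist c (X P.^ ℓ) P.- constant D  ≈⟨ P.+-congʳ {x = P.- constant D} (begin
      twist c (X P.^ ℓ)  ≈⟨ hom-^ polynomialRing polynomialRing (twist-isHom c) X ℓ ⟩
      twist c X P.^ ℓ  ≈⟨ PT.^-congˡ ℓ (twist-X c) ⟩
      (constant c *ₚ X) P.^ ℓ  ≈⟨ PT.^-distrib-* (constant c) X ℓ ⟩
      constant c P.^ ℓ *ₚ X P.^ ℓ  ≈⟨ P.*-congʳ {x = X P.^ ℓ} (P.trans
                                               (P.sym (hom-^ (Field.commutativeRing k) polynomialRing constant-isHom c ℓ))
                                               (constant-cong c^ℓ≈1)) ⟩
      1ₚ *ₚ X P.^ ℓ  ≈⟨ *ₚ-identityˡ (X P.^ ℓ) ⟩
      X P.^ ℓ  ∎) ⟩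
    f  ∎
    where open SetoidReasoning polySetoid

  module _ (D≉0 : ¬ (D ≈ 0#)) where
    coeff-f-0 : coeff f 0 ≈ - D
    coeff-f-0 = trans (coeff-+ (X P.^ ℓ) (P.- constant D) 0) (trans (+-congʳ (X^ℓ-0 0<ℓ)) (+-identityˡ _))
      where
      X^ℓ-0 : ∀ {n} → 0 < n → coeff (X P.^ n) 0 ≈ 0#
      X^ℓ-0 {suc n} _ = trans (coeff-+ (scale 0# (X P.^ n)) (0# ∷ (1# ∷ []) *ₚ (X P.^ n)) 0)
        (trans (+-congʳ (coeff-≈ (scale-zero (X P.^ n) refl) 0)) (+-identityˡ 0#))

    coeff-*-0 : ∀ p q → coeff (p *ₚ q) 0 ≈ coeff p 0 * coeff q 0
    coeff-*-0 []      q = sym (zeroˡ _)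
    coeff-*-0 (a ∷ p) q = trans (coeff-+ (scale a q) (0# ∷ p *ₚ q) 0) (trans (+-identityʳ _) (coeff-scale a q 0))

    divisor-0≉0 : ∀ {s} → s P.∣ f → ¬ (coeff s 0 ≈ 0#)
    divisor-0≉0 {s} (r , eq) s0≈0 = D≉0 (trans (sym (-‿involutive D)) (trans (-‿cong (begin
      - D  ≈⟨ coeff-f-0 ⟨
      coeff f 0  ≈⟨ coeff-≈ eq 0 ⟨
      coeff (r *ₚ s) 0  ≈⟨ coeff-*-0 r s ⟩
      coeff r 0 * coeff s 0  ≈⟨ trans (*-congˡ s0≈0) (zeroʳ _) ⟩
      0#  ∎)) -0#≈0#))
      where
      open SetoidReasoning setoid
      open import Algebra.Properties.Ring ring using (-‿involutive; -0#≈0#)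

    module Factor {s r} (irr : P.Irreducible s) (s∣f : s P.∣ f) (s-degree : HasDegree s r) (0<r : 0 < r) (r<ℓ : r < ℓ) where
      conjugate : Fin ℓ → Poly
      conjugate i = twist (ζ ^ toℕ i) s

      conjugate-degree : ∀ i → HasDegree (conjugate i) r
      conjugate-degree i = twist-degree {ζ ^ toℕ i} {s} (ζ^n≉0 (toℕ i)) s-degree

      conjugate-∣ : ∀ i → conjugate i P.∣ f
      conjugate-∣ i = PT.∣-respʳ {conjugate i} (twist-f (ζ^n^ℓ≈1 (toℕ i))) (twist-∣ (ζ ^ toℕ i) {s} {f} s∣f)

      conjugate-irreducible : ∀ i → P.Irreducible (conjugate i)
      conjugate-irreducible i = twist-irreducible {ζ ^ toℕ i} {ζ ^ (ℓ ∸ toℕ i)} {s}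
        (trans (*-comm _ _) (ζ^-inverse (toℕ i) (ℕ.<⇒≤ (Fin.toℕ<n i)))) irr

      -- Conjugates share the constant term s(0), which is nonzero because it divides -D; so the
      -- scalar is 1. Comparing leading coefficients then gives ζ^(i r) = ζ^(j r).
      scalar-ratio : ∀ {t i j} → conjugate j ≈ₚ scale t (conjugate i) → i ≡ j
      scalar-ratio {t} {i} {j} eq = Fin.toℕ-injective (exponents-injective (Fin.toℕ<n i) (Fin.toℕ<n j) 0<r r<ℓ
        (domain-cancelʳ (Field.commutativeRing k) domainₖ (proj₁ s-degree) (begin
          (ζ ^ toℕ i) ^ r * coeff s r  ≈⟨ coeff-twist (ζ ^ toℕ i) s r ⟨
          coeff (conjugate i) r  ≈⟨ trans (sym (*-identityˡ _)) (*-congʳ (sym t≈1)) ⟩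
          t * coeff (conjugate i) r  ≈⟨ coeff-scale t (conjugate i) r ⟨
          coeff (scale t (conjugate i)) r  ≈⟨ coeff-≈ eq r ⟨
          coeff (conjugate j) r  ≈⟨ coeff-twist (ζ ^ toℕ j) s r ⟩
          (ζ ^ toℕ j) ^ r * coeff s r  ∎)))
        where
        open SetoidReasoning setoid
        constant-term : ∀ i → coeff (conjugate i) 0 ≈ coeff s 0
        constant-term i = trans (coeff-twist (ζ ^ toℕ i) s 0) (*-identityˡ _)
        t≈1 : t ≈ 1#
        t≈1 = domain-cancelʳ (Field.commutativeRing k) domainₖ (divisor-0≉0 {s} s∣f) (begin
          t * coeff s 0  ≈⟨ *-congˡ (constant-term i) ⟨
          t * coeff (conjugate i) 0  ≈⟨ coeff-scale t (conjugate i) 0 ⟨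
          coeff (scale t (conjugate i)) 0  ≈⟨ coeff-≈ eq 0 ⟨
          coeff (conjugate j) 0  ≈⟨ constant-term j ⟩
          coeff s 0  ≈⟨ *-identityˡ _ ⟨
          1# * coeff s 0  ∎)

      conjugate-∣⇒≡ : ∀ i j → conjugate i P.∣ conjugate j → i ≡ j
      conjugate-∣⇒≡ i j (q , eq) = scalar-ratio {coeff q 0} {i} {j}
        (P.trans (P.sym eq) (P.trans (P.*-congʳ {x = conjugate i} q-constant) (constant-* (coeff q 0) (conjugate i))))
        where
        q-degree : ∃ (HasDegree q)
        q-degree = ≉0⇒degree {q} λ q≈0 → degree≉0 {conjugate j} (conjugate-degree j)
          (P.trans (P.sym eq) (0*≈0 {q} (conjugate i) q≈0))
        q-degree≡0 : proj₁ q-degree ≡ 0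
        q-degree≡0 = ℕ.+-cancelʳ-≡ r (proj₁ q-degree) 0 (degree-unique {conjugate j}
          (degree-resp {q *ₚ conjugate i} {conjugate j} eq
            (degree-* {q} {conjugate i} (proj₂ q-degree) (conjugate-degree i)))
          (conjugate-degree j))
        q-constant : q ≈ₚ constant (coeff q 0)
        q-constant = coeffs λ { zero → refl ; (suc n) →
          proj₂ (proj₂ q-degree) (suc n) (≡.subst (_< suc n) (≡.sym q-degree≡0) (s≤s z≤n)) }

      conjugate-comaximal : ∀ i j → i ≢ j → PT.Comaximal (conjugate i) (conjugate j)
      conjugate-comaximal i j i≢j = go (irreducible-∣⊎comaximal (conjugate-irreducible i) (conjugate j))
        where
        go : conjugate i P.∣ conjugate j ⊎ PT.Comaximal (conjugate i) (conjugate j) → PT.Comaximal (conjugate i) (conjugate j)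
        go (inj₁ d)  = ⊥-elim (i≢j (conjugate-∣⇒≡ i j d))
        go (inj₂ cm) = cm

      -- The product of the ℓ pairwise comaximal conjugates divides f, so ℓ r ≤ ℓ.
      r≤1 : r ≤ 1
      r≤1 = ℕ.*-cancelˡ-≤ ℓ {{ℕ.>-nonZero 0<ℓ}} (≡.subst₂ _≤_
        (degree-unique {PT.product conjugate} (proj₁ (proj₂ d)) (degree-product conjugate conjugate-degree))
        (≡.sym (ℕ.*-identityʳ ℓ)) (proj₂ (proj₂ d)))
        where
        d : ∃ λ m → HasDegree (PT.product conjugate) m × m ≤ ℓ
        d = divisor-degree {PT.product conjugate} {f} f-degree (PT.product-∣ {x = f} conjugate conjugate-comaximal conjugate-∣)

    -- Up to a unit s is X - β, so it divides X^ℓ - β^ℓ as well as X^ℓ - D. It then divides the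
    -- constant β^ℓ - D, which must be 0 since s has degree 1.
    linear-factor⇒root : ∀ {s} → s P.∣ f → HasDegree s 1 → ∃ λ β → β ^ ℓ ≈ D
    linear-factor⇒root {s} s∣f h@(lc≉0 , b) = β , x-y≈0⇒x≈y (trans
        (sym (coeff-+ (constant (β ^ ℓ)) (P.- constant D) 0))
        (coeff-≈ (small-multiple {s} {1} {constant (β ^ ℓ) P.- constant D} h
          (below-+ (constant (β ^ ℓ)) (P.- constant D) (constant-below (β ^ ℓ)) (below-neg (constant D) (constant-below D)))
          (PT.∣-respʳ {s} (PT.[x-y]-[x-z]≈z-y (X P.^ ℓ) (constant D) (constant (β ^ ℓ)))
            (PT.∣-- {s} {f} {X P.^ ℓ P.- constant (β ^ ℓ)} s∣f s∣X^ℓ-β^ℓ))) 0))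
      where
      inv = proj₂ (Field.isField k) (coeff s 1) lc≉0
      t = proj₁ inv
      β = - (t * coeff s 0)
      t*s≈X-β : constant t *ₚ s ≈ₚ X P.- constant β
      t*s≈X-β = P.trans (constant-* t s) (coeffs
        λ { zero → trans (coeff-scale t s 0) (sym (trans (+-identityˡ _) (-‿involutive _)))
          ; (suc zero) → trans (coeff-scale t s 1) (trans (*-comm t _) (proj₂ inv))
          ; (suc (suc n)) → below-scale t s b (suc (suc n)) (s≤s (s≤s z≤n)) })
        where open import Algebra.Properties.Ring ring using (-‿involutive)
      s∣X-β : s P.∣ (X P.- constant β)
      s∣X-β = constant t , t*s≈X-β
      s∣X^ℓ-β^ℓ : s P.∣ (X P.^ ℓ P.- constant (β ^ ℓ))
      s∣X^ℓ-β^ℓ = PT.∣-respʳ {s} (P.+-congˡ {x = X P.^ ℓ} (P.-‿cong {constant β P.^ ℓ} {constant (β ^ ℓ)}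
          (P.sym (hom-^ (Field.commutativeRing k) polynomialRing constant-isHom β ℓ))))
        (PT.∣-trans {s} {X P.- constant β} {X P.^ ℓ P.- constant β P.^ ℓ} s∣X-β (PT.x-y∣x^n-y^n X (constant β) ℓ))

    f-irreducible : (∀ β → ¬ (β ^ ℓ ≈ D)) → P.Irreducible f
    f-irreducible not-power = mkIrred (degree>0⇒∤1 {f} f-degree 0<ℓ) λ {x} {y} eq → split x y eq
      where
      open import Algebra.Definitions.RawSemiring (Semiring.rawSemiring P.semiring) using (mkIrred)
      no-proper-factor : ∀ {s} → P.Irreducible s → s P.∣ f → (∃ λ r → HasDegree s r × 0 < r × r < ℓ) → ⊥
      no-proper-factor {s} irr s∣f (r , h , 0<r , r<ℓ) = not-power (proj₁ root) (proj₂ root)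
        where
        root : ∃ λ β → β ^ ℓ ≈ D
        root = linear-factor⇒root {s} s∣f (≡.subst (HasDegree s) (ℕ.≤-antisym (Factor.r≤1 {s} irr s∣f h 0<r r<ℓ) 0<r) h)
      split : ∀ x y → f ≈ₚ x *ₚ y → x P.∣ 1ₚ ⊎ y P.∣ 1ₚ
      split x y f≈xy = by-degrees (divisor-degree {x} {f} f-degree x∣f) (divisor-degree {y} {f} f-degree y∣f)
        where
        x∣f : x P.∣ f
        x∣f = PT.∣-respʳ {x} (P.sym f≈xy) (PT.x∣x*y x y)
        y∣f : y P.∣ f
        y∣f = PT.∣-respʳ {y} (P.sym f≈xy) (PT.∣-*ˡ {y} {y} x (PT.∣-refl {y}))
        by-degrees : (∃ λ m → HasDegree x m × m ≤ ℓ) → (∃ λ m → HasDegree y m × m ≤ ℓ) → x P.∣ 1ₚ ⊎ y P.∣ 1ₚ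
        by-degrees (zero  , hx , _) _              = inj₁ (degree-0⇒unit {x} hx)
        by-degrees (suc a , hx , _) (zero , hy , _) = inj₂ (degree-0⇒unit {y} hy)
        -- Two factors of positive degree are to be refuted, so the irreducible factor of x is
        -- available although it is known only under double negation; its degree is below ℓ because
        -- y is not constant.
        by-degrees (suc a , hx , _) (suc b , hy , _) = ⊥-elim
          (¬¬-irreducible-factor (suc a) {x} ℕ.≤-refl hx (s≤s z≤n) λ (s , irr , s∣x) →
            no-proper-factor {s} irr (PT.∣-trans {s} {x} {f} s∣x x∣f) (s-degrees irr s∣x))
          where
          a+b≡ℓ : suc a ℕ.+ suc b ≡ ℓ
          a+b≡ℓ = degree-unique {f} (degree-resp {x *ₚ y} {f} (P.sym f≈xy) (degree-* {x} {y} hx hy)) f-degree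
          s-degrees : ∀ {s} → P.Irreducible s → s P.∣ x → ∃ λ r → HasDegree s r × 0 < r × r < ℓ
          s-degrees {s} irr s∣x = proj₁ sx , proj₁ (proj₂ sx) ,
            ≡.subst (0 <_) (degree-unique {s} (proj₁ (proj₂ si)) (proj₁ (proj₂ sx))) (proj₂ (proj₂ si)) ,
            ℕ.≤-<-trans (proj₂ (proj₂ sx)) (≡.subst (suc a <_) a+b≡ℓ (ℕ.m<m+n (suc a) (s≤s z≤n)))
            where
            sx : ∃ λ r → HasDegree s r × r ≤ suc a
            sx = divisor-degree {s} {x} hx s∣x
            si : ∃ λ r → HasDegree s r × 0 < r
            si = irreducible-degree irr

-- Simple extensions and Kummer extensions

module _ {c e p} (R : CommutativeRing c e) (I : Ideal R p) where
  open CommRing R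
  open Ideal I

  ≈⇒≈/ : ∀ {x y} → x ≈ y → Member (x - y)
  ≈⇒≈/ x≈y = ∈-resp-≈ (sym (RingTheory.x≈y⇒x-y≈0 R x≈y)) 0∈

  hom-quotient : ∀ {a b} {A : CommutativeRing a b} {φ : CommutativeRing.Carrier A → Carrier} →
                 IsHom A R φ → IsHom A (quotientRing R I) φ
  hom-quotient {A = A} φ-isHom = mkIsHom A (quotientRing R I) (λ eq → ≈⇒≈/ (⟦⟧-cong eq)) (λ x y → ≈⇒≈/ (+-homo x y))
    (≈⇒≈/ 0#-homo) (λ x y → ≈⇒≈/ (*-homo x y)) (≈⇒≈/ 1#-homo) (λ x → ≈⇒≈/ (-‿homo x))
    where open RingMorphisms.IsRingHomomorphism φ-isHom

module SimpleExtension {c e} (k : Field c e) (_≟_ : Decidable (Field._≈_ k)) {f : List (Field.Carrier k)} {n : ℕ}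
  (h : Polynomials.HasDegree (Field.commutativeRing k) f n)
  (irr : CommRing.Irreducible (Polynomials.polynomialRing (Field.commutativeRing k)) f) where
  private module k = Field k
  open PolynomialsOverField k _≟_
  open ResidueRing k _≟_ {f} {n} h
  open Twist k _≟_

  extension : Extension k c e
  extension = record
    { overfield = record { commutativeRing = residueRing ; isField = irreducible⇒isField irr }
    ; embed     = constant
    ; isHom     = hom-quotient polynomialRing ideal {A = k.commutativeRing} constant-isHom
    }

  private
    module L = Extension extension
    module LT = RingTheory L.ring

  generator : Poly
  generator = k.0# ∷ k.1# ∷ []

  ∷-generator : ∀ a p → (a ∷ p) ≈ₚ constant a +ₚ generator *ₚ p
  ∷-generator a p = P.sym (P.trans
    (P.+-congˡ {x = constant a} (P.trans (P.+-congʳ {x = k.0# ∷ 1ₚ *ₚ p} (scale-zero p k.refl)) (k.refl ∷-cong *ₚ-identityˡ p)))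
    (k.+-identityʳ a ∷-cong P.refl))

  fromCoordinates-sum : ∀ {m} (v : Fin m → k.Carrier) →
    fromCoordinates v L.≈ L.sum (λ j → L.embed (v j) L.* generator L.^ toℕ j)
  fromCoordinates-sum {zero}  v = ≈ₚ⇒≈ᵣ {[]} {[]} P.refl
  fromCoordinates-sum {suc m} v = L.trans {x} {y} {z} (≈ₚ⇒≈ᵣ {x} {y} (∷-generator (v zero) (fromCoordinates (v ∘ suc))))
    (L.trans {y} {y′} {z} (L.+-congˡ {x = constant (v zero)} {w} {w′} (L.*-congˡ {x = generator} {fromCoordinates (v ∘ suc)} {s} (fromCoordinates-sum (v ∘ suc))))
      (LT.horner {m} (λ j → constant (v j)) generator))
    where
    s x y z y′ w w′ : Poly
    s = L.sum (λ j → L.embed (v (suc j)) L.* generator L.^ toℕ j)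
    x = fromCoordinates v
    w = generator *ₚ fromCoordinates (v ∘ suc)
    w′ = generator *ₚ s
    y = constant (v zero) +ₚ w
    y′ = constant (v zero) +ₚ w′
    z = L.sum (λ j → L.embed (v j) L.* generator L.^ toℕ j)

  basis : Basis extension n
  basis = record
    { vector     = λ j → generator L.^ toℕ j
    ; coordinate = coordinate
    ; spanning   = λ x → L.trans {x} {fromCoordinates (coordinate x)}
        (coordinate-injective {x} {fromCoordinates (coordinate x)} λ i → k.sym (coordinate-fromCoordinates (coordinate x) i))
        (fromCoordinates-sum (coordinate x))
    ; independent = λ a eq j → k.trans (k.sym (coordinate-fromCoordinates a j))
        (k.trans (coordinate-cong {fromCoordinates a} {[]} (L.trans {fromCoordinates a} {_} {[]} (fromCoordinates-sum a) eq) j)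
          (coordinate-0 j))
    }
    where
    coordinate-0 : ∀ j → coordinate [] j k.≈ k.0#
    coordinate-0 j = coeff-≈ (∣⇒remainder≈0 {[]} (PT.∣0 f)) (toℕ j)

  module _ {c d : k.Carrier} (cd≈1 : c k.* d k.≈ k.1#) (twist-f : twist c f ≈ₚ f) where
    private
      twist-f′ : twist d f ≈ₚ f
      twist-f′ = P.trans (twist-cong k.refl (P.sym twist-f)) (twist-inverse f (k.trans (k.*-comm d c) cd≈1))

      twist-resp : ∀ {c} → twist c f ≈ₚ f → ∀ {p q} → p ≈ᵣ q → twist c p ≈ᵣ twist c q
      twist-resp {c} eq {p} {q} p≈q = ∣⇒≈ᵣ {twist c p} {twist c q}
        (PT.∣-respʳ {f} (P.trans (twist-+ c p (-ₚ q)) (P.+-congˡ {x = twist c p} (twist-neg c q)))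
          (PT.∣-respˡ {twist c (p P.- q)} eq (twist-∣ c {f} {p P.- q} (≈ᵣ⇒∣ {p} {q} p≈q))))

    -- As t ↦ c t fixes f, it maps multiples of f to multiples of f and passes to residues. The same
    -- holds for t ↦ d t, which is its inverse.
    automorphism : extension ≅ extension
    automorphism = record
      { ⟦_⟧ = twist c
      ; isRingIsomorphism = record
        { isRingMonomorphism = record
          { isRingHomomorphism = record
            { isSemiringHomomorphism = record
              { isNearSemiringHomomorphism = record
                { +-isMonoidHomomorphism = record
                  { isMagmaHomomorphism = record
                    { isRelHomomorphism = record { cong = λ {p} {q} → twist-resp twist-f {p} {q} }
                    ; homo = λ p q → ≈ₚ⇒≈ᵣ {twist c (p +ₚ q)} {twist c p +ₚ twist c q} (twist-+ c p q)
                    }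
                  ; ε-homo = ≈ₚ⇒≈ᵣ {[]} {[]} P.refl
                  }
                ; *-homo = λ p q → ≈ₚ⇒≈ᵣ {twist c (p *ₚ q)} {twist c p *ₚ twist c q} (twist-* c p q)
                }
              ; 1#-homo = ≈ₚ⇒≈ᵣ {1ₚ} {1ₚ} P.refl
              }
            ; -‿homo = λ p → ≈ₚ⇒≈ᵣ {twist c (-ₚ p)} { -ₚ twist c p} (twist-neg c p)
            }
          ; injective = λ {p} {q} eq → L.trans {p} {twist d (twist c p)} {q} (L.sym {twist d (twist c p)} {p} (untwist p))
              (L.trans {twist d (twist c p)} {twist d (twist c q)} {q}
                (twist-resp twist-f′ {twist c p} {twist c q} eq) (untwist q))
          }
        ; surjective = λ q → twist d q , λ {z} eq → L.trans {twist c z} {twist c (twist d q)} {q}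
            (twist-resp twist-f {z} {twist d q} eq) (≈ₚ⇒≈ᵣ {twist c (twist d q)} {q} (twist-inverse q cd≈1))
        }
      ; fixes-k = λ a → ≈ₚ⇒≈ᵣ {constant a} {constant a} P.refl
      }
      where
      untwist : ∀ p → twist d (twist c p) ≈ᵣ p
      untwist p = ≈ₚ⇒≈ᵣ {twist d (twist c p)} {p} (twist-inverse p (k.trans (k.*-comm d c) cd≈1))

-- The interface through which Kummer theory sees an extension; arguments based on it do not refer
-- to the quotient ring that realises the field.
record IsKummer {c e c′ e′} {k : Field c e} {ℓ} (ω : RootOfUnity (Field.commutativeRing k) ℓ) (D : Field.Carrier k)
                (K : Extension k c′ e′) (B : Basis K ℓ) : Set (c ⊔ e ⊔ c′ ⊔ e′) where
  open Extension K
  open RootOfUnity ω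
  field
    y        : Carrier
    y^ℓ≈D    : y ^ ℓ ≈ embed D
    vector≈  : ∀ i → Basis.vector B i ≈ y ^ toℕ i
    σ        : K ≅ K
    σy≈ζy    : _≅_.⟦ σ ⟧ y ≈ embed ζ * y

module KummerExtension {c e} (k : Field c e) (_≟_ : Decidable (Field._≈_ k)) {ℓ} (ℓ-prime : Prime ℓ)
  (ω : RootOfUnity (Field.commutativeRing k) ℓ) {D : Field.Carrier k} (D≉0 : ¬ (Field._≈_ k D (Field.0# k)))
  (not-power : ∀ β → ¬ (Field._≈_ k (CommRing._^_ (Field.commutativeRing k) β ℓ) D)) where
  open RootsOfUnityInField k _≟_ ℓ-prime ω using (ζ; ζ^ℓ≈1; ζ^-inverse; 0<ℓ)
  open KummerPolynomial k _≟_ ℓ-prime ω D using (X; f; f-degree; f-irreducible; twist-f)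
  open PolynomialsOverField k _≟_
  open ResidueRing k _≟_ {f} {ℓ} f-degree
  private
    module k = CommRing (Field.commutativeRing k)
    module S = SimpleExtension k _≟_ {f} {ℓ} f-degree (f-irreducible D≉0 not-power)

  open S public using (extension; basis)

  private module L = Extension extension

  ζζ^[ℓ-1]≈1 : ζ k.* ζ k.^ (ℓ ∸ 1) k.≈ k.1#
  ζζ^[ℓ-1]≈1 = k.trans (k.*-comm ζ _) (k.trans (k.*-congˡ (k.sym (k.*-identityʳ ζ))) (ζ^-inverse 1 0<ℓ))

  isKummer : IsKummer ω D extension basis
  isKummer = record
    { y       = X
    ; y^ℓ≈D   = ≡.subst (_≈ᵣ constant D) (≡.sym (quotientRing-^ polynomialRing ideal X ℓ))
        (∣⇒≈ᵣ {X P.^ ℓ} {constant D} (PT.∣-refl {f}))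
    ; vector≈ = λ i → L.refl {X L.^ toℕ i}
    ; σ       = S.automorphism ζζ^[ℓ-1]≈1 (twist-f ζ^ℓ≈1)
    ; σy≈ζy   = ≈ₚ⇒≈ᵣ {twist ζ X} {constant ζ *ₚ X} (twist-X ζ)
    }
    where
    open Twist k _≟_ using (twist)
    open KummerPolynomial k _≟_ ℓ-prime ω D using (twist-X)

-- Determinants, and coordinates in a basis

module Determinant {c e} (R : CommutativeRing c e) where
  open CommRing R
  open RingTheory R
  open IntegerSolver R

  private
    toℕ-punchIn-last : ∀ n (k : Fin n) → toℕ (punchIn (Fin.fromℕ n) k) ≡ toℕ k
    toℕ-punchIn-last (suc n) zero    = ≡.refl
    toℕ-punchIn-last (suc n) (suc k) = ≡.cong suc (toℕ-punchIn-last n k)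

  -- Expansion along the first row leaves one minor, without the last column. Removing that column
  -- does not renumber the others, so the minor is antidiagonal of the next smaller size. The sign
  -- stays an unspecified power of -1, as it is a unit anyway.
  antidiagonal-det : ∀ n a (M : Fin n → Fin n → Carrier) →
    (∀ i j → suc (toℕ i ℕ.+ toℕ j) ≡ n → M i j ≈ a) → (∀ i j → suc (toℕ i ℕ.+ toℕ j) ≢ n → M i j ≈ 0#) →
    ∃ λ m → det R M ≈ (- 1#) ^ m * a ^ n
  antidiagonal-det zero    a M on off = 0 , sym (*-identityˡ 1#)
  antidiagonal-det (suc n) a M on off = n ℕ.+ proj₁ ih , (begin
    det R M
      ≈⟨ sum-single {suc n} (λ j → (- 1#) ^ toℕ j * (M zero j * det R (λ i k → M (suc i) (punchIn j k)))) last
           (λ j j≢last → trans (*-congˡ (trans (*-congʳ (off zero j (j≢last ∘ last-unique j))) (zeroˡ _))) (zeroʳ _)) ⟩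
    (- 1#) ^ toℕ last * (M zero last * det R (λ i k → M (suc i) (punchIn last k)))
      ≈⟨ *-cong (^-congʳ (- 1#) (Fin.toℕ-fromℕ n)) (*-cong (on zero last (≡.cong suc (Fin.toℕ-fromℕ n))) (proj₂ ih)) ⟩
    (- 1#) ^ n * (a * ((- 1#) ^ proj₁ ih * a ^ n))
      ≈⟨ solve 4 (λ s a t p → s :* (a :* (t :* p)) := (s :* t) :* (a :* p)) refl ((- 1#) ^ n) a ((- 1#) ^ proj₁ ih) (a ^ n) ⟩
    ((- 1#) ^ n * (- 1#) ^ proj₁ ih) * a ^ suc n
      ≈⟨ *-congʳ (^-homo-* (- 1#) n (proj₁ ih)) ⟨
    (- 1#) ^ (n ℕ.+ proj₁ ih) * a ^ suc n ∎)
    where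
    open SetoidReasoning setoid
    last : Fin (suc n)
    last = Fin.fromℕ n
    last-unique : ∀ j → suc (toℕ j) ≡ suc n → j ≡ last
    last-unique j eq = Fin.toℕ-injective (≡.trans (ℕ.suc-injective eq) (≡.sym (Fin.toℕ-fromℕ n)))
    shifted : ∀ i k → suc (suc (toℕ i) ℕ.+ toℕ (punchIn last k)) ≡ suc (suc (toℕ i ℕ.+ toℕ k))
    shifted i k = ≡.cong (λ m → suc (suc (toℕ i ℕ.+ m))) (toℕ-punchIn-last n k)
    ih : ∃ λ m → det R (λ i k → M (suc i) (punchIn last k)) ≈ (- 1#) ^ m * a ^ n
    ih = antidiagonal-det n a (λ i k → M (suc i) (punchIn last k))
      (λ i k eq → on (suc i) (punchIn last k) (≡.trans (shifted i k) (≡.cong suc eq)))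
      (λ i k neq → off (suc i) (punchIn last k) λ eq → neq (ℕ.suc-injective (≡.trans (≡.sym (shifted i k)) eq)))

  corner-det : ∀ {n} (M : Fin (suc n) → Fin (suc n) → Carrier) → (∀ j → M zero (suc j) ≈ 0#) →
    det R M ≈ M zero zero * det R (λ i k → M (suc i) (suc k))
  corner-det {n} M off = trans
    (sum-single {suc n} (λ j → (- 1#) ^ toℕ j * (M zero j * det R (λ i k → M (suc i) (punchIn j k)))) zero
      λ { zero 0≢0 → ⊥-elim (0≢0 ≡.refl)
        ; (suc j) _ → trans (*-congˡ (trans (*-congʳ (off j)) (zeroˡ _))) (zeroʳ _) })
    (*-identityˡ _)

module Coordinates {c e c′ e′} (k : Field c e) (_≟_ : Decidable (Field._≈_ k)) {n} (K : Extension k c′ e′) (B : Basis K n) where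
  open Extension K
  open Basis B
  open RingTheory (Extension.ring K)
  open RingMorphisms.IsRingHomomorphism isHom
  private
    module k = CommRing (Field.commutativeRing k)
    module kT = RingTheory (Field.commutativeRing k)
    open IntegerSolver (Extension.ring K)

  embed≈0⇒≈0 : ∀ {a} → embed a ≈ 0# → a k.≈ k.0#
  embed≈0⇒≈0 {a} eq with a ≟ k.0#
  ... | yes a≈0 = a≈0
  ... | no  a≉0 with proj₂ (Field.isField k) a a≉0
  ...   | b , ab≈1 = ⊥-elim (proj₁ (Field.isField (Extension.overfield K)) (trans (sym (trans (*-congʳ eq) (zeroˡ (embed b))))
            (trans (sym (*-homo a b)) (trans (⟦⟧-cong ab≈1) 1#-homo))))

  embed-- : ∀ a b → embed (a k.- b) ≈ embed a - embed b
  embed-- a b = trans (+-homo a (k.- b)) (+-congˡ (-‿homo b))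

  embed-injective : ∀ {a b} → embed a ≈ embed b → a k.≈ b
  embed-injective {a} {b} eq = kT.x-y≈0⇒x≈y (embed≈0⇒≈0 (trans (embed-- a b) (x≈y⇒x-y≈0 eq)))

  combination : (Fin n → k.Carrier) → Carrier
  combination a = sum λ j → embed (a j) * vector j

  combination-cong : ∀ {a b : Fin n → k.Carrier} → (∀ j → a j k.≈ b j) → combination a ≈ combination b
  combination-cong eq = sum-cong-≋ {n} λ j → *-congʳ (⟦⟧-cong (eq j))

  combination-+ : ∀ a b → combination a + combination b ≈ combination (λ j → a j k.+ b j)
  combination-+ a b = trans (sym (∑-distrib-+ {n} (λ j → embed (a j) * vector j) (λ j → embed (b j) * vector j)))
    (sum-cong-≋ {n} λ j → trans (sym (distribʳ _ _ _)) (*-congʳ (sym (+-homo (a j) (b j)))))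

  combination-* : ∀ c a → embed c * combination a ≈ combination (λ j → c k.* a j)
  combination-* c a = trans (*-distribˡ-sum {n} (embed c) (λ j → embed (a j) * vector j))
    (sum-cong-≋ {n} λ j → trans (sym (*-assoc _ _ _)) (*-congʳ (sym (*-homo c (a j)))))

  coordinate-unique : ∀ {x a} → x ≈ combination a → ∀ j → coordinate x j k.≈ a j
  coordinate-unique {x} {a} x≈ j = kT.x-y≈0⇒x≈y (k.trans (k.+-congˡ (k.sym (kT.-1*x≈-x (a j))))
    (independent (λ j → coordinate x j k.+ k.- k.1# k.* a j) (begin
      combination (λ j → coordinate x j k.+ k.- k.1# k.* a j)
        ≈⟨ combination-+ (coordinate x) (λ j → k.- k.1# k.* a j) ⟨
      combination (coordinate x) + combination (λ j → k.- k.1# k.* a j)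
        ≈⟨ +-cong (sym (spanning x)) (sym (combination-* (k.- k.1#) a)) ⟩
      x + embed (k.- k.1#) * combination a
        ≈⟨ +-congˡ (*-cong (trans (-‿homo k.1#) (-‿cong 1#-homo)) (sym x≈)) ⟩
      x + - 1# * x
        ≈⟨ solve 1 (λ x → x :+ (:- 1′) :* x := 0′) refl x ⟩
      0# ∎) j))
    where open SetoidReasoning setoid

  coordinate-cong : ∀ {x y} → x ≈ y → ∀ j → coordinate x j k.≈ coordinate y j
  coordinate-cong {x} {y} x≈y = coordinate-unique (trans x≈y (spanning y))

  coordinate-+ : ∀ x y j → coordinate (x + y) j k.≈ coordinate x j k.+ coordinate y j
  coordinate-+ x y = coordinate-unique (trans (+-cong (spanning x) (spanning y)) (combination-+ (coordinate x) (coordinate y)))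

  coordinate-* : ∀ c x j → coordinate (embed c * x) j k.≈ c k.* coordinate x j
  coordinate-* c x = coordinate-unique (trans (*-congˡ (spanning x)) (combination-* c (coordinate x)))

  coordinate-- : ∀ x y j → coordinate (x - y) j k.≈ coordinate x j k.- coordinate y j
  coordinate-- x y j = kT.x+y≈z⇒x≈z-y (k.trans (k.sym (coordinate-+ (x - y) y j))
    (coordinate-cong (solve 2 (λ x y → (x :- y) :+ y := x) refl x y) j))

  coordinate-0 : ∀ j → coordinate 0# j k.≈ k.0#
  coordinate-0 = coordinate-unique (sym (sum-0 {n} λ j → trans (*-congʳ 0#-homo) (zeroˡ _)))

  coordinate-sum : ∀ {m} (x : Fin m → Carrier) j → coordinate (sum x) j k.≈ k.sum (λ i → coordinate (x i) j)
  coordinate-sum {zero}  x j = coordinate-0 j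
  coordinate-sum {suc m} x j = k.trans (coordinate-+ (x zero) (sum (x ∘ suc)) j) (k.+-congˡ (coordinate-sum (x ∘ suc) j))

  δ : Fin n → Fin n → k.Carrier
  δ i j with i Fin.≟ j
  ... | yes _ = k.1#
  ... | no  _ = k.0#

  δ-≢ : ∀ {i j} → i ≢ j → δ i j ≡ k.0#
  δ-≢ {i} {j} i≢j with i Fin.≟ j
  ... | yes i≡j = ⊥-elim (i≢j i≡j)
  ... | no  _   = ≡.refl

  δ-refl : ∀ i → δ i i ≡ k.1#
  δ-refl i with i Fin.≟ i
  ... | yes _   = ≡.refl
  ... | no  i≢i = ⊥-elim (i≢i ≡.refl)

  coordinate-vector : ∀ i j → coordinate (vector i) j k.≈ δ i j
  coordinate-vector i = coordinate-unique (sym (trans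
    (sum-single {n} (λ j → embed (δ i j) * vector j) i
      λ j j≢i → trans (*-congʳ (trans (⟦⟧-cong (k.reflexive (δ-≢ (j≢i ∘ ≡.sym)))) 0#-homo)) (zeroˡ _))
    (trans (*-congʳ (trans (⟦⟧-cong (k.reflexive (δ-refl i))) 1#-homo)) (*-identityˡ _))))

  coordinate-injective : ∀ {x y} → (∀ j → coordinate x j k.≈ coordinate y j) → x ≈ y
  coordinate-injective {x} {y} eq = trans (spanning x) (trans (combination-cong eq) (sym (spanning y)))

  _≟K_ : Decidable _≈_
  x ≟K y = map′ coordinate-injective coordinate-cong (Fin.all? λ j → coordinate x j ≟ coordinate y j)

  single-coordinate : ∀ {x} i → (∀ j → j ≢ i → coordinate x j k.≈ k.0#) → x ≈ embed (coordinate x i) * vector i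
  single-coordinate {x} i off = trans (spanning x) (sum-single {n} (λ j → embed (coordinate x j) * vector j) i
    λ j j≢i → trans (*-congʳ (trans (⟦⟧-cong (off j j≢i)) 0#-homo)) (zeroˡ _))

-- Kummer theory: automorphisms, monomials, traces, discriminant

module KummerTheory {c e c′ e′} (k : Field c e) (_≟_ : Decidable (Field._≈_ k)) {ℓ} (ℓ-prime : Prime ℓ)
  (ω : RootOfUnity (Field.commutativeRing k) ℓ) {D : Field.Carrier k} (D≉0 : ¬ (Field._≈_ k D (Field.0# k)))
  (K : Extension k c′ e′) (B : Basis K ℓ) (isKummer : IsKummer ω D K B) where
  open Extension K
  open Basis B
  open RingTheory (Extension.ring K)
  open RingMorphisms.IsRingHomomorphism isHom
  open RootsOfUnityInField k _≟_ ℓ-prime ω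
  open Coordinates k _≟_ K B public
  open IsKummer isKummer public
  private
    module k = CommRing (Field.commutativeRing k)
    module kT = RingTheory (Field.commutativeRing k)
    open IntegerSolver (Extension.ring K)

  domainK : IsDomain (Extension.ring K)
  domainK = field-isDomain (Extension.overfield K) _≟K_

  embed-^ : ∀ a n → embed (a k.^ n) ≈ embed a ^ n
  embed-^ = hom-^ (Field.commutativeRing k) (Extension.ring K) isHom

  ωK : RootOfUnity (Extension.ring K) ℓ
  ωK = mapRootOfUnity (Field.commutativeRing k) (Extension.ring K) isHom ω

  y≉0 : ¬ (y ≈ 0#)
  y≉0 y≈0 = D≉0 (embed≈0⇒≈0 (trans (sym y^ℓ≈D) (trans (^-congˡ ℓ y≈0) (0^ 0<ℓ))))

  -- The quotient u / v is an ℓ-th root of unity in the domain K, hence a power of ζ. It serves to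
  -- compare an element with its image under an automorphism.
  ratio-is-root : ∀ {u v} → u ^ ℓ ≈ v ^ ℓ → ¬ (v ≈ 0#) → ∃ λ n → u ≈ embed (ζ k.^ n) * v
  ratio-is-root {u} {v} eq v≉0 with proj₂ (Field.isField (Extension.overfield K)) v v≉0
  ... | v⁻¹ , vv⁻¹≈1 = proj₁ root , (begin
      u  ≈⟨ *-identityʳ u ⟨
      u * 1#  ≈⟨ *-congˡ vv⁻¹≈1 ⟨
      u * (v * v⁻¹)  ≈⟨ solve 3 (λ u v w → u :* (v :* w) := (u :* w) :* v) refl u v v⁻¹ ⟩
      (u * v⁻¹) * v  ≈⟨ *-congʳ (trans (proj₂ root) (sym (embed-^ ζ (proj₁ root)))) ⟩
      embed (ζ k.^ proj₁ root) * v  ∎)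
    where
    open SetoidReasoning setoid
    root : ∃ λ n → u * v⁻¹ ≈ embed ζ ^ n
    root = RootsOfUnity.root-of-1 (Extension.ring K) ωK domainK _≟K_ 0<ℓ (u * v⁻¹)
      (trans (^-distrib-* u v⁻¹ ℓ) (trans (*-congʳ eq) (trans (sym (^-distrib-* v v⁻¹ ℓ))
        (trans (^-congˡ ℓ vv⁻¹≈1) (1^ ℓ)))))

  automorphism-coordinate : ∀ (τ : K ≅ K) z → _≅_.⟦ τ ⟧ y ≈ embed z * y →
                            ∀ x i → coordinate (_≅_.⟦ τ ⟧ x) i k.≈ z k.^ toℕ i k.* coordinate x i
  automorphism-coordinate τ z τy≈zy x = coordinate-unique (begin
    τ.⟦ x ⟧  ≈⟨ τ.⟦⟧-cong (spanning x) ⟩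
    τ.⟦ combination (coordinate x) ⟧  ≈⟨ hom-sum (Extension.ring K) (Extension.ring K) τ.isRingHomomorphism {ℓ} _ ⟩
    sum (λ j → τ.⟦ embed (coordinate x j) * vector j ⟧)  ≈⟨ sum-cong-≋ {ℓ} (λ j → trans (τ.*-homo _ _)
                                                                       (*-cong (τ.fixes-k (coordinate x j)) (τ-vector j))) ⟩
    sum (λ j → embed (coordinate x j) * (embed z ^ toℕ j * vector j))
      ≈⟨ sum-cong-≋ {ℓ} (λ j → trans (solve 3 (λ a z v → a :* (z :* v) := (z :* a) :* v) refl _ _ _)
           (*-congʳ (sym (trans (*-homo _ _) (*-congʳ (embed-^ z (toℕ j))))))) ⟩
    combination (λ j → z k.^ toℕ j k.* coordinate x j)  ∎)
    where
    open SetoidReasoning setoid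
    module τ = _≅_ τ
    τ-vector : ∀ j → τ.⟦ vector j ⟧ ≈ embed z ^ toℕ j * vector j
    τ-vector j = begin
      τ.⟦ vector j ⟧  ≈⟨ τ.⟦⟧-cong (vector≈ j) ⟩
      τ.⟦ y ^ toℕ j ⟧  ≈⟨ hom-^ (Extension.ring K) (Extension.ring K) τ.isRingHomomorphism y (toℕ j) ⟩
      τ.⟦ y ⟧ ^ toℕ j  ≈⟨ ^-congˡ (toℕ j) τy≈zy ⟩
      (embed z * y) ^ toℕ j  ≈⟨ ^-distrib-* (embed z) y (toℕ j) ⟩
      embed z ^ toℕ j * y ^ toℕ j ≈⟨ *-congˡ (vector≈ j) ⟨
      embed z ^ toℕ j * vector j ∎

  σ-coordinate : ∀ x i → coordinate (_≅_.⟦ σ ⟧ x) i k.≈ ζ k.^ toℕ i k.* coordinate x i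
  σ-coordinate = automorphism-coordinate σ ζ σy≈ζy

  0ℓ : Fin ℓ
  0ℓ = fromℕ< 0<ℓ

  toℕ-0ℓ : toℕ 0ℓ ≡ 0
  toℕ-0ℓ = Fin.toℕ-fromℕ< 0<ℓ

  vector-0ℓ : vector 0ℓ ≈ 1#
  vector-0ℓ = trans (vector≈ 0ℓ) (^-congʳ y toℕ-0ℓ)

  ≢0ℓ⇒0< : ∀ {j} → j ≢ 0ℓ → 0 < toℕ j
  ≢0ℓ⇒0< {j} j≢0 = ℕ.n≢0⇒n>0 λ j≡0 → j≢0 (Fin.toℕ-injective (≡.trans j≡0 (≡.sym toℕ-0ℓ)))

  eigenvalues-distinct : ∀ {a b z} → a k.* z k.≈ b k.* z → ¬ (a k.≈ b) → z k.≈ k.0#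
  eigenvalues-distinct {a} {b} {z} eq a≉b with z ≟ k.0#
  ... | yes z≈0 = z≈0
  ... | no  z≉0 = ⊥-elim (a≉b (domain-cancelʳ (Field.commutativeRing k) domainₖ z≉0 eq))

  -- The j-th coordinate is multiplied by ζ^j under σ, and ζ^j ≠ 1 for 0 < j < ℓ.
  σ-fixed : ∀ x → _≅_.⟦ σ ⟧ x ≈ x → x ≈ embed (coordinate x 0ℓ)
  σ-fixed x σx≈x = trans (single-coordinate 0ℓ λ j j≢0 → eigenvalues-distinct
      (k.trans (k.trans (k.sym (σ-coordinate x j)) (coordinate-cong σx≈x j)) (k.sym (k.*-identityˡ _)))
      (ζ^i≉1 (toℕ j) (≢0ℓ⇒0< j≢0) (Fin.toℕ<n j)))
    (trans (*-congˡ vector-0ℓ) (*-identityʳ _))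

  isGalois : FixedFieldIsBase K
  isGalois x fixed = coordinate x 0ℓ , σ-fixed x (fixed σ)

  σ^_ : ℕ → K ≅ K
  σ^ n = n timesᴳ σ
    where open RawMonoidDefinitions (Group.rawMonoid (automorphismGroup K)) using () renaming (_×_ to _timesᴳ_)

  σ^n-y : ∀ n → _≅_.⟦ σ^ n ⟧ y ≈ embed (ζ k.^ n) * y
  σ^n-y zero    = sym (trans (*-congʳ 1#-homo) (*-identityˡ y))
  σ^n-y (suc n) = begin
    σ.⟦ _≅_.⟦ σ^ n ⟧ y ⟧  ≈⟨ σ.⟦⟧-cong (σ^n-y n) ⟩
    σ.⟦ embed (ζ k.^ n) * y ⟧  ≈⟨ trans (σ.*-homo _ _) (*-cong (σ.fixes-k _) σy≈ζy) ⟩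
    embed (ζ k.^ n) * (embed ζ * y)  ≈⟨ solve 3 (λ p z y → p :* (z :* y) := (z :* p) :* y) refl _ _ _ ⟩
    (embed ζ * embed (ζ k.^ n)) * y  ≈⟨ *-congʳ (*-homo ζ (ζ k.^ n)) ⟨
    embed (ζ k.^ suc n) * y  ∎
    where
    open SetoidReasoning setoid
    module σ = _≅_ σ

  σ^n-coordinate : ∀ n x i → coordinate (_≅_.⟦ σ^ n ⟧ x) i k.≈ (ζ k.^ n) k.^ toℕ i k.* coordinate x i
  σ^n-coordinate n = automorphism-coordinate (σ^ n) (ζ k.^ n) (σ^n-y n)

  -- An automorphism τ sends y to another ℓ-th root of D, that is, to ζ^n y for some n. So does the
  -- n-th power of σ, and the image of y determines all coordinates.
  isCyclic : IsCyclicGroup (automorphismGroup K)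
  isCyclic = σ , λ τ → ℤ.+ proj₁ (image τ) , λ x → coordinate-injective λ j → k.trans
      (automorphism-coordinate τ (ζ k.^ proj₁ (image τ)) (proj₂ (image τ)) x j)
      (k.sym (σ^n-coordinate (proj₁ (image τ)) x j))
    where
    image : ∀ τ → ∃ λ n → _≅_.⟦ τ ⟧ y ≈ embed (ζ k.^ n) * y
    image τ = ratio-is-root (begin
      τ.⟦ y ⟧ ^ ℓ  ≈⟨ hom-^ (Extension.ring K) (Extension.ring K) τ.isRingHomomorphism y ℓ ⟨
      τ.⟦ y ^ ℓ ⟧  ≈⟨ τ.⟦⟧-cong y^ℓ≈D ⟩
      τ.⟦ embed D ⟧  ≈⟨ τ.fixes-k D ⟩
      embed D  ≈⟨ y^ℓ≈D ⟨
      y ^ ℓ  ∎) y≉0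
      where
      open SetoidReasoning setoid
      module τ = _≅_ τ

  -- As σ fixes w^ℓ, it multiplies w by a power of ζ. So w is an eigenvector of σ; the eigenvalues
  -- ζ^j on the basis are distinct, so w has a single nonzero coordinate and is a monomial in y.
  power-of-base : ∀ {w b} → w ^ ℓ ≈ embed b → ¬ (b k.≈ k.0#) → ∃₂ λ a n → b k.≈ a k.^ ℓ k.* D k.^ n
  power-of-base {w} {b} w^ℓ≈b b≉0 with Fin.any? (λ j → ¬? (coordinate w j ≟ k.0#))
  ... | no all-zero = ⊥-elim (b≉0 (embed≈0⇒≈0 (trans (sym w^ℓ≈b) (trans (^-congˡ ℓ w≈0) (0^ 0<ℓ)))))
    where
    w≈0 : w ≈ 0#
    w≈0 = trans (spanning w) (sum-0 {ℓ} λ j → trans (*-congʳ (trans (⟦⟧-cong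
      (decidable-stable (coordinate w j ≟ k.0#) λ w≉0 → all-zero (j , w≉0))) 0#-homo)) (zeroˡ _))
  ... | yes (i , wᵢ≉0) = coordinate w i , toℕ i , embed-injective (begin
      embed b  ≈⟨ w^ℓ≈b ⟨
      w ^ ℓ  ≈⟨ ^-congˡ ℓ (single-coordinate i others) ⟩
      (embed (coordinate w i) * vector i) ^ ℓ  ≈⟨ ^-distrib-* _ _ ℓ ⟩
      embed (coordinate w i) ^ ℓ * vector i ^ ℓ  ≈⟨ *-cong (sym (embed-^ _ ℓ)) (begin
        vector i ^ ℓ  ≈⟨ ^-congˡ ℓ (vector≈ i) ⟩
        (y ^ toℕ i) ^ ℓ  ≈⟨ ^-comm y (toℕ i) ℓ ⟩
        (y ^ ℓ) ^ toℕ i  ≈⟨ ^-congˡ (toℕ i) y^ℓ≈D ⟩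
        embed D ^ toℕ i  ≈⟨ embed-^ D (toℕ i) ⟨
        embed (D k.^ toℕ i)  ∎) ⟩
      embed (coordinate w i k.^ ℓ) * embed (D k.^ toℕ i)  ≈⟨ *-homo _ _ ⟨
      embed (coordinate w i k.^ ℓ k.* D k.^ toℕ i)  ∎)
    where
    open SetoidReasoning setoid
    module σ = _≅_ σ
    w≉0 : ¬ (w ≈ 0#)
    w≉0 w≈0 = b≉0 (embed≈0⇒≈0 (trans (sym w^ℓ≈b) (trans (^-congˡ ℓ w≈0) (0^ 0<ℓ))))
    σw : ∃ λ n → σ.⟦ w ⟧ ≈ embed (ζ k.^ n) * w
    σw = ratio-is-root (begin
      σ.⟦ w ⟧ ^ ℓ  ≈⟨ hom-^ (Extension.ring K) (Extension.ring K) σ.isRingHomomorphism w ℓ ⟨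
      σ.⟦ w ^ ℓ ⟧  ≈⟨ σ.⟦⟧-cong w^ℓ≈b ⟩
      σ.⟦ embed b ⟧  ≈⟨ σ.fixes-k b ⟩
      embed b  ≈⟨ w^ℓ≈b ⟨
      w ^ ℓ  ∎) w≉0
    eigenvalue : ∀ j → ζ k.^ toℕ j k.* coordinate w j k.≈ ζ k.^ proj₁ σw k.* coordinate w j
    eigenvalue j = k.trans (k.sym (σ-coordinate w j))
      (k.trans (coordinate-cong (proj₂ σw) j) (coordinate-* (ζ k.^ proj₁ σw) w j))
    eigenvalue-i : ζ k.^ toℕ i k.≈ ζ k.^ proj₁ σw
    eigenvalue-i = domain-cancelʳ (Field.commutativeRing k) domainₖ wᵢ≉0 (eigenvalue i)
    others : ∀ j → j ≢ i → coordinate w j k.≈ k.0#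
    others j j≢i = eigenvalues-distinct (eigenvalue j) λ eq → j≢i (Fin.toℕ-injective
      (exponents-injective (Fin.toℕ<n j) (Fin.toℕ<n i) (s≤s z≤n) 1<ℓ
        (k.trans (k.*-identityʳ _) (k.trans (k.trans eq (k.sym eigenvalue-i)) (k.sym (k.*-identityʳ _))))))

  -- Division with remainder turns y^n into D^(n / ℓ) times the basis vector of index n % ℓ; the
  -- hypothesis says that this index is not i.
  coordinate-y^ : ∀ n i → (∀ q → n ≢ toℕ i ℕ.+ q ℕ.* ℓ) → coordinate (y ^ n) i k.≈ k.0#
  coordinate-y^ n i n≢ = k.trans (coordinate-cong y^n≈ i) (k.trans (coordinate-* _ _ i)
    (k.trans (k.*-congˡ (k.trans (coordinate-vector r i) (k.reflexive (δ-≢ r≢i)))) (k.zeroʳ _)))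
    where
    instance
      ℓ-nonZero : ℕ.NonZero ℓ
      ℓ-nonZero = ℕ.>-nonZero 0<ℓ
    r : Fin ℓ
    r = fromℕ< (ℕ.m%n<n n ℓ)
    toℕ-r : toℕ r ≡ n ℕ.% ℓ
    toℕ-r = Fin.toℕ-fromℕ< (ℕ.m%n<n n ℓ)
    r≢i : r ≢ i
    r≢i r≡i = n≢ (n ℕ./ ℓ) (≡.trans (ℕ.m≡m%n+[m/n]*n n ℓ)
      (≡.cong (ℕ._+ (n ℕ./ ℓ) ℕ.* ℓ) (≡.trans (≡.sym toℕ-r) (≡.cong toℕ r≡i))))
    y^n≈ : y ^ n ≈ embed (D k.^ (n ℕ./ ℓ)) * vector r
    y^n≈ = begin
      y ^ n  ≡⟨ ≡.cong (y ^_) (≡.trans (ℕ.m≡m%n+[m/n]*n n ℓ) (ℕ.+-comm (n ℕ.% ℓ) _)) ⟩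
      y ^ ((n ℕ./ ℓ) ℕ.* ℓ ℕ.+ n ℕ.% ℓ)  ≈⟨ ^-homo-* y ((n ℕ./ ℓ) ℕ.* ℓ) (n ℕ.% ℓ) ⟩
      y ^ ((n ℕ./ ℓ) ℕ.* ℓ) * y ^ (n ℕ.% ℓ)  ≈⟨ *-cong (trans (^-congʳ y (ℕ.*-comm (n ℕ./ ℓ) ℓ)) (sym (^-assocʳ y ℓ (n ℕ./ ℓ))))
                                                          (trans (^-congʳ y (≡.sym toℕ-r)) (sym (vector≈ r))) ⟩
      (y ^ ℓ) ^ (n ℕ./ ℓ) * vector r  ≈⟨ *-congʳ (trans (^-congˡ (n ℕ./ ℓ) y^ℓ≈D) (sym (embed-^ D (n ℕ./ ℓ)))) ⟩
      embed (D k.^ (n ℕ./ ℓ)) * vector r  ∎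
      where open SetoidReasoning setoid

  not-multiple : ∀ {m} → 0 < m → m < ℓ ℕ.+ ℓ → m ≢ ℓ → ∀ q → m ≢ q ℕ.* ℓ
  not-multiple 0<m m<2ℓ m≢ℓ zero          m≡ = ℕ.<⇒≢ 0<m (≡.sym m≡)
  not-multiple 0<m m<2ℓ m≢ℓ (suc zero)    m≡ = m≢ℓ (≡.trans m≡ (ℕ.+-identityʳ ℓ))
  not-multiple 0<m m<2ℓ m≢ℓ (suc (suc q)) m≡ = ℕ.<⇒≱ m<2ℓ (≡.subst (ℓ ℕ.+ ℓ ≤_) (≡.sym m≡)
    (ℕ.+-monoʳ-≤ ℓ (ℕ.m≤m+n ℓ (q ℕ.* ℓ))))

  -- Multiplication by y^m shifts the basis cyclically up to powers of D, so there is no diagonal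
  -- entry unless ℓ divides m. The bound 2 ℓ covers all exponents i + j of the discriminant matrix
  -- and leaves ℓ as the only positive multiple.
  trace-0 : ∀ {x m} → x ≈ y ^ m → 0 < m → m < ℓ ℕ.+ ℓ → m ≢ ℓ → trace x k.≈ k.0#
  trace-0 {x} {m} x≈ 0<m m<2ℓ m≢ℓ = kT.sum-0 {ℓ} λ i → k.trans
    (coordinate-cong (trans (*-cong x≈ (vector≈ i)) (sym (^-homo-* y m (toℕ i)))) i)
    (coordinate-y^ (m ℕ.+ toℕ i) i λ q eq → not-multiple 0<m m<2ℓ m≢ℓ q (ℕ.+-cancelʳ-≡ (toℕ i) m (q ℕ.* ℓ) (≡.trans eq (ℕ.+-comm (toℕ i) _))))

  trace-scalar : ∀ {x} b → x ≈ embed b → trace x k.≈ (ℓ kT.times k.1#) k.* b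
  trace-scalar {x} b x≈b = k.trans (kT.sum-cong-≋ {ℓ} λ i → k.trans (coordinate-cong (*-congʳ x≈b) i)
      (k.trans (coordinate-* b (vector i) i) (k.trans (k.*-congˡ (k.trans (coordinate-vector i i) (k.reflexive (δ-refl i))))
        (k.trans (k.*-identityʳ b) (k.sym (k.*-identityˡ b))))))
    (k.trans (k.sym (kT.*-distribʳ-sum {ℓ} b (λ _ → k.1#))) (k.*-congʳ (kT.sum-replicate ℓ)))

  coordinate-0ℓ-y^ : ∀ {n} → 0 < n → n < ℓ ℕ.+ ℓ → n ≢ ℓ → coordinate (y ^ n) 0ℓ k.≈ k.0#
  coordinate-0ℓ-y^ 0<n n<2ℓ n≢ℓ = coordinate-y^ _ 0ℓ λ q eq →
    not-multiple 0<n n<2ℓ n≢ℓ q (≡.trans eq (≡.cong (ℕ._+ q ℕ.* ℓ) toℕ-0ℓ))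

  module _ (L : k.Carrier) (L≈ℓ : L k.≈ ℓ kT.times k.1#) where
    -- The traces of y^(i+j) form a matrix with ℓ in the corner and zeros in the rest of the first
    -- row. The remaining minor has ℓ D where i + j = ℓ and zeros elsewhere. The name `L` for ℓ
    -- allows it to be the image of a polynomial.
    power-basis-discriminant : ∀ (x : Fin ℓ → Carrier) → (∀ i → x i ≈ y ^ toℕ i) →
      ∃ λ m → discriminant x k.≈ kT.signed-power L D m (ℓ ∸ 1)
    power-basis-discriminant x x≈ = go ℓ ≡.refl (λ i j → trace (x i * x j)) corner first-row on off
      where
      open Determinant (Field.commutativeRing k)
      exponent : Fin ℓ → Fin ℓ → ℕ
      exponent i j = toℕ i ℕ.+ toℕ j
      entry : ∀ i j → x i * x j ≈ y ^ exponent i j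
      entry i j = trans (*-cong (x≈ i) (x≈ j)) (sym (^-homo-* y (toℕ i) (toℕ j)))
      bound : ∀ i j → exponent i j < ℓ ℕ.+ ℓ
      bound i j = ℕ.+-mono-< (Fin.toℕ<n i) (Fin.toℕ<n j)
      corner : ∀ i j → exponent i j ≡ 0 → trace (x i * x j) k.≈ L
      corner i j eq = k.trans (trace-scalar k.1# (trans (entry i j) (trans (^-congʳ y eq) (sym 1#-homo))))
        (k.trans (k.*-identityʳ _) (k.sym L≈ℓ))
      first-row : ∀ i j → toℕ i ≡ 0 → 0 < toℕ j → trace (x i * x j) k.≈ k.0#
      first-row i j i≡0 0<j = trace-0 (entry i j) (ℕ.<-≤-trans 0<j (ℕ.m≤n+m (toℕ j) (toℕ i))) (bound i j)
        (ℕ.<⇒≢ (≡.subst (λ n → n ℕ.+ toℕ j < ℓ) (≡.sym i≡0) (Fin.toℕ<n j)))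
      on : ∀ i j → exponent i j ≡ ℓ → trace (x i * x j) k.≈ L k.* D
      on i j eq = k.trans (trace-scalar D (trans (entry i j) (trans (^-congʳ y eq) y^ℓ≈D))) (k.*-congʳ (k.sym L≈ℓ))
      off : ∀ i j → 0 < exponent i j → exponent i j ≢ ℓ → trace (x i * x j) k.≈ k.0#
      off i j 0<e e≢ℓ = trace-0 (entry i j) 0<e (bound i j) e≢ℓ
      -- The size ℓ becomes a variable, to be matched with a successor. In the minor both indices
      -- are shifted by one, which turns i + j = ℓ into the antidiagonal condition for size ℓ - 1.
      go : ∀ m → m ≡ ℓ → (M : Fin m → Fin m → k.Carrier) →
        (∀ i j → toℕ i ℕ.+ toℕ j ≡ 0 → M i j k.≈ L) → (∀ i j → toℕ i ≡ 0 → 0 < toℕ j → M i j k.≈ k.0#) →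
        (∀ i j → toℕ i ℕ.+ toℕ j ≡ m → M i j k.≈ L k.* D) →
        (∀ i j → 0 < toℕ i ℕ.+ toℕ j → toℕ i ℕ.+ toℕ j ≢ m → M i j k.≈ k.0#) →
        ∃ λ s → det (Field.commutativeRing k) M k.≈ kT.signed-power L D s (m ∸ 1)
      go zero    eq M _ _ _ _ = ⊥-elim (ℕ.<⇒≢ 0<ℓ eq)
      go (suc m) eq M corner first-row on off = proj₁ minor , k.trans
        (corner-det M λ j → first-row zero (suc j) ≡.refl (s≤s z≤n))
        (k.*-cong (corner zero zero ≡.refl) (proj₂ minor))
        where
        minor : ∃ λ s → det (Field.commutativeRing k) (λ i j → M (suc i) (suc j)) k.≈ (k.- k.1#) k.^ s k.* (L k.* D) k.^ m
        minor = antidiagonal-det m (L k.* D) (λ i j → M (suc i) (suc j))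
          (λ i j e → on (suc i) (suc j) (≡.cong suc (≡.trans (ℕ.+-suc (toℕ i) (toℕ j)) e)))
          (λ i j e → off (suc i) (suc j) (s≤s z≤n) λ e′ → e (≡.trans (≡.sym (ℕ.+-suc (toℕ i) (toℕ j))) (ℕ.suc-injective e′)))

-- The image of y is an element of K′ whose ℓ-th power is D, hence a monomial in the generator of
-- K′.
isomorphic-kummer : ∀ {c e c₁ e₁ c₂ e₂} (k : Field c e) (_≟_ : Decidable (Field._≈_ k)) {ℓ} (ℓ-prime : Prime ℓ)
  (ω : RootOfUnity (Field.commutativeRing k) ℓ) {D D′ : Field.Carrier k} →
  let module k = CommRing (Field.commutativeRing k) in
  (D≉0 : ¬ (D k.≈ k.0#)) (D′≉0 : ¬ (D′ k.≈ k.0#))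
  (K : Extension k c₁ e₁) (B : Basis K ℓ) (K′ : Extension k c₂ e₂) (B′ : Basis K′ ℓ) →
  IsKummer ω D K B → IsKummer ω D′ K′ B′ → K ≅ K′ → ∃₂ λ a n → D k.≈ a k.^ ℓ k.* D′ k.^ n
isomorphic-kummer k _≟_ {ℓ} ℓ-prime ω {D} D≉0 D′≉0 K B K′ B′ kummer kummer′ φ =
  KummerTheory.power-of-base k _≟_ ℓ-prime ω D′≉0 K′ B′ kummer′ {φ.⟦ y ⟧} {D}
    (K′.trans (K′.sym (hom-^ (Extension.ring K) (Extension.ring K′) φ.isRingHomomorphism y ℓ))
      (K′.trans (φ.⟦⟧-cong y^ℓ≈D) (φ.fixes-k D)))
    D≉0
  where
  module φ = _≅_ φ
  module K′ = Extension K′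
  open IsKummer kummer

-- Integral elements

module IntegralElements {a ℓ b ℓ′} (A : CommutativeRing a ℓ) (B : CommutativeRing b ℓ′)
  (f : CommutativeRing.Carrier A → CommutativeRing.Carrier B) (f-isHom : IsHom A B f) where
  open CommRing B
  open RingTheory B
  open IntegralClosure A B f f-isHom using (IsIntegral; integral-resp; integral-image; integral-+; integral-*)
  open RingMorphisms.IsRingHomomorphism f-isHom
  open IntegerSolver B
  private
    module A = CommRing A
    module AT = RingTheory A

  integral-1 : IsIntegral 1#
  integral-1 = integral-resp 1#-homo (integral-image A.1#)

  integral-^ : ∀ {x} n → IsIntegral x → IsIntegral (x ^ n)
  integral-^ zero    ix = integral-1
  integral-^ (suc n) ix = integral-* ix (integral-^ n ix)

  integral-sum : ∀ {n} {v : Fin n → Carrier} → (∀ i → IsIntegral (v i)) → IsIntegral (sum v)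
  integral-sum {zero}  iv = integral-resp 0#-homo (integral-image A.0#)
  integral-sum {suc n} iv = integral-+ (iv zero) (integral-sum (iv ∘ suc))

  root-integral : ∀ {x n c} → 0 < n → x ^ n ≈ f c → IsIntegral x
  root-integral {x} {suc n} {c} _ x^n≈c = suc n , c′ , (begin
    x ^ suc n + sum (λ i → f (c′ i) * x ^ toℕ i)
      ≈⟨ +-cong x^n≈c (sum-single {suc n} (λ i → f (c′ i) * x ^ toℕ i) zero
           λ { zero 0≢0 → ⊥-elim (0≢0 ≡.refl) ; (suc i) _ → trans (*-congʳ 0#-homo) (zeroˡ _) }) ⟩
    f c + f (A.- c) * 1#
      ≈⟨ trans (+-congˡ (trans (*-identityʳ _) (-‿homo c))) (-‿inverseʳ _) ⟩
    0# ∎)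
    where
    open SetoidReasoning setoid
    c′ : Fin (suc n) → A.Carrier
    c′ zero    = A.- c
    c′ (suc i) = A.0#

  image-integral : ∀ (τ : Carrier → Carrier) → IsHom B B τ → (∀ c → τ (f c) ≈ f c) →
                   ∀ {x} → IsIntegral x → IsIntegral (τ x)
  image-integral τ τ-isHom fixes {x} (n , c , eq) = n , c , (begin
    τ x ^ n + sum (λ i → f (c i) * τ x ^ toℕ i)
      ≈⟨ +-cong (sym (hom-^ B B τ-isHom x n)) (sum-cong-≋ {n} λ i →
           trans (*-cong (sym (fixes (c i))) (sym (hom-^ B B τ-isHom x (toℕ i)))) (sym (τ.*-homo _ _))) ⟩
    τ (x ^ n) + sum (λ i → τ (f (c i) * x ^ toℕ i))
      ≈⟨ +-congˡ (hom-sum B B τ-isHom {n} (λ i → f (c i) * x ^ toℕ i)) ⟨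
    τ (x ^ n) + τ (sum (λ i → f (c i) * x ^ toℕ i))
      ≈⟨ τ.+-homo _ _ ⟨
    τ (x ^ n + sum (λ i → f (c i) * x ^ toℕ i))
      ≈⟨ trans (τ.⟦⟧-cong eq) τ.0#-homo ⟩
    0# ∎)
    where
    open SetoidReasoning setoid
    module τ = RingMorphisms.IsRingHomomorphism τ-isHom

  -- The rational root theorem: multiplied by q^n, the integral equation of x = p / q becomes p^n
  -- plus terms divisible by q. So q divides p^n, to which it is comaximal.
  denominator-unit : (∀ {r} → f r ≈ 0# → r A.≈ A.0#) → ∀ {x p q} → IsIntegral x →
                     f q * x ≈ f p → AT.Comaximal p q → q A.∣ A.1#
  denominator-unit f-injective {x} {p} {q} (n , c , eq) qx≈p pq = AT.euclid
    (AT.comaximal-sym (AT.comaximal-^ n pq))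
    (AT.∣-respʳ (A.sym (A.*-identityʳ _)) q∣p^n)
    where
    open SetoidReasoning setoid
    clear : ∀ i → i ≤ n → f q ^ n * x ^ i ≈ f (q A.^ (n ∸ i) A.* p A.^ i)
    clear i i≤n = begin
      f q ^ n * x ^ i  ≈⟨ *-congʳ (^-congʳ (f q) (≡.sym (ℕ.m∸n+n≡m i≤n))) ⟩
      f q ^ (n ∸ i ℕ.+ i) * x ^ i  ≈⟨ *-congʳ (^-homo-* (f q) (n ∸ i) i) ⟩
      (f q ^ (n ∸ i) * f q ^ i) * x ^ i  ≈⟨ trans (*-assoc _ _ _) (*-congˡ (sym (^-distrib-* (f q) x i))) ⟩
      f q ^ (n ∸ i) * (f q * x) ^ i  ≈⟨ *-cong (sym (hom-^ A B f-isHom q (n ∸ i)))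
                                                (trans (^-congˡ i qx≈p) (sym (hom-^ A B f-isHom p i))) ⟩
      f (q A.^ (n ∸ i)) * f (p A.^ i)  ≈⟨ *-homo _ _ ⟨
      f (q A.^ (n ∸ i) A.* p A.^ i)  ∎
    term : Fin n → A.Carrier
    term i = c i A.* (q A.^ (n ∸ toℕ i) A.* p A.^ toℕ i)
    relation : p A.^ n A.+ A.sum term A.≈ A.0#
    relation = f-injective (begin
      f (p A.^ n A.+ A.sum term)
        ≈⟨ trans (+-homo _ _) (+-cong p^n (hom-sum A B f-isHom {n} term)) ⟩
      f q ^ n * x ^ n + sum (λ i → f (term i))
        ≈⟨ +-congˡ (trans (sum-cong-≋ {n} λ i → trans (*-homo (c i) _) (trans (*-congˡ (sym (clear (toℕ i) (ℕ.<⇒≤ (Fin.toℕ<n i)))))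
             (solve 3 (λ c q x → c :* (q :* x) := q :* (c :* x)) refl (f (c i)) (f q ^ n) (x ^ toℕ i))))
             (sym (*-distribˡ-sum {n} (f q ^ n) λ i → f (c i) * x ^ toℕ i))) ⟩
      f q ^ n * x ^ n + f q ^ n * sum (λ i → f (c i) * x ^ toℕ i)
        ≈⟨ distribˡ _ _ _ ⟨
      f q ^ n * (x ^ n + sum (λ i → f (c i) * x ^ toℕ i))
        ≈⟨ trans (*-congˡ eq) (zeroʳ _) ⟩
      0# ∎)
      where
      p^n : f (p A.^ n) ≈ f q ^ n * x ^ n
      p^n = sym (trans (clear n ℕ.≤-refl) (⟦⟧-cong (A.trans
        (A.*-congʳ (AT.^-congʳ q (ℕ.n∸n≡0 n))) (A.*-identityˡ _))))
    q∣term : ∀ i → q A.∣ term i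
    q∣term i = AT.∣-*ˡ (c i) (AT.∣-*ʳ (p A.^ toℕ i) (AT.∣-trans (AT.∣-respʳ (A.sym (A.*-identityʳ q)) AT.∣-refl)
      (AT.^-mono-∣ q {1} {n ∸ toℕ i} (ℕ.m<n⇒0<n∸m (Fin.toℕ<n i)))))
    q∣p^n : q A.∣ p A.^ n
    q∣p^n = AT.∣-respʳ (AT.x+y≈0⇒-y≈x relation) (AT.∣-neg (AT.∣-sum {n} q∣term))

-- The quotient modulo g: eigenspaces, size, zero divisors

-- In Q every element acts on each eigenspace of Y as the image of an element of A.
module EigenspaceFermat {a b c d} (A : CommutativeRing a b) (Q : CommutativeRing c d)
  {φ : CommutativeRing.Carrier A → CommutativeRing.Carrier Q} (φ-isHom : IsHom A Q φ)
  {ℓ} (0<ℓ : 0 < ℓ) (ω : RootOfUnity A ℓ) (M : ℕ)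
  (fermat : ∀ r → CommutativeRing._≈_ Q (CommRing._^_ Q (φ r) M) (φ r)) where
  open CommRing Q
  open RingTheory Q
  open IntegerSolver Q
  open SetoidReasoning setoid
  private
    module A = CommRing A
    ωQ : RootOfUnity Q ℓ
    ωQ = mapRootOfUnity A Q φ-isHom ω
    module ω = RootOfUnity ω
  open RootOfUnity ωQ
  open RootsOfUnity Q ωQ
  open RingMorphisms.IsRingHomomorphism φ-isHom

  module _ {Y} (Y^ℓ≈1 : Y ^ ℓ ≈ 1#) (w : Fin ℓ → A.Carrier) where
    private
      x : Carrier
      x = sum λ i → φ (w i) * Y ^ toℕ i
      E : Fin ℓ → Carrier
      E j = geometric (ζ ^ toℕ j * Y) ℓ
      -- The polynomial with coefficients w, evaluated at the eigenvalue ζ^(ℓ-j) of Y on the j-th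
      -- eigenspace.
      value : Fin ℓ → A.Carrier
      value j = A.sum {ℓ} λ i → w i A.* (ω.ζ A.^ (ℓ ∸ toℕ j)) A.^ toℕ i

      Y^i*E : ∀ j i → Y ^ i * E j ≈ (ζ ^ (ℓ ∸ toℕ j)) ^ i * E j
      Y^i*E j zero    = refl
      Y^i*E j (suc i) = begin
        (Y * Y ^ i) * E j  ≈⟨ *-assoc _ _ _ ⟩
        Y * (Y ^ i * E j)  ≈⟨ *-congˡ (Y^i*E j i) ⟩
        Y * ((ζ ^ (ℓ ∸ toℕ j)) ^ i * E j)  ≈⟨ solve 3 (λ y z e → y :* (z :* e) := z :* (y :* e)) refl Y _ (E j) ⟩
        (ζ ^ (ℓ ∸ toℕ j)) ^ i * (Y * E j)  ≈⟨ *-congˡ (eigen j Y Y^ℓ≈1) ⟩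
        (ζ ^ (ℓ ∸ toℕ j)) ^ i * (ζ ^ (ℓ ∸ toℕ j) * E j)  ≈⟨ solve 3 (λ z p e → p :* (z :* e) := (z :* p) :* e) refl (ζ ^ (ℓ ∸ toℕ j)) _ (E j) ⟩
        (ζ ^ (ℓ ∸ toℕ j)) ^ suc i * E j  ∎

      x*E : ∀ j → x * E j ≈ φ (value j) * E j
      x*E j = begin
        x * E j
          ≈⟨ *-distribʳ-sum {ℓ} (E j) (λ i → φ (w i) * Y ^ toℕ i) ⟩
        sum {ℓ} (λ i → (φ (w i) * Y ^ toℕ i) * E j)
          ≈⟨ sum-cong-≋ {ℓ} (λ i → trans (*-assoc _ _ _) (trans (*-congˡ (Y^i*E j (toℕ i))) (trans (sym (*-assoc _ _ _))
               (*-congʳ (trans (*-congˡ (power j (toℕ i))) (sym (*-homo _ _))))))) ⟩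
        sum {ℓ} (λ i → φ (w i A.* (ω.ζ A.^ (ℓ ∸ toℕ j)) A.^ toℕ i) * E j)
          ≈⟨ *-distribʳ-sum {ℓ} (E j) (λ i → φ (w i A.* (ω.ζ A.^ (ℓ ∸ toℕ j)) A.^ toℕ i)) ⟨
        sum {ℓ} (λ i → φ (w i A.* (ω.ζ A.^ (ℓ ∸ toℕ j)) A.^ toℕ i)) * E j
          ≈⟨ *-congʳ (hom-sum A Q φ-isHom {ℓ} λ i → w i A.* (ω.ζ A.^ (ℓ ∸ toℕ j)) A.^ toℕ i) ⟨
        φ (value j) * E j ∎
        where
        power : ∀ j i → (ζ ^ (ℓ ∸ toℕ {ℓ} j)) ^ i ≈ φ ((ω.ζ A.^ (ℓ ∸ toℕ j)) A.^ i)
        power j i = sym (trans (hom-^ A Q φ-isHom (ω.ζ A.^ (ℓ ∸ toℕ j)) i) (^-congˡ i (hom-^ A Q φ-isHom ω.ζ (ℓ ∸ toℕ j))))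

      x^n*E : ∀ j n → x ^ n * E j ≈ φ (value j) ^ n * E j
      x^n*E j zero    = refl
      x^n*E j (suc n) = begin
        (x * x ^ n) * E j  ≈⟨ *-assoc _ _ _ ⟩
        x * (x ^ n * E j)  ≈⟨ *-congˡ (x^n*E j n) ⟩
        x * (φ (value j) ^ n * E j)  ≈⟨ solve 3 (λ y z e → y :* (z :* e) := z :* (y :* e)) refl x _ (E j) ⟩
        φ (value j) ^ n * (x * E j)  ≈⟨ *-congˡ (x*E j) ⟩
        φ (value j) ^ n * (φ (value j) * E j)  ≈⟨ solve 3 (λ z p e → p :* (z :* e) := (z :* p) :* e) refl (φ (value j)) _ (E j) ⟩
        φ (value j) ^ suc n * E j  ∎

      resolve : ∀ z → z * sum E ≈ sum (λ j → z * E j)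
      resolve z = *-distribˡ-sum {ℓ} z E

      cancel-ℓ : ∀ {u v} → u * sum E ≈ v * sum E → u ≈ v
      cancel-ℓ {u} {v} eq = begin
        u  ≈⟨ unfold u ⟩
        ℓ⁻¹ * (u * sum E)  ≈⟨ *-congˡ eq ⟩
        ℓ⁻¹ * (v * sum E)  ≈⟨ unfold v ⟨
        v  ∎
        where
        unfold : ∀ u → u ≈ ℓ⁻¹ * (u * sum E)
        unfold u = begin
          u  ≈⟨ trans (*-congˡ ℓ⁻¹*ℓ≈1) (*-identityʳ u) ⟨
          u * (ℓ⁻¹ * (ℓ times 1#))  ≈⟨ *-congˡ (*-congˡ (resolution Y 0<ℓ)) ⟨
          u * (ℓ⁻¹ * sum E)  ≈⟨ solve 3 (λ u l s → u :* (l :* s) := l :* (u :* s)) refl u ℓ⁻¹ (sum E) ⟩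
          ℓ⁻¹ * (u * sum E)  ∎

    -- On each eigenspace x acts as an element of A, for which the identity is assumed. The
    -- identities add up because the projectors have the unit ℓ as their sum.
    combination-fermat : x ^ M ≈ x
    combination-fermat = cancel-ℓ (begin
      x ^ M * sum E  ≈⟨ resolve (x ^ M) ⟩
      sum (λ j → x ^ M * E j)  ≈⟨ sum-cong-≋ {ℓ} (λ j → trans (x^n*E j M) (trans (*-congʳ (fermat (value j))) (sym (x*E j)))) ⟩
      sum (λ j → x * E j)  ≈⟨ resolve x ⟨
      x * sum E  ∎)

-- 𝒪 lies between A[Y] and D⁻¹A[Y], where 1, Y, …, Y^(ℓ-1) are independent over
-- A: HasScaled x i r means that the i-th coefficient of D x is r.
record ScaledCoordinates {a b o o′} (A : CommutativeRing a b) (𝒪 : CommutativeRing o o′)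
  (ψ : CommutativeRing.Carrier A → CommutativeRing.Carrier 𝒪) (Y : CommutativeRing.Carrier 𝒪)
  (D : CommutativeRing.Carrier A) (ℓ : ℕ) s : Set (a ⊔ b ⊔ o ⊔ o′ ⊔ lsuc s) where
  private
    module A = CommRing A
    module 𝒪 = CommRing 𝒪
  element : (Fin ℓ → A.Carrier) → 𝒪.Carrier
  element w = 𝒪.sum {ℓ} λ i → ψ (w i) 𝒪.* Y 𝒪.^ toℕ i
  field
    HasScaled : 𝒪.Carrier → Fin ℓ → A.Carrier → Set s
    resp      : ∀ {x z i r t} → x 𝒪.≈ z → r A.≈ t → HasScaled x i r → HasScaled z i t
    unique    : ∀ {x i r t} → HasScaled x i r → HasScaled x i t → r A.≈ t
    injective : ∀ {x z} (r : Fin ℓ → A.Carrier) → (∀ i → HasScaled x i (r i)) → (∀ i → HasScaled z i (r i)) → x 𝒪.≈ z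
    exists    : ∀ x i → ∃ (HasScaled x i)
    minus     : ∀ {x z i r t} → HasScaled x i r → HasScaled z i t → HasScaled (x 𝒪.- z) i (r A.- t)
    multiple  : ∀ {x i r} c → HasScaled x i r → HasScaled (ψ c 𝒪.* x) i (c A.* r)
    ofElement : ∀ w i → HasScaled (element w) i (D A.* w i)

module OrderQuotient {a b o o′ s} (A : CommutativeRing a b) (𝒪 : CommutativeRing o o′) {ℓ} (1<ℓ : 1 < ℓ) (ω : RootOfUnity A ℓ)
  (ψ : CommutativeRing.Carrier A → CommutativeRing.Carrier 𝒪) (ψ-isHom : IsHom A 𝒪 ψ)
  {Y : CommutativeRing.Carrier 𝒪} {D : CommutativeRing.Carrier A} (coordinates : ScaledCoordinates A 𝒪 ψ Y D ℓ s)
  (Y^ℓ≈D : CommutativeRing._≈_ 𝒪 (CommRing._^_ 𝒪 Y ℓ) (ψ D)) where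
  private
    module A = CommRing A
    module AT = RingTheory A
    module 𝒪 = CommRing 𝒪
    module 𝒪T = RingTheory 𝒪
    module ψ = RingMorphisms.IsRingHomomorphism ψ-isHom
  open ScaledCoordinates coordinates
  open import Algebra.Definitions.RawMagma 𝒪.*-rawMagma using () renaming (_,_ to _,𝒪_)
  open import Algebra.Definitions.RawMagma A.*-rawMagma using () renaming (_,_ to _,A_)

  u : 𝒪.Carrier → Fin ℓ → A.Carrier
  u x i = proj₁ (exists x i)

  u-scaled : ∀ x i → HasScaled x i (u x i)
  u-scaled x i = proj₂ (exists x i)

  δ : Fin ℓ → Fin ℓ → A.Carrier
  δ i j with i Fin.≟ j
  ... | yes _ = A.1#
  ... | no  _ = A.0#

  δ-≢ : ∀ {i j} → i ≢ j → δ i j ≡ A.0#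
  δ-≢ {i} {j} i≢j with i Fin.≟ j
  ... | yes i≡j = ⊥-elim (i≢j i≡j)
  ... | no  _   = ≡.refl

  δ-refl : ∀ i → δ i i ≡ A.1#
  δ-refl i with i Fin.≟ i
  ... | yes _   = ≡.refl
  ... | no  i≢i = ⊥-elim (i≢i ≡.refl)

  element-δ : ∀ i → element (δ i) 𝒪.≈ Y 𝒪.^ toℕ i
  element-δ i = 𝒪.trans
    (𝒪T.sum-single {ℓ} (λ j → ψ (δ i j) 𝒪.* Y 𝒪.^ toℕ j) i λ j j≢i → 𝒪.trans
      (𝒪.*-congʳ (𝒪.trans (𝒪.reflexive (≡.cong ψ (δ-≢ (j≢i ∘ ≡.sym)))) ψ.0#-homo)) (𝒪.zeroˡ _))
    (𝒪.trans (𝒪.*-congʳ (𝒪.trans (𝒪.reflexive (≡.cong ψ (δ-refl i))) ψ.1#-homo)) (𝒪.*-identityˡ _))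

  Y^-scaled : ∀ i j → HasScaled (Y 𝒪.^ toℕ i) j (D A.* δ i j)
  Y^-scaled i j = resp (element-δ i) A.refl (ofElement (δ i) j)

  module _ {g h : A.Carrier} (D≈1+hg : D A.≈ A.1# A.+ h A.* g) (g∤1 : ¬ (g A.∣ A.1#))
           (γ : 𝒪.Carrier) (γ≈ψg : γ 𝒪.≈ ψ g) where
    Q : CommutativeRing _ _
    Q = quotientRing 𝒪 (principalIdeal 𝒪 γ)

    private
      module Q = CommRing Q
      module QT = RingTheory Q

    ψQ-isHom : IsHom A Q ψ
    ψQ-isHom = hom-quotient 𝒪 (principalIdeal 𝒪 γ) {A = A} ψ-isHom

    g∣Dr-r : ∀ r → g A.∣ (D A.* r A.- r)
    g∣Dr-r r = AT.∣-respʳ (AT.[1+x]*y-y D≈1+hg) (AT.∣-*ʳ r (AT.∣-*ˡ h AT.∣-refl))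

    g∣Dr⇒g∣r : ∀ r → g A.∣ D A.* r → g A.∣ r
    g∣Dr⇒g∣r r g∣Dr = AT.∣-respʳ (AT.x-[x-y]≈y (D A.* r) r) (AT.∣-- g∣Dr (g∣Dr-r r))

    -- If x = q γ, then the scaled coordinates of x are g times those of q.
    γ∣⇒g∣scaled : ∀ {x i r} → γ 𝒪.∣ x → HasScaled x i r → g A.∣ r
    γ∣⇒g∣scaled {x} {i} {r} (q ,𝒪 eq) scaled = u q i ,A A.trans (A.*-comm (u q i) g)
      (unique (resp g*q≈x A.refl (multiple g (u-scaled q i))) scaled)
      where
      g*q≈x : ψ g 𝒪.* q 𝒪.≈ x
      g*q≈x = 𝒪.trans (𝒪.*-comm (ψ g) q) (𝒪.trans (𝒪.*-congˡ (𝒪.sym γ≈ψg)) eq)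

    -- If the scaled coordinates of x are g w, then D x = g z for the element z of A[Y] with
    -- coefficients w. Since D = 1 + h g, this gives x = g (z - h x): the denominator D is harmless
    -- modulo g.
    g∣scaled⇒γ∣ : ∀ {x} (r : Fin ℓ → A.Carrier) → (∀ i → HasScaled x i (r i)) → (∀ i → g A.∣ r i) → γ 𝒪.∣ x
    g∣scaled⇒γ∣ {x} r scaled g∣r = element w 𝒪.- (ψ h 𝒪.* x) ,𝒪
      𝒪.trans (𝒪T.[z-h*x]*g (element w) (ψ h) x γ)
        (𝒪.trans (𝒪.+-cong (𝒪.+-congʳ g*z≈D*x) (𝒪.-‿cong (𝒪.*-congʳ ψD))) (𝒪T.[x+y]-x≈y (ψ D 𝒪.* x) x))
      where
      w : Fin ℓ → A.Carrier
      w i = AT.quotient (g∣r i)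
      ψD : 𝒪.1# 𝒪.+ ψ h 𝒪.* γ 𝒪.≈ ψ D
      ψD = 𝒪.sym (𝒪.trans (ψ.⟦⟧-cong D≈1+hg) (𝒪.trans (ψ.+-homo A.1# (h A.* g))
        (𝒪.+-cong ψ.1#-homo (𝒪.trans (ψ.*-homo h g) (𝒪.*-congˡ (𝒪.sym γ≈ψg))))))
      g*z≈D*x : γ 𝒪.* element w 𝒪.≈ ψ D 𝒪.* x
      g*z≈D*x = 𝒪.trans (𝒪.*-congʳ γ≈ψg) (injective (λ i → D A.* r i)
        (λ i → resp 𝒪.refl (AT.g*[D*w]≈D*r (AT.quotient*divisor (g∣r i))) (multiple g (ofElement w i)))
        (λ i → multiple D (scaled i)))

    ≈Q⇒scaled≈ : ∀ {x z i r t} → x Q.≈ z → HasScaled x i r → HasScaled z i t → g A.∣ (r A.- t)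
    ≈Q⇒scaled≈ {x} {z} eq scaled scaled′ = γ∣⇒g∣scaled {x 𝒪.- z} eq (minus scaled scaled′)

    scaled≈⇒≈Q : ∀ {x z} (r t : Fin ℓ → A.Carrier) → (∀ i → HasScaled x i (r i)) →
                 (∀ i → HasScaled z i (t i)) → (∀ i → g A.∣ (r i A.- t i)) → x Q.≈ z
    scaled≈⇒≈Q {x} {z} r t scaled scaled′ g∣ = g∣scaled⇒γ∣ {x 𝒪.- z} (λ i → r i A.- t i)
      (λ i → minus (scaled i) (scaled′ i)) g∣

    u-element-mod : ∀ w i → g A.∣ (u (element w) i A.- w i)
    u-element-mod w i = AT.∣-respʳ (A.+-congʳ (unique (ofElement w i) (u-scaled (element w) i))) (g∣Dr-r (w i))

    -- The coefficients `u x` belong to D x and not to x, but D is 1 modulo g. So `u` and `element`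
    -- are mutually inverse modulo g, which gives the size of the quotient.
    element-u : ∀ x → x Q.≈ element (u x)
    element-u x = scaled≈⇒≈Q {x} {element (u x)} (u x) (λ i → D A.* u x i) (u-scaled x) (ofElement (u x))
      λ i → AT.∣-respʳ (AT.-[x-y]≈y-x (D A.* u x i) (u x i)) (AT.∣-neg (g∣Dr-r (u x i)))

    Q-element : ∀ w → Q.sum {ℓ} (λ i → ψ (w i) Q.* Y Q.^ toℕ i) ≡ element w
    Q-element w = quotientRing-sum 𝒪 (principalIdeal 𝒪 γ) {ℓ}
      λ i → ≡.cong (ψ (w i) 𝒪.*_) (quotientRing-^ 𝒪 (principalIdeal 𝒪 γ) Y (toℕ i))

    Q-cardinality : ∀ {N} → HasCardinality (quotientRing A (principalIdeal A g)) N → HasCardinality Q (N ℕ.^ ℓ)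
    Q-cardinality |A/g|≡N = power-cardinality
      {S = CommutativeRing.setoid (quotientRing A (principalIdeal A g))} {T = Q.setoid} |A/g|≡N u element
      (λ {x} {z} eq i → ≈Q⇒scaled≈ {x} {z} eq (u-scaled x i) (u-scaled z i))
      (λ {x} {z} eq → scaled≈⇒≈Q {x} {z} (u x) (u z) (u-scaled x) (u-scaled z) eq)
      u-element-mod

    ψ-∣ : ∀ {r s} → g A.∣ (r A.- s) → ψ r Q.≈ ψ s
    ψ-∣ {r} {s} (q ,A eq) = ψ q ,𝒪 𝒪.trans (𝒪.trans (𝒪.*-congˡ γ≈ψg) (𝒪.sym (ψ.*-homo q g)))
      (𝒪.trans (ψ.⟦⟧-cong eq) (𝒪.trans (ψ.+-homo r (A.- s)) (𝒪.+-congˡ (ψ.-‿homo s))))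

    Y^ℓ≈1 : Y Q.^ ℓ Q.≈ Q.1#
    Y^ℓ≈1 = ≡.subst (Q._≈ Q.1#) (≡.sym (quotientRing-^ 𝒪 (principalIdeal 𝒪 γ) Y ℓ))
      (Q.trans {Y 𝒪.^ ℓ} {ψ D} {Q.1#} (≈⇒≈/ 𝒪 (principalIdeal 𝒪 γ) Y^ℓ≈D)
        (Q.trans {ψ D} {ψ A.1#} {Q.1#} (ψ-∣ (AT.∣-respʳ (A.+-congʳ (A.*-identityʳ D)) (g∣Dr-r A.1#)))
          (≈⇒≈/ 𝒪 (principalIdeal 𝒪 γ) ψ.1#-homo)))

    Q-fermat : ∀ M → (∀ r → g A.∣ (r A.^ M A.- r)) → ∀ x → x Q.^ M Q.≈ x
    Q-fermat M fermat x = Q.trans {x Q.^ M} {element (u x) Q.^ M} {x} (QT.^-congˡ M {x} {element (u x)} (element-u x))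
      (Q.trans {element (u x) Q.^ M} {element (u x)} {x}
        (≡.subst (λ z → z Q.^ M Q.≈ z) (Q-element (u x)) (combination-fermat {Y} Y^ℓ≈1 (u x)))
        (Q.sym {x} {element (u x)} (element-u x)))
      where
      open EigenspaceFermat A Q ψQ-isHom (ℕ.<-trans ℕ.0<1+n 1<ℓ) ω M
        (λ r → Q.trans {ψ r Q.^ M} {ψ (r A.^ M)} {ψ r} (Q.sym {ψ (r A.^ M)} {ψ r Q.^ M} (hom-^ A Q ψQ-isHom r M)) (ψ-∣ (fermat r)))

    -- Such a coordinate is 1 modulo g, so divisibility would make g a unit. It separates the two
    -- zero divisors from 0.
    not-∣-unit-coordinate : ∀ {x i} → HasScaled x i (D A.* A.1#) → ¬ (γ 𝒪.∣ x)
    not-∣-unit-coordinate {x} {i} scaled γ∣x = g∤1 (g∣Dr⇒g∣r A.1# (γ∣⇒g∣scaled {x} {i} γ∣x scaled))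

    -- Y - 1 and 1 + Y + ⋯ + Y^(ℓ-1) are zero divisors modulo g.
    Q-notField : ¬ IsField Q
    Q-notField (_ , inverse) = not-∣-unit-coordinate {S 𝒪.- 𝒪.0#} {0ℓ} S-scaled S≈0
      where
      S : 𝒪.Carrier
      S = QT.geometric Y ℓ
      0ℓ 1ℓ : Fin ℓ
      0ℓ = fromℕ< (ℕ.<-trans ℕ.0<1+n 1<ℓ)
      1ℓ = fromℕ< 1<ℓ
      toℕ-0ℓ : toℕ 0ℓ ≡ 0
      toℕ-0ℓ = Fin.toℕ-fromℕ< (ℕ.<-trans ℕ.0<1+n 1<ℓ)
      toℕ-1ℓ : toℕ 1ℓ ≡ 1
      toℕ-1ℓ = Fin.toℕ-fromℕ< 1<ℓ
      0ℓ≢1ℓ : 0ℓ ≢ 1ℓ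
      0ℓ≢1ℓ eq = ℕ.0≢1+n (≡.trans (≡.sym toℕ-0ℓ) (≡.trans (≡.cong toℕ eq) toℕ-1ℓ))
      Y-1-scaled : HasScaled ((Y 𝒪.- 𝒪.1#) 𝒪.- 𝒪.0#) 1ℓ (D A.* A.1#)
      Y-1-scaled = resp
        (𝒪.trans (𝒪.+-cong (𝒪.trans (𝒪T.^-congʳ Y toℕ-1ℓ) (𝒪.*-identityʳ Y)) (𝒪.-‿cong (𝒪T.^-congʳ Y toℕ-0ℓ)))
          (𝒪.sym (𝒪T.x-0≈x (Y 𝒪.- 𝒪.1#))))
        (A.trans (A.+-cong (A.*-congˡ (A.reflexive (δ-refl 1ℓ)))
            (A.-‿cong (A.trans (A.*-congˡ (A.reflexive (δ-≢ 0ℓ≢1ℓ))) (A.zeroʳ D))))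
          (AT.x-0≈x (D A.* A.1#)))
        (minus (Y^-scaled 1ℓ 1ℓ) (Y^-scaled 0ℓ 1ℓ))
      v : 𝒪.Carrier
      v = proj₁ (inverse (Y Q.- Q.1#) (not-∣-unit-coordinate {(Y 𝒪.- 𝒪.1#) 𝒪.- 𝒪.0#} {1ℓ} Y-1-scaled))
      S≈0 : S Q.≈ Q.0#
      S≈0 = QT.inverse-cancel {Y Q.- Q.1#} {v} {S}
        (proj₂ (inverse (Y Q.- Q.1#) (not-∣-unit-coordinate {(Y 𝒪.- 𝒪.1#) 𝒪.- 𝒪.0#} {1ℓ} Y-1-scaled)))
        (QT.[x-1]*y≈0 {Y} {S} (QT.geometric-fixed {Y} {ℓ} Y^ℓ≈1))
      S≈element : S 𝒪.≈ element (λ _ → A.1#)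
      S≈element = 𝒪.trans
        (𝒪.reflexive (quotientRing-sum 𝒪 (principalIdeal 𝒪 γ) {ℓ} {λ i → Y Q.^ toℕ i}
          λ i → quotientRing-^ 𝒪 (principalIdeal 𝒪 γ) Y (toℕ i)))
        (𝒪T.sum-cong-≋ {ℓ} λ i → 𝒪.sym (𝒪.trans (𝒪.*-congʳ ψ.1#-homo) (𝒪.*-identityˡ (Y 𝒪.^ toℕ i))))
      S-scaled : HasScaled (S 𝒪.- 𝒪.0#) 0ℓ (D A.* A.1#)
      S-scaled = resp (𝒪.trans (𝒪.sym S≈element) (𝒪.sym (𝒪T.x-0≈x S))) A.refl (ofElement (λ _ → A.1#) 0ℓ)

    isCarmichael : ∀ {N} → HasCardinality (quotientRing A (principalIdeal A g)) N →
                   (∀ r → g A.∣ (r A.^ (N ℕ.^ ℓ) A.- r)) → IsCarmichaelIdeal 𝒪 (principalIdeal 𝒪 γ)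
    isCarmichael {N} |A/g|≡N fermat = Q-notField , N ℕ.^ ℓ , Q-cardinality |A/g|≡N , Q-fermat (N ℕ.^ ℓ) fermat

-- The ring of integers of a Kummer extension

module KummerOrder {a b c e c′ e′ o o′} (A : CommutativeRing a b) (k : Field c e) (_≟_ : Decidable (Field._≈_ k))
  {ℓ} (ℓ-prime : Prime ℓ) (ωA : RootOfUnity A ℓ) (ω : RootOfUnity (Field.commutativeRing k) ℓ)
  (ι : CommutativeRing.Carrier A → Field.Carrier k) (ι-isHom : IsHom A (Field.commutativeRing k) ι)
  (ι≈0⇒≈0 : ∀ {r} → Field._≈_ k (ι r) (Field.0# k) → CommutativeRing._≈_ A r (CommutativeRing.0# A))
  {D : CommutativeRing.Carrier A} (D≉0 : ¬ (Field._≈_ k (ι D) (Field.0# k)))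
  (K : Extension k c′ e′) (B : Basis K ℓ)
  (isKummer : IsKummer ω (ι D) K B)
  (𝒪 : CommutativeRing o o′) (π : CommutativeRing.Carrier 𝒪 → Extension.Carrier K) (π-isHom : IsHom 𝒪 (Extension.ring K) π)
  (π-injective : ∀ {x z} → Extension._≈_ K (π x) (π z) → CommutativeRing._≈_ 𝒪 x z)
  (ψ : CommutativeRing.Carrier A → CommutativeRing.Carrier 𝒪) (ψ-isHom : IsHom A 𝒪 ψ)
  (π∘ψ : ∀ r → Extension._≈_ K (π (ψ r)) (Extension.embed K (ι r)))
  (Y : CommutativeRing.Carrier 𝒪) (πY : Extension._≈_ K (π Y) (IsKummer.y isKummer))
  (scaled-integral : ∀ x i → ∃ λ r → Field._≈_ k (ι r) (Field._*_ k (ι D) (Basis.coordinate B (π x) i))) where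
  private
    module A = CommRing A
    module AT = RingTheory A
    module k = CommRing (Field.commutativeRing k)
    module kT = RingTheory (Field.commutativeRing k)
    module ι = RingMorphisms.IsRingHomomorphism ι-isHom
    module 𝒪 = CommRing 𝒪
    module π = RingMorphisms.IsRingHomomorphism π-isHom
  open Extension K
  open Basis B
  open RingTheory (Extension.ring K)
  open KummerTheory k _≟_ ℓ-prime ω D≉0 K B isKummer
  open RootsOfUnityInField k _≟_ ℓ-prime ω using (1<ℓ; domainₖ)

  ι-injective : ∀ {r s} → ι r k.≈ ι s → r A.≈ s
  ι-injective {r} {s} eq = AT.x-y≈0⇒x≈y (ι≈0⇒≈0 (k.trans (ι.+-homo r (A.- s))
    (k.trans (k.+-congˡ (ι.-‿homo s)) (kT.x≈y⇒x-y≈0 eq))))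

  π-- : ∀ x z → π (x 𝒪.- z) ≈ π x - π z
  π-- x z = trans (π.+-homo x (𝒪.- z)) (+-congˡ (π.-‿homo z))

  π-Y^ : ∀ n → π (Y 𝒪.^ n) ≈ y ^ n
  π-Y^ n = trans (hom-^ 𝒪 (Extension.ring K) π-isHom Y n) (^-congˡ n πY)

  HasScaled : 𝒪.Carrier → Fin ℓ → A.Carrier → Set e
  HasScaled x i r = ι r k.≈ ι D k.* coordinate (π x) i

  scaled-minus : ∀ {x z i r t} → HasScaled x i r → HasScaled z i t → HasScaled (x 𝒪.- z) i (r A.- t)
  scaled-minus {x} {z} {i} {r} {t} eq eq′ = begin
    ι (r A.- t)  ≈⟨ k.trans (ι.+-homo r (A.- t)) (k.+-congˡ (ι.-‿homo t)) ⟩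
    ι r k.- ι t  ≈⟨ k.+-cong eq (k.-‿cong eq′) ⟩
    ι D k.* coordinate (π x) i k.- ι D k.* coordinate (π z) i  ≈⟨ kT.x[y-z]≈xy-xz (ι D) (coordinate (π x) i) (coordinate (π z) i) ⟨
    ι D k.* (coordinate (π x) i k.- coordinate (π z) i)  ≈⟨ k.*-congˡ (k.trans (coordinate-cong (π-- x z) i) (coordinate-- (π x) (π z) i)) ⟨
    ι D k.* coordinate (π (x 𝒪.- z)) i  ∎
    where open SetoidReasoning k.setoid

  scaled-multiple : ∀ {x i r} c → HasScaled x i r → HasScaled (ψ c 𝒪.* x) i (c A.* r)
  scaled-multiple {x} {i} {r} c eq = begin
    ι (c A.* r)  ≈⟨ k.trans (ι.*-homo c r) (k.*-congˡ eq) ⟩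
    ι c k.* (ι D k.* coordinate (π x) i)  ≈⟨ k.trans (k.sym (k.*-assoc _ _ _)) (k.trans (k.*-congʳ (k.*-comm _ _)) (k.*-assoc _ _ _)) ⟩
    ι D k.* (ι c k.* coordinate (π x) i)  ≈⟨ k.*-congˡ (coordinate-* (ι c) (π x) i) ⟨
    ι D k.* coordinate (embed (ι c) * π x) i  ≈⟨ k.*-congˡ (coordinate-cong (trans (π.*-homo (ψ c) x) (*-congʳ (π∘ψ c))) i) ⟨
    ι D k.* coordinate (π (ψ c 𝒪.* x)) i  ∎
    where open SetoidReasoning k.setoid

  scaledCoordinates : ScaledCoordinates A 𝒪 ψ Y D ℓ e
  scaledCoordinates = record
    { HasScaled = HasScaled
    ; resp      = λ x≈z r≈t eq → k.trans (ι.⟦⟧-cong (A.sym r≈t)) (k.trans eq (k.*-congˡ (coordinate-cong (π.⟦⟧-cong x≈z) _)))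
    ; unique    = λ eq eq′ → ι-injective (k.trans eq (k.sym eq′))
    ; injective = λ r eq eq′ → π-injective (coordinate-injective λ i →
        kT.*-cancelˡ-domain domainₖ D≉0 (k.trans (k.sym (eq i)) (eq′ i)))
    ; exists    = scaled-integral
    ; minus     = λ {x} {z} → scaled-minus {x} {z}
    ; multiple  = λ {x} → scaled-multiple {x}
    ; ofElement = λ w i → k.trans (ι.*-homo D (w i)) (k.*-congˡ (k.sym (coordinate-unique (π-element w) i)))
    }
    where
    π-element : ∀ w → π (𝒪.sum {ℓ} λ i → ψ (w i) 𝒪.* Y 𝒪.^ toℕ i) ≈ combination (ι ∘ w)
    π-element w = trans (hom-sum 𝒪 (Extension.ring K) π-isHom {ℓ} (λ i → ψ (w i) 𝒪.* Y 𝒪.^ toℕ i))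
      (sum-cong-≋ {ℓ} λ i → trans (π.*-homo _ _) (*-cong (π∘ψ (w i)) (trans (π-Y^ (toℕ i)) (sym (vector≈ i)))))

  isCarmichael : ∀ {g h N} → D A.≈ A.1# A.+ h A.* g → ¬ (g A.∣ A.1#) → ∀ γ → π γ ≈ embed (ι g) →
                 HasCardinality (quotientRing A (principalIdeal A g)) N →
                 (∀ r → g A.∣ (r A.^ (N ℕ.^ ℓ) A.- r)) → IsCarmichaelIdeal 𝒪 (principalIdeal 𝒪 γ)
  isCarmichael {g} D≈1+hg g∤1 γ πγ = OrderQuotient.isCarmichael A 𝒪 1<ℓ ωA ψ ψ-isHom scaledCoordinates
    (π-injective (trans (π-Y^ ℓ) (trans y^ℓ≈D (sym (π∘ψ D))))) D≈1+hg g∤1 γ (π-injective (trans πγ (sym (π∘ψ g))))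

module KummerIntegers {a b c₁ e c′ e′} (A : CommutativeRing a b) (k : Field c₁ e) (_≟_ : Decidable (Field._≈_ k))
  {ℓ} (ℓ-prime : Prime ℓ) (ω : RootOfUnity (Field.commutativeRing k) ℓ)
  (ι : CommutativeRing.Carrier A → Field.Carrier k) (ι-isHom : IsHom A (Field.commutativeRing k) ι)
  {c : CommutativeRing.Carrier A} (c≈ℓ⁻¹ : Field._≈_ k (ι c) (RootOfUnity.ℓ⁻¹ ω))
  {D : CommutativeRing.Carrier A} (D≉0 : ¬ (Field._≈_ k (ι D) (Field.0# k)))
  (K : Extension k c′ e′) (B : Basis K ℓ)
  (isKummer : IsKummer ω (ι D) K B)
  (φ-isHom : IsHom A (Extension.ring K) (Extension.embed K ∘ ι))
  (integrally-closed : ∀ x → IntegralClosure.IsIntegral A (Extension.ring K) (Extension.embed K ∘ ι) φ-isHom (Extension.embed K x) →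
                       ∃ λ r → Field._≈_ k x (ι r)) where
  private
    module A = CommRing A
    module k = CommRing (Field.commutativeRing k)
    module kT = RingTheory (Field.commutativeRing k)
    module ι = RingMorphisms.IsRingHomomorphism ι-isHom
  open Extension K
  open Basis B
  open RingTheory (Extension.ring K)
  open KummerTheory k _≟_ ℓ-prime ω D≉0 K B isKummer
  open RootsOfUnityInField k _≟_ ℓ-prime ω using (ζ; 0<ℓ; ℓ⁻¹; ℓ⁻¹*ℓ≈1; orthogonality)
  open IntegralElements A (Extension.ring K) (embed ∘ ι) φ-isHom
  open IntegralClosure A (Extension.ring K) (embed ∘ ι) φ-isHom
    using (IsIntegral; integral-resp; integral-*)

  integral-y : IsIntegral y
  integral-y = root-integral 0<ℓ y^ℓ≈D

  -- The trace as a sum of conjugates instead of a matrix trace: in this form it is visibly integral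
  -- when z is.
  trace-sum : Carrier → Carrier
  trace-sum z = sum {ℓ} λ j → _≅_.⟦ σ^ toℕ j ⟧ z

  trace-sum-integral : ∀ {z} → IsIntegral z → IsIntegral (trace-sum z)
  trace-sum-integral iz = integral-sum {ℓ} λ j → image-integral (_≅_.⟦ σ^ toℕ j ⟧)
    (_≅_.isRingHomomorphism (σ^ toℕ j)) (λ r → _≅_.fixes-k (σ^ toℕ j) (ι r)) iz

  trace-sum-coordinate : ∀ z i → coordinate (trace-sum z) i k.≈ ((ℓ kT.times k.1#) k.* k.0# k.^ toℕ i) k.* coordinate z i
  trace-sum-coordinate z i = begin
    coordinate (trace-sum z) i
      ≈⟨ coordinate-sum {ℓ} (λ j → _≅_.⟦ σ^ toℕ j ⟧ z) i ⟩
    k.sum {ℓ} (λ j → coordinate (_≅_.⟦ σ^ toℕ j ⟧ z) i)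
      ≈⟨ kT.sum-cong-≋ {ℓ} (λ j → σ^n-coordinate (toℕ j) z i) ⟩
    k.sum {ℓ} (λ j → (ζ k.^ toℕ j) k.^ toℕ i k.* coordinate z i)
      ≈⟨ kT.*-distribʳ-sum {ℓ} (coordinate z i) (λ j → (ζ k.^ toℕ j) k.^ toℕ i) ⟨
    k.sum {ℓ} (λ j → (ζ k.^ toℕ j) k.^ toℕ i) k.* coordinate z i
      ≈⟨ k.*-congʳ (orthogonality (toℕ i) (Fin.toℕ<n i)) ⟩
    ((ℓ kT.times k.1#) k.* k.0# k.^ toℕ i) k.* coordinate z i ∎
    where open SetoidReasoning k.setoid

  trace-sum≈ : ∀ z → trace-sum z ≈ embed ((ℓ kT.times k.1#) k.* coordinate z 0ℓ)
  trace-sum≈ z = trans (single-coordinate 0ℓ λ j j≢0 → k.trans (trace-sum-coordinate z j)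
      (k.trans (k.*-congʳ (k.trans (k.*-congˡ (kT.0^ (≢0ℓ⇒0< j≢0))) (k.zeroʳ _))) (k.zeroˡ _)))
    (trans (*-cong (embed.⟦⟧-cong (k.trans (trace-sum-coordinate z 0ℓ) (k.*-congʳ
        (k.trans (k.*-congˡ (kT.^-congʳ k.0# toℕ-0ℓ)) (k.*-identityʳ _))))) vector-0ℓ)
      (*-identityʳ _))
    where module embed = RingMorphisms.IsRingHomomorphism isHom

  -- The sum of the conjugates of z is ℓ times its coordinate at 1. It is integral and lies in the
  -- base field, hence in A, where ℓ is invertible.
  integral-coordinate-0 : ∀ {z} → IsIntegral z → ∃ λ r → coordinate z 0ℓ k.≈ ι r
  integral-coordinate-0 {z} iz = c A.* proj₁ descended , (begin
    coordinate z 0ℓ  ≈⟨ k.trans (k.*-congʳ ℓ⁻¹*ℓ≈1) (k.*-identityˡ _) ⟨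
    (ℓ⁻¹ k.* (ℓ kT.times k.1#)) k.* coordinate z 0ℓ  ≈⟨ k.*-assoc _ _ _ ⟩
    ℓ⁻¹ k.* ((ℓ kT.times k.1#) k.* coordinate z 0ℓ)  ≈⟨ k.*-congˡ (proj₂ descended) ⟩
    ℓ⁻¹ k.* ι (proj₁ descended)  ≈⟨ k.trans (ι.*-homo c _) (k.*-congʳ c≈ℓ⁻¹) ⟨
    ι (c A.* proj₁ descended)  ∎)
    where
    open SetoidReasoning k.setoid
    descended : ∃ λ r → (ℓ kT.times k.1#) k.* coordinate z 0ℓ k.≈ ι r
    descended = integrally-closed ((ℓ kT.times k.1#) k.* coordinate z 0ℓ)
      (integral-resp {trace-sum z} (trace-sum≈ z) (trace-sum-integral iz))

  -- Multiplication by y^(ℓ-i) moves the i-th coordinate to the exponent ℓ, where y^ℓ = D brings it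
  -- to position 0. A term with j ≠ i gets an exponent strictly between 0 and 2 ℓ other than ℓ, and
  -- contributes nothing there.
  D*coordinate : ∀ x i → coordinate (x * y ^ (ℓ ∸ toℕ i)) 0ℓ k.≈ ι D k.* coordinate x i
  D*coordinate x i = begin
    coordinate (x * y ^ (ℓ ∸ toℕ i)) 0ℓ
      ≈⟨ coordinate-cong x*y^≈ 0ℓ ⟩
    coordinate (sum {ℓ} λ j → embed (coordinate x j) * y ^ (toℕ j ℕ.+ (ℓ ∸ toℕ i))) 0ℓ
      ≈⟨ coordinate-sum {ℓ} (λ j → embed (coordinate x j) * y ^ (toℕ j ℕ.+ (ℓ ∸ toℕ i))) 0ℓ ⟩
    k.sum {ℓ} (λ j → coordinate (embed (coordinate x j) * y ^ (toℕ j ℕ.+ (ℓ ∸ toℕ i))) 0ℓ)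
      ≈⟨ kT.sum-cong-≋ {ℓ} (λ j → coordinate-* (coordinate x j) (y ^ (toℕ j ℕ.+ (ℓ ∸ toℕ i))) 0ℓ) ⟩
    k.sum {ℓ} (λ j → coordinate x j k.* coordinate (y ^ (toℕ j ℕ.+ (ℓ ∸ toℕ i))) 0ℓ)
      ≈⟨ kT.sum-single {ℓ} (λ j → coordinate x j k.* coordinate (y ^ (toℕ j ℕ.+ (ℓ ∸ toℕ i))) 0ℓ) i
           (λ j j≢i → k.trans (k.*-congˡ (coordinate-0ℓ-y^ (ℕ.<-≤-trans (positive i) (ℕ.m≤n+m _ (toℕ j)))
             (ℕ.+-mono-<-≤ (Fin.toℕ<n j) (ℕ.m∸n≤m ℓ (toℕ i)))
             λ eq → j≢i (Fin.toℕ-injective (ℕ.+-cancelʳ-≡ (ℓ ∸ toℕ i) (toℕ j) (toℕ i) (≡.trans eq (≡.sym (complement i)))))))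
             (k.zeroʳ _)) ⟩
    coordinate x i k.* coordinate (y ^ (toℕ i ℕ.+ (ℓ ∸ toℕ i))) 0ℓ
      ≈⟨ k.*-congˡ (coordinate-cong y^ℓ≈ 0ℓ) ⟩
    coordinate x i k.* coordinate (embed (ι D) * vector 0ℓ) 0ℓ
      ≈⟨ k.*-congˡ (k.trans (coordinate-* (ι D) (vector 0ℓ) 0ℓ)
           (k.trans (k.*-congˡ (k.trans (coordinate-vector 0ℓ 0ℓ) (k.reflexive (δ-refl 0ℓ)))) (k.*-identityʳ _))) ⟩
    coordinate x i k.* ι D
      ≈⟨ k.*-comm _ _ ⟩
    ι D k.* coordinate x i ∎
    where
    open SetoidReasoning k.setoid
    positive : ∀ i → 0 < ℓ ∸ toℕ {ℓ} i
    positive i = ℕ.m<n⇒0<n∸m (Fin.toℕ<n i)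
    complement : ∀ i → toℕ {ℓ} i ℕ.+ (ℓ ∸ toℕ i) ≡ ℓ
    complement i = ℕ.m+[n∸m]≡n (ℕ.<⇒≤ (Fin.toℕ<n i))
    y^ℓ≈ : y ^ (toℕ i ℕ.+ (ℓ ∸ toℕ i)) ≈ embed (ι D) * vector 0ℓ
    y^ℓ≈ = trans (^-congʳ y (complement i)) (trans y^ℓ≈D (sym (trans (*-congˡ vector-0ℓ) (*-identityʳ _))))
    x*y^≈ : x * y ^ (ℓ ∸ toℕ i) ≈ sum {ℓ} λ j → embed (coordinate x j) * y ^ (toℕ j ℕ.+ (ℓ ∸ toℕ i))
    x*y^≈ = trans (*-congʳ (spanning x)) (trans (*-distribʳ-sum {ℓ} (y ^ (ℓ ∸ toℕ i)) (λ j → embed (coordinate x j) * vector j))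
      (sum-cong-≋ {ℓ} λ j → trans (*-assoc _ _ _) (*-congˡ (trans (*-congʳ (vector≈ j)) (sym (^-homo-* y (toℕ j) (ℓ ∸ toℕ i)))))))

  opaque
    scaled-integral : ∀ {x} → IsIntegral x → ∀ i → ∃ λ r → ι r k.≈ ι D k.* coordinate x i
    scaled-integral {x} ix i = proj₁ descended , k.trans (k.sym (proj₂ descended)) (D*coordinate x i)
      where
      descended : ∃ λ r → coordinate (x * y ^ (ℓ ∸ toℕ i)) 0ℓ k.≈ ι r
      descended = integral-coordinate-0 (integral-* {x} {y ^ (ℓ ∸ toℕ i)} ix (integral-^ {y} (ℓ ∸ toℕ i) integral-y))

-- The sequence of Kummer extensions

module KummerFamily {c e c′ e′} (F : Field c e) {n-1} (|F|≡n : HasCardinality (Field.commutativeRing F) (suc n-1))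
  (_≟_ : Decidable (Field._≈_ F)) {ℓ} (ℓ-prime : Prime ℓ) (0<n-1 : 0 < n-1) (ℓ∣n-1 : ℓ ℕ.∣ n-1)
  (k : Field c′ e′) (_≟k_ : Decidable (Field._≈_ k))
  (ι : List (Field.Carrier F) → Field.Carrier k)
  (ι-isHom : IsHom (Polynomials.polynomialRing (Field.commutativeRing F)) (Field.commutativeRing k) ι)
  (ι≈0⇒≈0 : ∀ {p} → Field._≈_ k (ι p) (Field.0# k) → Polynomials._≈ₚ_ (Field.commutativeRing F) p [])
  (fraction : ∀ x → ∃₂ λ p q → ¬ (Polynomials._≈ₚ_ (Field.commutativeRing F) q []) × Field._≈_ k (Field._*_ k (ι q) x) (ι p))
  where
  open PolynomialsOverField F _≟_
  private
    module F = Field F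
    module k = CommRing (Field.commutativeRing k)
    module kT = RingTheory (Field.commutativeRing k)
    module ι = RingMorphisms.IsRingHomomorphism ι-isHom

  ωA : RootOfUnity polynomialRing ℓ
  ωA = mapRootOfUnity F.commutativeRing polynomialRing constant-isHom (rootOfUnity F |F|≡n ℓ-prime 0<n-1 ℓ∣n-1)

  ω : RootOfUnity (Field.commutativeRing k) ℓ
  ω = mapRootOfUnity polynomialRing (Field.commutativeRing k) ι-isHom ωA

  open RootsOfUnityInField k _≟k_ ℓ-prime ω using (0<ℓ; 1<ℓ; domainₖ)

  ι-injective : ∀ {p q} → ι p k.≈ ι q → p ≈ₚ q
  ι-injective {p} {q} eq = PT.x-y≈0⇒x≈y (ι≈0⇒≈0 (k.trans (ι.+-homo p (-ₚ q))
    (k.trans (k.+-congˡ (ι.-‿homo q)) (kT.x≈y⇒x-y≈0 eq))))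

  ι-^ : ∀ p m → ι (p P.^ m) k.≈ ι p k.^ m
  ι-^ = hom-^ polynomialRing (Field.commutativeRing k) ι-isHom

  clear-denominators : ∀ {x p q X Y} → ι q k.* x k.≈ ι p → ι X k.≈ x k.^ ℓ k.* ι Y → q P.^ ℓ *ₚ X ≈ₚ p P.^ ℓ *ₚ Y
  clear-denominators {x} {p} {q} {X} {Y} qx≈p eq = ι-injective (begin
    ι (q P.^ ℓ *ₚ X)  ≈⟨ k.trans (ι.*-homo (q P.^ ℓ) X) (k.*-cong (ι-^ q ℓ) eq) ⟩
    ι q k.^ ℓ k.* (x k.^ ℓ k.* ι Y)  ≈⟨ k.*-assoc _ _ _ ⟨
    (ι q k.^ ℓ k.* x k.^ ℓ) k.* ι Y  ≈⟨ k.*-congʳ (k.trans (k.sym (kT.^-distrib-* (ι q) x ℓ)) (kT.^-congˡ ℓ qx≈p)) ⟩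
    ι p k.^ ℓ k.* ι Y  ≈⟨ k.trans (ι.*-homo (p P.^ ℓ) Y) (k.*-congʳ (ι-^ p ℓ)) ⟨
    ι (p P.^ ℓ *ₚ Y)  ∎)
    where open SetoidReasoning k.setoid

  -- As x is a quotient of polynomials, clearing its denominator leads to the polynomial identity
  -- treated by `power-ratio-degree`.
  power-quotient⇒∣degree : ∀ {X Y m} → PT.Comaximal X Y → HasDegree X m → (∃ λ x → ι X k.≈ x k.^ ℓ k.* ι Y) → ℓ ℕ.∣ m
  power-quotient⇒∣degree {X} {Y} XY hX (x , eq) = go (fraction x)
    where
    go : (∃₂ λ p q → ¬ (q ≈ₚ []) × ι q k.* x k.≈ ι p) → ℓ ℕ.∣ _
    go (p , q , q≉0 , qx≈p) = power-ratio-degree ℓ {p} {q} {X} {Y} 0<ℓ q≉0 XY (clear-denominators {x} {p} {q} {X} {Y} qx≈p eq) hX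

  t : Poly
  t = F.0# ∷ F.1# ∷ []

  t-degree : HasDegree t 1
  t-degree = (λ 1≈0 → proj₁ F.isField (F.sym 1≈0)) , λ { (suc zero) (s≤s ()) ; (suc (suc m)) _ → F.refl }

  -- The summand 1 makes the result comaximal to every divisor of G, and the factor t moves its
  -- degree away from the multiples of ℓ.
  next : Poly → Poly
  next G = 1ₚ +ₚ t *ₚ G P.^ ℓ

  next-degree : ∀ {G m} → HasDegree G m → HasDegree (next G) (suc (ℓ ℕ.* m))
  next-degree {G} {m} hG = degree-resp {t *ₚ G P.^ ℓ +ₚ 1ₚ} {next G} (+ₚ-comm (t *ₚ G P.^ ℓ) 1ₚ)
    (degree-+-below {t *ₚ G P.^ ℓ} {1ₚ} (degree-* {t} {G P.^ ℓ} t-degree (degree-^ {G} ℓ hG))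
      (below-mono {1ₚ} {1} (s≤s z≤n) (proj₂ degree-1)))

  ∣⇒∣next-1 : ∀ {p G} → p P.∣ G → p P.∣ (t *ₚ G P.^ ℓ)
  ∣⇒∣next-1 {p} {G} p∣G = PT.∣-*ˡ {p} {G P.^ ℓ} t (PT.∣-trans {p} {G} {G P.^ ℓ} p∣G (PT.∣-respˡ {G P.^ ℓ} (*ₚ-identityʳ G) (PT.^-mono-∣ G 0<ℓ)))

  ℓ∤1+ℓm : ∀ m → ¬ (ℓ ℕ.∣ suc (ℓ ℕ.* m))
  ℓ∤1+ℓm m ℓ∣ = ℕ.<⇒≱ 1<ℓ (ℕ.∣⇒≤ (ℕ.∣m+n∣m⇒∣n (≡.subst (ℓ ℕ.∣_) (ℕ.+-comm 1 (ℓ ℕ.* m)) ℓ∣) (ℕ.m∣m*n m)))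

  module Integers {g D h} (D≉0 : ¬ (ι D k.≈ k.0#)) (D≈1+hg : D ≈ₚ 1ₚ +ₚ h *ₚ g)
    {c₁ e₁} (K : Extension k c₁ e₁) (B : Basis K ℓ) (isKummer : IsKummer ω (ι D) K B)
    (φ-isHom : IsHom polynomialRing (Extension.ring K) (Extension.embed K ∘ ι)) where
    private
      module L = Extension K
      open KummerTheory k _≟k_ ℓ-prime ω D≉0 K B isKummer
        using (y; y^ℓ≈D; embed≈0⇒≈0; power-basis-discriminant)
    module 𝒪 = IntegralClosure polynomialRing L.ring (L.embed ∘ ι) φ-isHom
    open IntegralElements polynomialRing L.ring (L.embed ∘ ι) φ-isHom

    -- In lowest terms the denominator of an integral fraction is a unit.
    integrally-closed : ∀ x → 𝒪.IsIntegral (L.embed x) → ∃ λ r → x k.≈ ι r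
    integrally-closed x ix = go (fraction x)
      where
      module embed = RingMorphisms.IsRingHomomorphism L.isHom
      go : (∃₂ λ p q → ¬ (q ≈ₚ []) × ι q k.* x k.≈ ι p) → ∃ λ r → x k.≈ ι r
      go (p , q , q≉0 , qx≈p) = reduced (reduce-pair p q q≉0)
        where
        reduced : ReducedPair p q → ∃ λ r → x k.≈ ι r
        reduced pair = PT.quotient b′∣1 *ₚ a′ , (begin
          x  ≈⟨ k.trans (k.*-congʳ ι.1#-homo) (k.*-identityˡ x) ⟨
          ι 1ₚ k.* x  ≈⟨ k.*-congʳ (ι.⟦⟧-cong (PT.quotient*divisor b′∣1)) ⟨
          ι (PT.quotient b′∣1 *ₚ b′) k.* x  ≈⟨ k.trans (k.*-congʳ (ι.*-homo (PT.quotient b′∣1) b′)) (k.*-assoc _ _ _) ⟩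
          ι (PT.quotient b′∣1) k.* (ι b′ k.* x)  ≈⟨ k.*-congˡ b′x≈a′ ⟩
          ι (PT.quotient b′∣1) k.* ι a′  ≈⟨ ι.*-homo (PT.quotient b′∣1) a′ ⟨
          ι (PT.quotient b′∣1 *ₚ a′)  ∎)
          where
          open SetoidReasoning k.setoid
          open ReducedPair pair
          b′x≈a′ : ι b′ k.* x k.≈ ι a′
          b′x≈a′ = domain-cancelʳ (Field.commutativeRing k) domainₖ {z = ι s} (s≉0 ∘ ι≈0⇒≈0) (begin
            (ι b′ k.* x) k.* ι s  ≈⟨ k.trans (k.*-assoc _ _ _) (k.trans (k.*-congˡ (k.*-comm x (ι s))) (k.sym (k.*-assoc _ _ _))) ⟩
            (ι b′ k.* ι s) k.* x  ≈⟨ k.*-congʳ (k.trans (k.sym (ι.*-homo b′ s)) (ι.⟦⟧-cong b′s≈b)) ⟩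
            ι q k.* x  ≈⟨ qx≈p ⟩
            ι p  ≈⟨ k.trans (k.sym (ι.*-homo a′ s)) (ι.⟦⟧-cong a′s≈a) ⟨
            ι a′ k.* ι s  ∎)
          b′∣1 : b′ P.∣ 1ₚ
          b′∣1 = denominator-unit (ι≈0⇒≈0 ∘ embed≈0⇒≈0) {L.embed x} {a′} {b′} ix
            (L.trans (L.sym (embed.*-homo (ι b′) x)) (embed.⟦⟧-cong b′x≈a′)) comaximal

    power-basis : Fin ℓ → CommutativeRing.Carrier 𝒪.integralClosure
    power-basis i = y L.^ toℕ i , integral-^ (toℕ i) (root-integral 0<ℓ y^ℓ≈D)

    D-comaximal : PT.Comaximal g D
    D-comaximal = PT.comaximal-1+ {g} {h} {D} D≈1+hg

    ℓₚ : Poly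
    ℓₚ = ℓ PT.times 1ₚ

    power-basis-discriminantₚ : ∃ λ m → Basis.discriminant B (λ i → y L.^ toℕ i) k.≈ kT.signed-power (ι ℓₚ) (ι D) m (ℓ ∸ 1)
    power-basis-discriminantₚ = power-basis-discriminant (ι ℓₚ)
      (hom-times polynomialRing (Field.commutativeRing k) ι-isHom ℓ) (λ i → y L.^ toℕ i) λ i → L.refl

    discriminant-polynomial : Poly
    discriminant-polynomial = PT.signed-power ℓₚ D (proj₁ power-basis-discriminantₚ) (ℓ ∸ 1)

    ι-discriminant-polynomial : Basis.discriminant B (λ i → y L.^ toℕ i) k.≈ ι discriminant-polynomial
    ι-discriminant-polynomial = k.trans (proj₂ power-basis-discriminantₚ) (k.sym
      (hom-signed-power polynomialRing (Field.commutativeRing k) ι-isHom ℓₚ D (proj₁ power-basis-discriminantₚ) (ℓ ∸ 1)))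

    -- One member of the discriminant ideal that is comaximal to g is enough: an irreducible factor
    -- of g dividing the whole ideal would divide this member. Here ℓ is a unit and D is 1 modulo g.
    discriminant-comaximal : PT.Comaximal discriminant-polynomial g
    discriminant-comaximal = PT.comaximal-signed-power {ℓₚ} {RootOfUnity.ℓ⁻¹ ωA} {D} {g}
      (proj₁ power-basis-discriminantₚ) (ℓ ∸ 1) (RootOfUnity.ℓ⁻¹*ℓ≈1 ωA) (PT.comaximal-sym {g} {D} D-comaximal)

  module Sequence {g d} (g-degree : HasDegree g d) (g∤1 : ¬ (g P.∣ 1ₚ)) where
    -- Euclid's construction of infinitely many primes: `G j` is the product of g and all earlier
    -- `D i`, and `D j` is 1 modulo it.
    G D : ℕ → Poly
    G zero    = g
    G (suc j) = G j *ₚ next (G j)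
    D j = next (G j)

    G-degree : ∀ j → ∃ (HasDegree (G j))
    G-degree zero    = d , g-degree
    G-degree (suc j) = _ , degree-* {G j} {D j} (proj₂ (G-degree j)) (next-degree {G j} (proj₂ (G-degree j)))

    D-degree : ∀ j → HasDegree (D j) (suc (ℓ ℕ.* proj₁ (G-degree j)))
    D-degree j = next-degree {G j} (proj₂ (G-degree j))

    g∣G : ∀ j → g P.∣ G j
    g∣G zero    = PT.∣-refl {g}
    g∣G (suc j) = PT.∣-*ʳ {g} {G j} (D j) (g∣G j)

    D∣G : ∀ {i j} → i < j → D i P.∣ G j
    D∣G {i} {suc j} (s≤s i≤j) = by-cases (ℕ.m≤n⇒m<n∨m≡n i≤j)
      where
      by-cases : i < j ⊎ i ≡ j → D i P.∣ G (suc j)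
      by-cases (inj₁ i<j)    = PT.∣-*ʳ {D i} {G j} (D j) (D∣G i<j)
      by-cases (inj₂ ≡.refl) = PT.∣-*ˡ {D i} {D i} (G i) (PT.∣-refl {D i})

    comaximal-D : ∀ {p j} → p P.∣ G j → PT.Comaximal p (D j)
    comaximal-D {p} {j} p∣G = PT.∣⇒comaximal-1+ {p} {t *ₚ G j P.^ ℓ} (∣⇒∣next-1 {p} {G j} p∣G)

    D-comaximal : ∀ {i j} → i ≢ j → PT.Comaximal (D i) (D j)
    D-comaximal {i} {j} i≢j = by-cases (ℕ.<-cmp i j)
      where
      by-cases : _ → PT.Comaximal (D i) (D j)
      by-cases (tri< i<j _ _) = comaximal-D {D i} {j} (D∣G i<j)
      by-cases (tri≈ _ i≡j _) = ⊥-elim (i≢j i≡j)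
      by-cases (tri> _ _ j<i) = PT.comaximal-sym {D j} {D i} (comaximal-D {D j} {i} (D∣G j<i))

    D≉0 : ∀ j → ¬ (ι (D j) k.≈ k.0#)
    D≉0 j = degree≉0 {D j} (D-degree j) ∘ ι≈0⇒≈0

    -- The degree criterion is applied with Y = 1; it would make ℓ divide a number that is 1 modulo
    -- ℓ.
    D-not-power : ∀ j β → ¬ (β k.^ ℓ k.≈ ι (D j))
    D-not-power j β β^ℓ≈D = ℓ∤1+ℓm (proj₁ (G-degree j)) (power-quotient⇒∣degree {D j} {1ₚ}
      (PT.comaximal-sym {1ₚ} {D j} (PT.comaximal-1 (D j))) (D-degree j)
      (β , k.trans (k.sym β^ℓ≈D) (k.trans (k.sym (k.*-identityʳ _)) (k.*-congˡ (k.sym ι.1#-homo)))))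

    module K (j : ℕ) where
      open KummerExtension k _≟k_ ℓ-prime ω (D≉0 j) (D-not-power j) public using (extension; basis; isKummer)

    opaque
      cyclicExtension : ℕ → CyclicExtension k c′ e′ ℓ
      cyclicExtension j = record
        { extension = K.extension j
        ; basis     = K.basis j
        ; isGalois  = KT.isGalois
        ; isCyclic  = KT.isCyclic
        }
        where module KT = KummerTheory k _≟k_ ℓ-prime ω (D≉0 j) (K.extension j) (K.basis j) (K.isKummer j)

      isKummer : ∀ j → IsKummer ω (ι (D j)) (CyclicExtension.extension (cyclicExtension j)) (CyclicExtension.basis (cyclicExtension j))
      isKummer j = K.isKummer j

      -- An isomorphism gives D_i = a^ℓ D_j^m for some m. Whatever m is, D_j^m is comaximal to D_i,
      -- so the degree criterion applies with Y = D_j^m.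
      non-isomorphic : ∀ {i j} → i ≢ j → ¬ (cyclicExtension i ≅ᶜ cyclicExtension j)
      non-isomorphic {i} {j} i≢j iso = go (isomorphic-kummer k _≟k_ ℓ-prime ω (D≉0 i) (D≉0 j)
          (K.extension i) (K.basis i) (K.extension j) (K.basis j) (K.isKummer i) (K.isKummer j) iso)
        where
        go : (∃₂ λ a m → ι (D i) k.≈ a k.^ ℓ k.* ι (D j) k.^ m) → ⊥
        go (a , m , eq) = ℓ∤1+ℓm (proj₁ (G-degree i)) (power-quotient⇒∣degree {D i} {D j P.^ m}
          (PT.comaximal-sym {D j P.^ m} {D i} (PT.comaximal-^ {D j} {D i} m (PT.comaximal-sym {D i} {D j} (D-comaximal i≢j))))
          (D-degree i) (a , k.trans eq (k.*-congˡ (k.sym (ι-^ (D j) m)))))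

    g∣D-1 : ∀ j → g P.∣ (t *ₚ G j P.^ ℓ)
    g∣D-1 j = ∣⇒∣next-1 {g} {G j} (g∣G j)

    D≈1+hg : ∀ j → D j ≈ₚ 1ₚ +ₚ PT.quotient (g∣D-1 j) *ₚ g
    D≈1+hg j = P.+-congˡ {x = 1ₚ} (P.sym (PT.quotient*divisor (g∣D-1 j)))

-- Extensions of the rational function field, and the theorem

-- Taken as an instance argument, this leaves the element itself to be found
-- by unification with a goal, before anything about it has to be checked.
record HasValue {a b} {A : Set a} (_≈_ : A → A → Set b) (x y : A) : Set b where
  constructor hasValue
  field value : x ≈ y

module _ {c e} (F : Field c e) {n-1} (|F|≡n : HasCardinality (Field.commutativeRing F) (suc n-1))
         {ℓ} (ℓ-prime : Prime ℓ) (0<n-1 : 0 < n-1) (ℓ∣n-1 : ℓ ℕ.∣ n-1) where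
  open RationalFunctions F |F|≡n using (_≟F_; F⟨t⟩; module Frac)
  open PolynomialsOverField F _≟F_

  _≟ᶠ_ : Decidable Frac._≈ᶠ_
  x ≟ᶠ y = map′ Frac.cross Frac.cross-≈ ((Frac.num x *ₚ Frac.den y) ≟ₚ (Frac.num y *ₚ Frac.den x))

  fromA≈0⇒≈0 : ∀ {p} → Frac.fromA p Frac.≈ᶠ Frac.fromA [] → p ≈ₚ []
  fromA≈0⇒≈0 {p} (Frac.cross eq) = P.trans (P.sym (*ₚ-identityʳ p)) eq

  numerator-denominator : ∀ x → ∃₂ λ p q → ¬ (q ≈ₚ []) × Frac.fromA q Frac.*ᶠ x Frac.≈ᶠ Frac.fromA p
  numerator-denominator x = Frac.num x , Frac.den x , Frac.den≉0 x , Frac.cross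
    (P.trans (*ₚ-identityʳ (Frac.den x *ₚ Frac.num x)) (P.trans (*ₚ-comm (Frac.den x) (Frac.num x))
      (P.*-congˡ {x = Frac.num x} (P.sym (*ₚ-identityˡ (Frac.den x))))))

  module RationalFamily = KummerFamily F |F|≡n _≟F_ ℓ-prime 0<n-1 ℓ∣n-1 F⟨t⟩ _≟ᶠ_ Frac.fromA Frac.fromA-isHom
    (λ {p} → fromA≈0⇒≈0 {p}) numerator-denominator
  open RationalFamily using (ωA; ω)

  module _ {g D h d} (g-degree : HasDegree g d) (g∤1 : ¬ (g P.∣ 1ₚ))
    (D≉0 : ¬ (Frac.fromA D Frac.≈ᶠ Frac.fromA [])) (D≈1+hg : D ≈ₚ 1ₚ +ₚ h *ₚ g)
    {c₁ e₁} (K : Extension F⟨t⟩ c₁ e₁) (B : Basis K ℓ) (isKummer : IsKummer ω (Frac.fromA D) K B) where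
    private
      module K = Extension K

      φ-isHom : IsHom polynomialRing K.ring (K.embed ∘ Frac.fromA)
      φ-isHom = Composition.isRingHomomorphism K.trans Frac.fromA-isHom K.isHom

      module φ = RingMorphisms.IsRingHomomorphism φ-isHom
      module I = RationalFamily.Integers {g} {D} {h} D≉0 D≈1+hg K B isKummer φ-isHom
      module KI = KummerIntegers polynomialRing F⟨t⟩ _≟ᶠ_ ℓ-prime ω Frac.fromA Frac.fromA-isHom
        {RootOfUnity.ℓ⁻¹ ωA} (Field.refl F⟨t⟩ {RootOfUnity.ℓ⁻¹ ω}) {D} D≉0 K B isKummer φ-isHom I.integrally-closed

      proj₁-isHom : IsHom (RationalFunctions.𝒪-ring F |F|≡n K) K.ring proj₁
      proj₁-isHom = mkIsHom (RationalFunctions.𝒪-ring F |F|≡n K) K.ring id (λ _ _ → K.refl) K.refl (λ _ _ → K.refl) K.refl (λ _ → K.refl)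

      fromPolynomial-isHom : IsHom polynomialRing (RationalFunctions.𝒪-ring F |F|≡n K) (RationalFunctions.fromPolynomial F |F|≡n K)
      fromPolynomial-isHom = mkIsHom polynomialRing (RationalFunctions.𝒪-ring F |F|≡n K)
        φ.⟦⟧-cong φ.+-homo φ.0#-homo φ.*-homo φ.1#-homo φ.-‿homo

    carmichael : (∀ r → g P.∣ (r P.^ ((suc n-1 ℕ.^ d) ℕ.^ ℓ) P.- r)) → ∀ {α} →
                 {{HasValue K._≈_ (proj₁ α) (K.embed (Frac.fromA g))}} → RationalFunctions.IsCarmichaelIn F |F|≡n K α
    carmichael fermat {α} {{α≈g}} = KummerOrder.isCarmichael polynomialRing F⟨t⟩ _≟ᶠ_ ℓ-prime ωA ω Frac.fromA Frac.fromA-isHom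
      (λ {p} → fromA≈0⇒≈0 {p}) {D} D≉0 K B isKummer
      (RationalFunctions.𝒪-ring F |F|≡n K) proj₁ proj₁-isHom id (RationalFunctions.fromPolynomial F |F|≡n K) fromPolynomial-isHom
      (λ _ → K.refl) (IsKummer.y isKummer , KI.integral-y) K.refl (λ x → KI.scaled-integral (proj₂ x))
      {g} {h} {suc n-1 ℕ.^ d} D≈1+hg g∤1 α (HasValue.value α≈g)
      (ResidueRing.principal-cardinality F _≟F_ {g} {d} g-degree |F|≡n) fermat

    discriminant-prime : RationalFunctions.RelativelyPrimeTo F |F|≡n g (RationalFunctions.discriminantIdeal F |F|≡n K B)
    discriminant-prime p irr p∣g p∣discriminants = P.Irreducible.p∤1 irr
      (PT.euclid {p} {I.discriminant-polynomial} {1ₚ} p-comaximal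
        (PT.∣-*ʳ {p} {I.discriminant-polynomial} 1ₚ (p∣discriminants I.discriminant-polynomial
          (RationalFunctions.resp-≈ I.ι-discriminant-polynomial (RationalFunctions.discriminant I.power-basis)))))
      where
      p-comaximal : PT.Comaximal p I.discriminant-polynomial
      p-comaximal = PT.comaximal-∣ {p} {g} {I.discriminant-polynomial} p∣g
        (PT.comaximal-sym {I.discriminant-polynomial} {g} I.discriminant-comaximal)

-- A factor whose degree does not divide d is, by the classification, one of the P_i and so has
-- degree ℓ; both kinds of degree divide the exponent d ℓ.
factor-degree-∣ : ∀ {c e} {F : Field c e} (_≟_ : Decidable (Field._≈_ F)) → let open PolynomialsOverField F _≟_ in
  ∀ {g : Poly} {d ℓ s} (P : Fin s → Poly) →
  (∀ Q → (∃[ m ] (IsMonicOfDegree Q m × CommRing.Irreducible polynomialRing Q × CommRing._∣_ polynomialRing Q g × ¬ (m ℕ.∣ d)))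
         ⇔ (∃[ i ] (Q ≈ₚ P i))) →
  (∀ i → HasDegree (P i) ℓ) →
  ∀ Q m → CommRing.Irreducible polynomialRing Q → IsMonicOfDegree Q m → CommRing._∣_ polynomialRing Q g → m ℕ.∣ d ℕ.* ℓ
factor-degree-∣ {F = F} _≟_ {g} {d} {ℓ} P classification P-degree Q m irr monic Q∣g = by-cases (m ℕ.∣? d)
  where
  open PolynomialsOverField F _≟_
  module F = Field F
  Q-degree : HasDegree Q m
  Q-degree = (λ eq → proj₁ F.isField (F.trans (F.sym eq) (proj₁ monic))) , proj₂ monic
  by-cases : Dec (m ℕ.∣ d) → m ℕ.∣ d ℕ.* ℓ
  by-cases (yes m∣d) = ℕ.∣m⇒∣m*n ℓ m∣d
  by-cases (no  m∤d) = ℕ.∣n⇒∣m*n d (ℕ.∣-reflexive (degree-unique {P i} (degree-resp {Q} {P i} Q≈Pᵢ Q-degree) (P-degree i)))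
    where
    match = Equivalence.to (classification Q) (m , monic , irr , Q∣g , m∤d)
    i = proj₁ match
    Q≈Pᵢ = proj₂ match

open import Data.Nat.Divisibility using (_∣_)

theorem5p5 : ∀ {c e} (q : ℕ) (F : Field c e) (|F|≡q : HasCardinality (Field.commutativeRing F) q) →
    3 ≤ q →
    let open RationalFunctions F |F|≡q in
    (g : Poly) (d : ℕ) → HasDegree g d → 1 ≤ d → SquareFree g →
    (ℓ : ℕ) → Prime ℓ → ℓ ∣ q ∸ 1 →
    (s : ℕ) (P : Fin s → Poly) →
    (∀ Q → (∃[ m ] (IsMonicOfDegree Q m × Irreducible Q × Q ∣ₚ g × ¬ (m ∣ d))) ⇔ (∃[ i ] (Q ≈ₚ P i))) →
    (∀ i → HasDegree (P i) ℓ) →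
    InfinitelyMany {A = CyclicExtension F⟨t⟩ (c ⊔ e) e ℓ} _≅ᶜ_
    (λ K → let open CyclicExtension K in
    RelativelyPrimeTo g (discriminantIdeal extension basis) ×
    IsCarmichaelIn extension (fromPolynomial extension g))
theorem5p5 zero F |F|≡q ()
theorem5p5 (suc n-1) F |F|≡q (s≤s 2≤n-1) g d g-degree 1≤d squarefree ℓ ℓ-prime ℓ∣n-1 s P classification P-degree =
  S.cyclicExtension ,
  (λ j → discriminant-prime F |F|≡q ℓ-prime 0<n-1 ℓ∣n-1 {g} {S.D j} {h j} g-degree g∤1 (S.D≉0 j) (S.D≈1+hg j)
           (extension (S.cyclicExtension j)) (basis (S.cyclicExtension j)) (S.isKummer j)
       , carmichael F |F|≡q ℓ-prime 0<n-1 ℓ∣n-1 {g} {S.D j} {h j} g-degree g∤1 (S.D≉0 j) (S.D≈1+hg j)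
           (extension (S.cyclicExtension j)) (basis (S.cyclicExtension j)) (S.isKummer j)
           fermat) ,
  λ i≢j → S.non-isomorphic i≢j
  where
  open RationalFunctions F |F|≡q using (_≟F_)
  open CyclicExtension using (extension; basis)
  open PolynomialsOverField F _≟F_
  0<n-1 : 0 < n-1
  0<n-1 = ℕ.<-≤-trans (s≤s z≤n) 2≤n-1
  g∤1 : ¬ (g P.∣ 1ₚ)
  g∤1 = degree>0⇒∤1 {g} g-degree 1≤d
  module S = RationalFamily.Sequence F |F|≡q ℓ-prime 0<n-1 ℓ∣n-1 {g} {d} g-degree g∤1
  h : ℕ → Poly
  h j = PT.quotient (S.g∣D-1 j)
  -- The exponent is the size of the quotient of the ring of integers, ℓ copies of the q^d residues
  -- modulo g, rewritten as q^(d ℓ).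
  fermat : ∀ r → g P.∣ (r P.^ ((suc n-1 ℕ.^ d) ℕ.^ ℓ) P.- r)
  fermat r = ≡.subst (λ N → g P.∣ (r P.^ N P.- r)) (≡.sym (ℕ.^-*-assoc (suc n-1) d ℓ))
    (squarefree-∣-fermat F |F|≡q _≟F_ {g} {d} {d ℕ.* ℓ} g-degree squarefree
      (factor-degree-∣ {F = F} _≟F_ {g} {d} {ℓ} P classification P-degree) r)
  instance
    g-value : ∀ {j} → let module K = Extension (extension (S.cyclicExtension j)) in
              HasValue K._≈_ (K.embed (RationalFunctions.Frac.fromA F |F|≡q g)) (K.embed (RationalFunctions.Frac.fromA F |F|≡q g))
    g-value {j} = hasValue (Extension.refl (extension (S.cyclicExtension j))
      {Extension.embed (extension (S.cyclicExtension j)) (RationalFunctions.Frac.fromA F |F|≡q g)})
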